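{- For every fixed positive integer $d$ there are positive constants $C$ and $c$ depending only on $d$ such that the following holds. For any positive integers $n$ and $l$ and any set $A\subseteq[n]=\{1,\dots,n\}$ satisfying $l\le |A|/2$ and $l^d|A|\ge Cn$, the set $l^{\ast}A$ contains a proper generalized arithmetic progression of rank $d'$ and volume at least $c\,l^{d'}|A|$, for some integer $1\le d'\le d$.
   Context: $l^{\ast}A=\{a_1+\dots+a_l : a_i\in A,\ a_i\ne a_j \text{ for } i\ne j\}$ (sums of $l$ distinct elements of $A$). A generalized arithmetic progression (GAP) of rank $d$ is a set $Q=\{a+\sum_{i=1}^d x_i a_i : 0\le x_i\le n_i \text{ integers}\}$, together with its data $a,a_1,\dots,a_d,n_1,\dots,n_d$; its volume is $\prod_{i=1}^d n_i$; it is proper if $(x_1,\dots,x_d)\mapsto a+\sum x_ia_i$ is injective on $\{0\le x_i\le n_i\}$. -}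

module Defs where

open import Data.Nat using (ℕ; zero; suc; _*_; _≤_; _^_)
import Data.Nat as ℕ
open import Data.Integer using (ℤ; +_) renaming (_+_ to _+ℤ_; _*_ to _*ℤ_)
open import Data.Fin using (Fin; toℕ) renaming (zero to fz; suc to fs)
open import Data.List using (List; length)
open import Data.Nat.ListAction using (sum)
open import Data.List.Relation.Unary.All using (All)
open import Data.List.Relation.Unary.Unique.Propositional using (Unique)
open import Data.List.Membership.Propositional using (_∈_)
open import Data.Product using (Σ; _×_; ∃)
open import Relation.Binary.PropositionalEquality using (_≡_)

IsFinSet : List ℕ → Set
IsFinSet A = Unique A

SubsetOfRange : ℕ → List ℕ → Set
SubsetOfRange n A = All (λ a → 1 ≤ a × a ≤ n) A

InSumset : ℕ → List ℕ → ℕ → Set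
InSumset l A x =
  Σ (List ℕ) λ B → Unique B × All (_∈ A) B × length B ≡ l × sum B ≡ x

sumFinℤ : (k : ℕ) → (Fin k → ℤ) → ℤ
sumFinℤ zero f = + 0
sumFinℤ (suc k) f = f fz +ℤ sumFinℤ k (λ i → f (fs i))

prodFin : (k : ℕ) → (Fin k → ℕ) → ℕ
prodFin zero f = 1
prodFin (suc k) f = f fz * prodFin k (λ i → f (fs i))

-- Data of a generalized arithmetic progression of rank k:
-- base a, steps a_i, bounds n_i; elements a + Σ x_i a_i with 0 ≤ x_i ≤ n_i.
record GAP (k : ℕ) : Set where
  constructor mkGAP
  field
    base  : ℤ
    step  : Fin k → ℤ
    bound : Fin k → ℕ

open GAP public

Coord : {k : ℕ} → GAP k → Set
Coord {k} Q = (i : Fin k) → Fin (suc (bound Q i))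

eval : {k : ℕ} → (Q : GAP k) → Coord Q → ℤ
eval {k} Q x = base Q +ℤ sumFinℤ k (λ i → (+ toℕ (x i)) *ℤ step Q i)

volume : {k : ℕ} → GAP k → ℕ
volume {k} Q = prodFin k (bound Q)

Proper : {k : ℕ} → GAP k → Set
Proper {k} Q = (x y : Coord Q) → eval Q x ≡ eval Q y → (i : Fin k) → toℕ (x i) ≡ toℕ (y i)

GAPSubset : {k : ℕ} → GAP k → (ℕ → Set) → Set
GAPSubset Q S = (x : Coord Q) → ∃ λ s → S s × eval Q x ≡ + s

{-# OPTIONS --safe #-}
{-
Deleting from A the few elements whose removal destroys the growth of the sets of
sums of 2ⁱ distinct elements leaves a set with a scale j such that the sums of j
distinct elements have bounded doubling and survive any small deletion.  Choosing
representations in which no element is used too often produces many sums of 2j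
elements that can be represented while avoiding any given small set.  Sums of such
robust elements are automatically sums of distinct elements, so distinctness is no
longer an issue; passing to a popular reflection z ↦ σ - z of the robust set turns
differences into sums as well and gives a symmetric S with S + S covered by
boundedly many translates x + S, x ∈ X.

Integral multiples of a few elements of X, chosen independent modulo S at a scale far
larger than the one at which they generate, serve as a coordinate frame: S plus small
combinations of X becomes a finite group modulo the frame, walking along b, 2b, 3b, …
until it closes up gives every b exact rational coordinates, and these are additive.
So S is a box in a lattice of bounded rank on which the map to ℤ is injective.  An
elementary reduction (project along a shortest vector) produces independent lattice
vectors spanning a progression of comparable volume.  Since the multiples i s with
i ≤ t lie in S + [-2t,2t]X, the coordinates of S are t times smaller than those of the
enlarged set, and the sides of the progression gain a factor t.  The rank is at most d
because all sums lie in [0, l n].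
-}
module Submission where

open import Defs
open import Data.Nat using (ℕ; zero; suc; _+_; _*_; _∸_; _^_; _≤_; _<_; _≤?_; _<?_; z≤n; s≤s; NonZero; _!)
import Data.Nat as ℕ
import Data.Nat.Properties as ℕP
open import Data.Nat.Divisibility using (_∣_; divides)
import Data.Nat.Divisibility as ℕD
import Data.Nat.DivMod as ℕDM
open import Data.Nat.Tactic.RingSolver using () renaming (solve-∀ to ring-ℕ)
open import Data.Integer using (ℤ; -[1+_]; ∣_∣) renaming (+_ to pos)
import Data.Integer as ℤ
import Data.Integer.Properties as ℤP
import Data.Integer.DivMod as ℤDM
open import Data.Integer.Tactic.RingSolver using () renaming (solve-∀ to ring-ℤ)
open import Data.Fin using (Fin; toℕ)
import Data.Fin as Fin
import Data.Fin.Properties as FinP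
open import Data.Vec using (Vec)
import Data.Vec as Vec
import Data.Vec.Properties as VecP
import Data.Vec.Relation.Unary.All as VAll
open import Data.List using (List; []; _∷_; _++_; length; map; filter; upTo; deduplicate; cartesianProductWith)
import Data.List.Properties as ListP
open import Data.Nat.ListAction using (sum)
import Data.Nat.ListAction.Properties as SumP
open import Data.List.Relation.Unary.All using (All; []; _∷_)
import Data.List.Relation.Unary.All as All
import Data.List.Relation.Unary.All.Properties as AllP
open import Data.List.Relation.Unary.Any using (here; there; any?; index)
import Data.List.Relation.Unary.Any.Properties as AnyP
open import Data.List.Relation.Unary.AllPairs using ([]; _∷_)
import Data.List.Relation.Unary.AllPairs
open import Data.List.Relation.Unary.Unique.Propositional using (Unique)
import Data.List.Relation.Unary.Unique.Propositional.Properties as UniqueP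
open import Data.List.Relation.Unary.Unique.DecPropositional.Properties using (deduplicate-!)
import Data.List.Relation.Unary.Unique.DecPropositional as DecUnique
open import Data.List.Membership.Propositional using (_∈_; _∉_; find; lose)
open import Data.List.Membership.Propositional.Properties
import Data.List.Membership.DecPropositional as DecMembership
open import Data.Product using (Σ; ∃; ∃₂; _×_; _,_; proj₁; proj₂)
open import Data.Sum using (_⊎_; inj₁; inj₂)
open import Data.Empty using (⊥-elim)
open import Function using (_∘_; id; case_of_)
open import Relation.Nullary using (¬_; Dec; yes; no; ¬?)
open import Relation.Nullary.Decidable using (_×-dec_; map′; decidable-stable)
open import Relation.Unary using (Decidable)
open import Relation.Binary.Definitions using (DecidableEquality)
open import Relation.Binary.PropositionalEquality

-- One count shapes the argument. At scale `j = 2^i`, a family without overused elements and a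
-- deletion budget `ρ` allow about `ρ / j` summands from `A`, hence about `t = ρ / j²` robust ones.
-- A progression of rank `r` then gets volume about `|j^*A| (ρ / 4^i)^r`. The property that is
-- stabilised compares this quantity, for `r = d + 1`, with `|A| l^(d+1)`. The last budget for which
-- it holds is good in two ways: the final volume is large enough, and failure for half the budget
-- gives robustness with a loss of only `2^(d+1)`. The scale maximises `|j^*A| / j^(2(d+1)+1)`: the
-- exponent `2(d+1)` pays for `4^i`, and the spare factor `j` competes with the trivial bound `j n`
-- on the sums. Constants may depend on `d` alone, whereas `j` and `|A|` are unbounded. Hence the
-- frame comes from a tower of scales of fixed height, the decisive pigeonhole runs over coefficient
-- vectors instead of elements, and the uncontrolled return times enter only through a common
-- denominator that cancels. Finally `l` elements of `A` are held back, so that every sum can be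
-- completed to exactly `l` distinct summands.

variable
  𝔸 𝔹 : Set

-- Counting in lists

∑ : (𝔸 → ℕ) → List 𝔸 → ℕ
∑ f []       = 0
∑ f (x ∷ xs) = f x + ∑ f xs

ind : {P : Set} → Dec P → ℕ
ind (yes _) = 1
ind (no _)  = 0

count : {P : 𝔸 → Set} → Decidable P → List 𝔸 → ℕ
count P? = ∑ (λ x → ind (P? x))

∑-cong : ∀ {f g : 𝔸 → ℕ} xs → (∀ {x} → x ∈ xs → f x ≡ g x) → ∑ f xs ≡ ∑ g xs
∑-cong []       h = refl
∑-cong (x ∷ xs) h = cong₂ _+_ (h (here refl)) (∑-cong xs (h ∘ there))

∑-mono : ∀ {f g : 𝔸 → ℕ} xs → (∀ {x} → x ∈ xs → f x ≤ g x) → ∑ f xs ≤ ∑ g xs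
∑-mono []       h = z≤n
∑-mono (x ∷ xs) h = ℕP.+-mono-≤ (h (here refl)) (∑-mono xs (h ∘ there))

∑-const : ∀ c (xs : List 𝔸) → ∑ (λ _ → c) xs ≡ length xs * c
∑-const c []       = refl
∑-const c (x ∷ xs) = cong (c +_) (∑-const c xs)

∑-+ : ∀ (f g : 𝔸 → ℕ) xs → ∑ (λ x → f x + g x) xs ≡ ∑ f xs + ∑ g xs
∑-+ f g []       = refl
∑-+ f g (x ∷ xs) = trans (cong (_ +_) (∑-+ f g xs)) (lem (f x) (g x) _ _)
  where
  lem : ∀ a b c d → a + b + (c + d) ≡ a + c + (b + d)
  lem = ring-ℕ

∑-* : ∀ c (f : 𝔸 → ℕ) xs → ∑ (λ x → c * f x) xs ≡ c * ∑ f xs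
∑-* c f []       = sym (ℕP.*-zeroʳ c)
∑-* c f (x ∷ xs) = trans (cong (_ +_) (∑-* c f xs)) (sym (ℕP.*-distribˡ-+ c _ _))

∑-swap : ∀ (f : 𝔸 → 𝔹 → ℕ) xs ys → ∑ (λ x → ∑ (f x) ys) xs ≡ ∑ (λ y → ∑ (λ x → f x y) xs) ys
∑-swap f []       ys = sym (trans (∑-const 0 ys) (ℕP.*-zeroʳ (length ys)))
∑-swap f (x ∷ xs) ys = trans (cong (_ +_) (∑-swap f xs ys)) (sym (∑-+ (f x) _ ys))

member≤∑ : ∀ (f : 𝔸 → ℕ) {x xs} → x ∈ xs → f x ≤ ∑ f xs
member≤∑ f (here refl) = ℕP.m≤m+n _ _
member≤∑ f (there p)   = ℕP.≤-trans (member≤∑ f p) (ℕP.m≤n+m _ _)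

ind≤1 : {P : Set} (p : Dec P) → ind p ≤ 1
ind≤1 (yes _) = ℕP.≤-refl
ind≤1 (no _)  = z≤n

count≤length : ∀ {P : 𝔸 → Set} (P? : Decidable P) xs → count P? xs ≤ length xs
count≤length P? xs = ℕP.≤-trans (∑-mono xs (λ {x} _ → ind≤1 (P? x)))
                       (ℕP.≤-reflexive (trans (∑-const 1 xs) (ℕP.*-identityʳ _)))

length-filter≡ : ∀ {P : 𝔸 → Set} (P? : Decidable P) xs → length (filter P? xs) ≡ count P? xs
length-filter≡ P? []       = refl
length-filter≡ P? (x ∷ xs) with P? x
... | yes _ = cong suc (length-filter≡ P? xs)
... | no  _ = length-filter≡ P? xs

count-¬ : ∀ {P : 𝔸 → Set} (P? : Decidable P) xs → count P? xs + count (¬? ∘ P?) xs ≡ length xs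
count-¬ P? []       = refl
count-¬ P? (x ∷ xs) with P? x
... | yes _ = cong suc (count-¬ P? xs)
... | no  _ = trans (ℕP.+-suc _ _) (cong suc (count-¬ P? xs))

length-⊆ : ∀ {xs ys : List 𝔸} → Unique xs → (∀ {x} → x ∈ xs → x ∈ ys) → length xs ≤ length ys
length-⊆ {xs = []}     u h = z≤n
length-⊆ {xs = x ∷ xs} (x∉ ∷ u) h with ∈-∃++ (h (here refl))
... | ys , zs , refl = subst (suc (length xs) ≤_) (sym (len ys)) (s≤s (length-⊆ u sub))
  where
  len : ∀ ys → length (ys ++ x ∷ zs) ≡ suc (length (ys ++ zs))
  len []       = refl
  len (_ ∷ ys) = cong suc (len ys)
  sub : ∀ {z} → z ∈ xs → z ∈ ys ++ zs
  sub z∈ with ∈-++⁻ ys (h (there z∈))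
  ... | inj₁ p         = ∈-++⁺ˡ p
  ... | inj₂ (here eq) = ⊥-elim (All.lookup x∉ z∈ (sym eq))
  ... | inj₂ (there p) = ∈-++⁺ʳ ys p

map-unique : ∀ (f : 𝔸 → 𝔹) {xs} → Unique xs →
  (∀ {x y} → x ∈ xs → y ∈ xs → f x ≡ f y → x ≡ y) → Unique (map f xs)
map-unique f []       inj = []
map-unique f (x∉ ∷ u) inj =
  AllP.map⁺ (All.tabulate (λ y∈ eq → All.lookup x∉ y∈ (inj (here refl) (there y∈) eq)))
  ∷ map-unique f u (λ p q → inj (there p) (there q))

length-inj : ∀ (f : 𝔸 → 𝔹) {xs ys} → Unique xs →
  (∀ {x y} → x ∈ xs → y ∈ xs → f x ≡ f y → x ≡ y) →
  (∀ {x} → x ∈ xs → f x ∈ ys) → length xs ≤ length ys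
length-inj f {xs} {ys} u inj h =
  subst (_≤ length ys) (ListP.length-map f xs)
    (length-⊆ (map-unique f u inj)
      (λ p → let x , x∈ , eq = ∈-map⁻ f p in subst (_∈ ys) (sym eq) (h x∈)))

filter-unique : ∀ {P : 𝔸 → Set} (P? : Decidable P) {xs} → Unique xs → Unique (filter P? xs)
filter-unique = UniqueP.filter⁺

find∈? : ∀ {P : 𝔸 → Set} → Decidable P → ∀ xs → Dec (∃ λ x → x ∈ xs × P x)
find∈? P? xs = map′ find (λ (x , x∈ , px) → lose x∈ px) (any? P? xs)

∑-large : ∀ (f : 𝔸 → ℕ) c xs → length xs * c ≤ ∑ f xs → 1 ≤ length xs → ∃ λ x → x ∈ xs × c ≤ f x
∑-large f c xs h ne with find∈? (λ x → c ≤? f x) xs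
... | yes r = r
... | no ¬r = ⊥-elim (ℕP.<⇒≱ (small xs (λ x∈ → ℕP.≰⇒> (λ le → ¬r (_ , x∈ , le))) ne) h)
  where
  small : ∀ xs → (∀ {x} → x ∈ xs → f x < c) → 1 ≤ length xs → ∑ f xs < length xs * c
  small (x ∷ [])       lt _ = subst₂ _<_ (sym (ℕP.+-identityʳ _)) (sym (ℕP.+-identityʳ _)) (lt (here refl))
  small (x ∷ (y ∷ xs)) lt _ = ℕP.+-mono-<-≤ (lt (here refl)) (ℕP.<⇒≤ (small (y ∷ xs) (lt ∘ there) (s≤s z≤n)))

pigeonhole-list : ∀ (f : ℕ → 𝔸) (L : List 𝔸) → (∀ i → f i ∈ L) →
  ∃₂ λ i k → 1 ≤ k × i + k ≤ length L × f i ≡ f (i + k)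
pigeonhole-list f L h
  with i , j , i<j , eq ← FinP.pigeonhole (ℕP.n<1+n (length L)) (λ i → index (h (toℕ i)))
  = toℕ i , toℕ j ∸ toℕ i , ℕP.m<n⇒0<n∸m i<j
  , subst (_≤ length L) (sym i+k) (ℕP.<⇒≤pred (FinP.toℕ<n j))
  , trans (AnyP.lookup-index (h (toℕ i)))
      (trans (cong (Data.List.lookup L) eq)
        (trans (sym (AnyP.lookup-index (h (toℕ j)))) (cong f (sym i+k))))
  where
  i+k : toℕ i + (toℕ j ∸ toℕ i) ≡ toℕ j
  i+k = ℕP.m+[n∸m]≡n (ℕP.<⇒≤ i<j)

-- Sums of distinct elements

infix 4 _∈?_
_∈?_ : (x : ℕ) (xs : List ℕ) → Dec (x ∈ xs)
_∈?_ = DecMembership._∈?_ ℕ._≟_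

infixl 6 _∖_
_∖_ : List ℕ → List ℕ → List ℕ
A ∖ Z = filter (λ a → ¬? (a ∈? Z)) A

infix 4 _⊑_
_⊑_ : {A : Set} → List A → List A → Set
xs ⊑ ys = ∀ {x} → x ∈ xs → x ∈ ys

∖⁺ : ∀ {A Z a} → a ∈ A → a ∉ Z → a ∈ A ∖ Z
∖⁺ {Z = Z} = ∈-filter⁺ (λ a → ¬? (a ∈? Z))

∖⁻ : ∀ {A Z a} → a ∈ A ∖ Z → a ∈ A × a ∉ Z
∖⁻ {A} {Z} = ∈-filter⁻ (λ a → ¬? (a ∈? Z))

∖-⊑ : ∀ {A} Z → A ∖ Z ⊑ A
∖-⊑ Z = proj₁ ∘ ∖⁻ {Z = Z}

∖-unique : ∀ {A} Z → Unique A → Unique (A ∖ Z)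
∖-unique Z = filter-unique (λ a → ¬? (a ∈? Z))

∖-antitone : ∀ {A Z Z'} → Z' ⊑ Z → A ∖ Z ⊑ A ∖ Z'
∖-antitone {A} {Z} {Z'} h p = let a∈ , a∉ = ∖⁻ {A} {Z} p in ∖⁺ a∈ (a∉ ∘ h)

length-∩ : ∀ {A} Z → Unique A → count (_∈? Z) A ≤ length Z
length-∩ {A} Z u = subst (_≤ length Z) (length-filter≡ (_∈? Z) A)
  (length-⊆ (filter-unique (_∈? Z) u) (proj₂ ∘ ∈-filter⁻ (_∈? Z) {xs = A}))

length-∖ : ∀ {A} Z → Unique A → length A ≤ length (A ∖ Z) + length Z
length-∖ {A} Z u = begin
  length A  ≡⟨ count-¬ (_∈? Z) A ⟨
  count (_∈? Z) A + count (λ a → ¬? (a ∈? Z)) A  ≡⟨ ℕP.+-comm (count (_∈? Z) A) _ ⟩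
  count (λ a → ¬? (a ∈? Z)) A + count (_∈? Z) A  ≡⟨ cong (_+ count (_∈? Z) A) (length-filter≡ (λ a → ¬? (a ∈? Z)) A) ⟨
  length (A ∖ Z) + count (_∈? Z) A  ≤⟨ ℕP.+-monoʳ-≤ _ (length-∩ Z u) ⟩
  length (A ∖ Z) + length Z  ∎
  where open ℕP.≤-Reasoning

Rep : ℕ → List ℕ → List ℕ → Set
Rep j A B = Unique B × All (_∈ A) B × length B ≡ j

rep-mono : ∀ {j A A' B} → A ⊑ A' → Rep j A B → Rep j A' B
rep-mono h (u , a , l) = u , All.map h a , l

words : ℕ → List ℕ → List (List ℕ)
words zero    A = [] ∷ []
words (suc j) A = cartesianProductWith _∷_ A (words j A)

∈-words⁺ : ∀ {A} B → All (_∈ A) B → B ∈ words (length B) A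
∈-words⁺ []      []       = here refl
∈-words⁺ (b ∷ B) (p ∷ ps) = ∈-cartesianProductWith⁺ _∷_ p (∈-words⁺ B ps)

∈-words⁻ : ∀ {A} j {B} → B ∈ words j A → All (_∈ A) B × length B ≡ j
∈-words⁻ zero (here refl) = [] , refl
∈-words⁻ {A} (suc j) p with ∈-cartesianProductWith⁻ _∷_ A (words j A) p
... | a , B , a∈ , B∈ , refl = let h , l = ∈-words⁻ j B∈ in a∈ ∷ h , cong suc l

unique? : (B : List ℕ) → Dec (Unique B)
unique? = DecUnique.unique? ℕ._≟_

reps : ℕ → List ℕ → List (List ℕ)
reps j A = filter unique? (words j A)

∈-reps⁺ : ∀ {j A B} → Rep j A B → B ∈ reps j A
∈-reps⁺ {B = B} (u , a , refl) = ∈-filter⁺ unique? (∈-words⁺ B a) u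

∈-reps⁻ : ∀ {j A B} → B ∈ reps j A → Rep j A B
∈-reps⁻ {j} {A} p = let w , u = ∈-filter⁻ unique? {xs = words j A} p ; a , l = ∈-words⁻ j w in u , a , l

-- The restricted sumset `j^*A`, listed without repetitions so that its length is its cardinality.
V : ℕ → List ℕ → List ℕ
V j A = deduplicate ℕ._≟_ (map sum (reps j A))

V-unique : ∀ j A → Unique (V j A)
V-unique j A = deduplicate-! ℕ._≟_ _

∈-V⁺ : ∀ {j A B} → Rep j A B → sum B ∈ V j A
∈-V⁺ r = ∈-deduplicate⁺ ℕ._≟_ (∈-map⁺ sum (∈-reps⁺ r))

∈-V⁻ : ∀ {j A x} → x ∈ V j A → ∃ λ B → Rep j A B × x ≡ sum B
∈-V⁻ {j} {A} p with ∈-map⁻ sum (∈-deduplicate⁻ ℕ._≟_ (map sum (reps j A)) p)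
... | B , B∈ , eq = B , ∈-reps⁻ {j} {A} B∈ , eq

V-mono : ∀ j {A A'} → A ⊑ A' → length (V j A) ≤ length (V j A')
V-mono j {A} {A'} h = length-⊆ (V-unique j A) sub
  where
  sub : V j A ⊑ V j A'
  sub p with ∈-V⁻ {j} {A} p
  ... | B , r , refl = ∈-V⁺ {j} (rep-mono h r)

sum-bound : ∀ {n} B → All (_≤ n) B → sum B ≤ length B * n
sum-bound []      []       = z≤n
sum-bound (b ∷ B) (p ∷ ps) = ℕP.+-mono-≤ p (sum-bound B ps)

V-range : ∀ {n A} j → (∀ {a} → a ∈ A → a ≤ n) → length (V j A) ≤ suc (j * n)
V-range {n} {A} j h = subst (length (V j A) ≤_) (ListP.length-upTo _)
  (length-⊆ (V-unique j A) sub)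
  where
  sub : V j A ⊑ upTo (suc (j * n))
  sub p with ∈-V⁻ {j} {A} p
  ... | B , (_ , a , refl) , refl = ∈-upTo⁺ (s≤s (sum-bound B (All.map h a)))

-- A finite stock of deletion sets: quantification over all small `Z` becomes a finite search.
words≤ : ℕ → List ℕ → List (List ℕ)
words≤ zero    A = [] ∷ []
words≤ (suc c) A = [] ∷ cartesianProductWith _∷_ A (words≤ c A)

∈-words≤⁺ : ∀ {A} c B → length B ≤ c → All (_∈ A) B → B ∈ words≤ c A
∈-words≤⁺ zero    []      l       []       = here refl
∈-words≤⁺ (suc c) []      l       []       = here refl
∈-words≤⁺ (suc c) (b ∷ B) (s≤s l) (p ∷ ps) = there (∈-cartesianProductWith⁺ _∷_ p (∈-words≤⁺ c B l ps))

∈-words≤⁻ : ∀ {A} c {B} → B ∈ words≤ c A → length B ≤ c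
∈-words≤⁻ zero    (here refl) = z≤n
∈-words≤⁻ (suc c) (here refl) = z≤n
∈-words≤⁻ {A} (suc c) (there p) with ∈-cartesianProductWith⁻ _∷_ A (words≤ c A) p
... | a , B , a∈ , B∈ , refl = s≤s (∈-words≤⁻ c B∈)

-- Whenever deleting few elements kills a property, delete them; every property
-- is killed at most once, so the total loss is at most the sum of the costs.
module Stabilise {I : Set} (alive : I → List ℕ → Set) (alive? : ∀ p A → Dec (alive p A))
  (mono : ∀ p {A A'} → A' ⊑ A → alive p A' → alive p A) (cost : I → ℕ) where

  Robust : I → List ℕ → Set
  Robust p A = ∀ Z → length Z ≤ cost p → alive p (A ∖ Z)

  Killed : I → List ℕ → Set
  Killed p A = ∃ λ Z → length Z ≤ cost p × ¬ alive p (A ∖ Z)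

  -- Only the part of `Z` inside `A` influences the deletion, so the search over words in `A` is
  -- exhaustive.
  robust⊎killed : ∀ p A → Robust p A ⊎ Killed p A
  robust⊎killed p A with find∈? (λ Z → ¬? (alive? p (A ∖ Z))) (words≤ (cost p) A)
  ... | yes (Z , Z∈ , dead) = inj₂ (Z , ∈-words≤⁻ (cost p) Z∈ , dead)
  ... | no none = inj₁ λ Z l →
      let Z' = filter (_∈? A) Z
          Z'∈ = ∈-words≤⁺ (cost p) Z' (ℕP.≤-trans (ListP.length-filter (_∈? A) Z) l)
                  (All.tabulate (proj₂ ∘ ∈-filter⁻ (_∈? A) {xs = Z}))
          sub : A ∖ Z' ⊑ A ∖ Z
          sub q = let a∈ , a∉ = ∖⁻ {A} {Z'} q in ∖⁺ a∈ (λ a∈Z → a∉ (∈-filter⁺ (_∈? A) a∈Z a∈))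
      in mono p sub (decidable-stable (alive? p (A ∖ Z')) (λ dead → none (Z' , Z'∈ , dead)))

  killed? : ∀ p A → Dec (alive p A × Killed p A)
  killed? p A with robust⊎killed p A
  ... | inj₁ r                 = no λ (_ , Z , l , dead) → dead (r Z l)
  ... | inj₂ k with alive? p A
  ...   | yes a = yes (a , k)
  ...   | no ¬a = no (¬a ∘ proj₁)

  Stable : List I → List ℕ → List ℕ → Set
  Stable ps A A' = Unique A' × A' ⊑ A × length A ≤ length A' + ∑ cost ps
                 × (∀ {p} → p ∈ ps → alive p A' → Robust p A')

  stabilise′ : ∀ n ps → length ps ≡ n → ∀ A → Unique A → ∃ (Stable ps A)
  stabilise′ n ps eq A u with find∈? (λ p → killed? p A) ps
  ... | no none = A , u , id , ℕP.m≤m+n _ _ , robust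
    where
    robust : ∀ {p} → p ∈ ps → alive p A → Robust p A
    robust {p} p∈ a with robust⊎killed p A
    ... | inj₁ r = r
    ... | inj₂ k = ⊥-elim (none (p , p∈ , a , k))
  stabilise′ zero    []       eq A u | yes (_ , () , _)
  stabilise′ (suc n) ps eq A u | yes (p , p∈ , a , Z , l , dead) with ∈-∃++ p∈
  ... | ys , zs , refl with stabilise′ n (ys ++ zs) (ℕP.suc-injective (trans (sym (len ys)) eq)) (A ∖ Z) (∖-unique Z u)
    where
    len : ∀ ys → length (ys ++ p ∷ zs) ≡ suc (length (ys ++ zs))
    len []       = refl
    len (_ ∷ ys) = cong suc (len ys)
  ... | A' , u' , sub , loss , rob = A' , u' , ∖-⊑ Z ∘ sub , loss' , rob'
    where
    costs : ∀ ys → ∑ cost (ys ++ p ∷ zs) ≡ ∑ cost (ys ++ zs) + cost p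
    costs []       = ℕP.+-comm (cost p) _
    costs (y ∷ ys) = trans (cong (cost y +_) (costs ys)) (sym (ℕP.+-assoc (cost y) _ _))
    loss' : length A ≤ length A' + ∑ cost (ys ++ p ∷ zs)
    loss' = begin
      length A  ≤⟨ length-∖ Z u ⟩
      length (A ∖ Z) + length Z  ≤⟨ ℕP.+-mono-≤ loss l ⟩
      length A' + ∑ cost (ys ++ zs) + cost p  ≡⟨ ℕP.+-assoc (length A') _ _ ⟩
      length A' + (∑ cost (ys ++ zs) + cost p)  ≡⟨ cong (length A' +_) (costs ys) ⟨
      length A' + ∑ cost (ys ++ p ∷ zs)  ∎
      where open ℕP.≤-Reasoning
    rob' : ∀ {q} → q ∈ ys ++ p ∷ zs → alive q A' → Robust q A'
    rob' q∈ al with ∈-++⁻ ys q∈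
    ... | inj₁ m            = rob (∈-++⁺ˡ m) al
    -- The property just killed cannot revive: `A'` lies inside the set on which it is dead.
    ... | inj₂ (here refl)  = ⊥-elim (dead (mono p sub al))
    ... | inj₂ (there m)    = rob (∈-++⁺ʳ ys m) al

  stabilise : ∀ ps A → Unique A → ∃ (Stable ps A)
  stabilise ps = stabilise′ (length ps) ps refl

-- Families of subsets with bounded degrees, and popular sums

Meets : List ℕ → List ℕ → Set
Meets Z B = ∃ λ a → a ∈ Z × a ∈ B

meets? : ∀ Z B → Dec (Meets Z B)
meets? Z B = find∈? (_∈? B) Z

map-unique-inj : ∀ (f : 𝔸 → 𝔹) {xs} → Unique (map f xs) → ∀ {x y} → x ∈ xs → y ∈ xs → f x ≡ f y → x ≡ y
map-unique-inj f u       (here refl) (here refl) eq = refl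
map-unique-inj f (p ∷ u) (here refl) (there y∈)  eq = ⊥-elim (All.lookup p (∈-map⁺ f y∈) eq)
map-unique-inj f (p ∷ u) (there x∈)  (here refl) eq = ⊥-elim (All.lookup p (∈-map⁺ f x∈) (sym eq))
map-unique-inj f (p ∷ u) (there x∈)  (there y∈)  eq = map-unique-inj f u x∈ y∈ eq

deg : ℕ → List (List ℕ) → ℕ
deg a F = count (a ∈?_) F

-- A family of j-subsets with distinct sums, maximal subject to no element lying
-- in more than cap of its members.
module Spread (A : List ℕ) (uA : Unique A) (j cap : ℕ) where

  IsFamily : List (List ℕ) → Set
  IsFamily F = All (Rep j A) F × Unique (map sum F) × (∀ a → deg a F ≤ cap)

  -- The only two reasons for which the greedy choice passes over `B`; both persist when the family
  -- grows.
  Covered : List (List ℕ) → List ℕ → Set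
  Covered F B = sum B ∈ map sum F ⊎ ∃ λ a → a ∈ B × cap ≤ deg a F

  greedy : ∀ Ws → All (Rep j A) Ws → ∃ λ F → IsFamily F × (∀ {B} → B ∈ Ws → Covered F B)
  greedy []       []       = [] , ([] , [] , λ _ → z≤n) , λ ()
  greedy (B ∷ Ws) (r ∷ rs) with greedy Ws rs
  ... | F , (rF , uF , dF) , cov with sum B ∈? map sum F | find∈? (λ a → cap ≤? deg a F) B
  ...   | yes s∈ | _     = F , (rF , uF , dF) , λ { (here refl) → inj₁ s∈ ; (there p) → cov p }
  ...   | no  _  | yes s = F , (rF , uF , dF) , λ { (here refl) → inj₂ s ; (there p) → cov p }
  ...   | no s∉  | no ¬s = B ∷ F , (r ∷ rF , AllP.¬Any⇒All¬ _ s∉ ∷ uF , degs) , cov'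
    where
    degs : ∀ a → deg a (B ∷ F) ≤ cap
    degs a with a ∈? B
    ... | no  _  = dF a
    ... | yes a∈ = ℕP.≰⇒> (λ le → ¬s (a , a∈ , le))
    cov' : ∀ {B'} → B' ∈ B ∷ Ws → Covered (B ∷ F) B'
    cov' (here refl) = inj₁ (here refl)
    cov' (there p) with cov p
    ... | inj₁ s∈           = inj₁ (there s∈)
    ... | inj₂ (a , a∈ , l) = inj₂ (a , a∈ , ℕP.≤-trans l (ℕP.m≤n+m _ _))

  private abstract
    result : ∃ λ F → IsFamily F × (∀ {B} → B ∈ reps j A → Covered F B)
    result = greedy (reps j A) (All.tabulate (∈-reps⁻ {j} {A}))

  F : List (List ℕ)
  F = proj₁ result

  F-rep : ∀ {B} → B ∈ F → Rep j A B
  F-rep = All.lookup (proj₁ (proj₁ (proj₂ result)))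

  F-inj : ∀ {B B'} → B ∈ F → B' ∈ F → sum B ≡ sum B' → B ≡ B'
  F-inj = map-unique-inj sum (proj₁ (proj₂ (proj₁ (proj₂ result))))

  F-unique : Unique F
  F-unique = UniqueP.map⁻ (proj₁ (proj₂ (proj₁ (proj₂ result))))

  deg≤cap : ∀ a → deg a F ≤ cap
  deg≤cap = proj₂ (proj₂ (proj₁ (proj₂ result)))

  sat : List ℕ
  sat = filter (λ a → cap ≤? deg a F) A

  -- A representation without saturated elements can only have been passed over because its sum was
  -- already present.
  V∖sat⊑ : V j (A ∖ sat) ⊑ map sum F
  V∖sat⊑ p with ∈-V⁻ {j} {A ∖ sat} p
  ... | B , r , refl with proj₂ (proj₂ result) (∈-reps⁺ {j} (rep-mono (∖-⊑ sat) r))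
  ...   | inj₁ s∈           = s∈
  ...   | inj₂ (a , a∈ , l) with ∖⁻ {A} {sat} (All.lookup (proj₁ (proj₂ r)) a∈)
  ...     | a∈A , a∉ = ⊥-elim (a∉ (∈-filter⁺ (λ a → cap ≤? deg a F) a∈A l))

  F≤V : length F ≤ length (V j A)
  F≤V = subst (_≤ length (V j A)) (ListP.length-map sum F)
    (length-⊆ (proj₁ (proj₂ (proj₁ (proj₂ result)))) sub)
    where
    sub : map sum F ⊑ V j A
    sub p with ∈-map⁻ sum p
    ... | B , B∈ , refl = ∈-V⁺ {j} (F-rep B∈)

  -- Double counting of incidences: a saturated element lies in at least `cap` members of `F`, and a
  -- member has `j` elements.
  sat-small : length sat * cap ≤ length F * j
  sat-small = begin
    length sat * cap  ≡⟨ ∑-const cap sat ⟨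
    ∑ (λ _ → cap) sat  ≤⟨ ∑-mono sat (λ a∈ → proj₂ (∈-filter⁻ (λ a → cap ≤? deg a F) {xs = A} a∈)) ⟩
    ∑ (λ a → deg a F) sat  ≡⟨ ∑-swap (λ a B → ind (a ∈? B)) sat F ⟩
    ∑ (λ B → count (_∈? B) sat) F  ≤⟨ ∑-mono F (λ {B} B∈ → subst (λ k → count (_∈? B) sat ≤ k) (proj₂ (proj₂ (F-rep B∈)))
                                                     (length-∩ {sat} B (filter-unique (λ a → cap ≤? deg a F) uA))) ⟩
    ∑ (λ _ → j) F  ≡⟨ ∑-const j F ⟩
    length F * j  ∎
    where open ℕP.≤-Reasoning

  -- By `sat-small` the saturated elements are few enough to be deleted at the price of the factor
  -- `E`, and every sum that survives is the sum of a member of `F`.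
  V≤F : ∀ {ρ E} → (∀ Z → length Z ≤ ρ → length (V j A) ≤ E * length (V j (A ∖ Z))) →
    j * length (V j A) < suc ρ * cap → length (V j A) ≤ E * length F
  V≤F {ρ} {E} rob small = ℕP.≤-trans (rob sat sat≤ρ) (ℕP.*-monoʳ-≤ E
    (subst (length (V j (A ∖ sat)) ≤_) (ListP.length-map sum F) (length-⊆ (V-unique j (A ∖ sat)) V∖sat⊑)))
    where
    sat≤ρ : length sat ≤ ρ
    sat≤ρ = ℕP.≮⇒≥ λ ρ< → ℕP.<⇒≱ small (begin
      suc ρ * cap  ≤⟨ ℕP.*-monoˡ-≤ cap ρ< ⟩
      length sat * cap  ≤⟨ sat-small ⟩
      length F * j  ≡⟨ ℕP.*-comm (length F) j ⟩
      j * length F  ≤⟨ ℕP.*-monoʳ-≤ j F≤V ⟩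
      j * length (V j A)  ∎)
      where open ℕP.≤-Reasoning

  meets-few : ∀ Z → count (meets? Z) F ≤ length Z * cap
  meets-few Z = begin
    count (meets? Z) F  ≤⟨ ∑-mono F (λ {B} _ → bound' B Z) ⟩
    ∑ (λ B → count (_∈? B) Z) F  ≡⟨ ∑-swap (λ B a → ind (a ∈? B)) F Z ⟩
    ∑ (λ a → deg a F) Z  ≤⟨ ∑-mono Z (λ {a} _ → deg≤cap a) ⟩
    ∑ (λ _ → cap) Z  ≡⟨ ∑-const cap Z ⟩
    length Z * cap  ∎
    where
    open ℕP.≤-Reasoning
    pos' : ∀ B {a Z} → a ∈ Z → a ∈ B → 1 ≤ count (_∈? B) Z
    pos' B {Z = a ∷ Z} (here refl) a∈B with a ∈? B
    ... | yes _ = s≤s z≤n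
    ... | no a∉ = ⊥-elim (a∉ a∈B)
    pos' B (there a∈) a∈B = ℕP.≤-trans (pos' B a∈ a∈B) (ℕP.m≤n+m _ _)
    bound' : ∀ B Z → ind (meets? Z B) ≤ count (_∈? B) Z
    bound' B Z with meets? Z B
    ... | no _             = z≤n
    ... | yes (a , p , q) = pos' B p q

  Good : ℕ → List ℕ → Set
  Good z B = ∃ λ B' → B' ∈ F × (¬ Meets B B' × sum B + sum B' ≡ z)

  good? : ∀ z B → Dec (Good z B)
  good? z B = find∈? (λ B' → ¬? (meets? B B') ×-dec (sum B + sum B' ℕ.≟ z)) F

  T : List ℕ
  T = V (j + j) A

  pairs : ℕ → ℕ
  pairs z = count (good? z) F

  rep-pair : ∀ {A' B B'} → Rep j A' B → Rep j A' B' → ¬ Meets B B' → Rep (j + j) A' (B ++ B')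
  rep-pair {B = B} (u , a , refl) (u' , a' , l') ¬m =
    UniqueP.++⁺ u u' (λ (p , q) → ¬m (_ , p , q)) , AllP.++⁺ a a'
    , trans (ListP.length-++ B) (cong (length B +_) l')

  -- At most `j * cap` members of `F` meet `B`. The others have distinct sums, so their unions with
  -- `B` give distinct elements of `T`.
  partners : ∀ {B} → B ∈ F → length F ≤ j * cap + count (λ z → good? z B) T
  partners {B} B∈ = begin
    length F  ≡⟨ count-¬ (meets? B) F ⟨
    count (meets? B) F + count (λ B' → ¬? (meets? B B')) F  ≤⟨ ℕP.+-mono-≤ met free ⟩
    j * cap + count (λ z → good? z B) T  ∎
    where
    open ℕP.≤-Reasoning
    met : count (meets? B) F ≤ j * cap
    met = subst (λ k → count (meets? B) F ≤ k * cap) (proj₂ (proj₂ (F-rep B∈))) (meets-few B)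
    free : count (λ B' → ¬? (meets? B B')) F ≤ count (λ z → good? z B) T
    free = subst₂ _≤_ (length-filter≡ (λ B' → ¬? (meets? B B')) F) (length-filter≡ (λ z → good? z B) T)
      (length-inj (λ B' → sum B + sum B') (filter-unique (λ B' → ¬? (meets? B B')) F-unique)
        (λ p q eq → F-inj (proj₁ (mem p)) (proj₁ (mem q)) (ℕP.+-cancelˡ-≡ (sum B) _ _ eq))
        (λ p → let B'∈ , ¬m = mem p in
          ∈-filter⁺ (λ z → good? z B)
            (subst (_∈ T) (SumP.sum-++ B _) (∈-V⁺ {j + j} (rep-pair (F-rep B∈) (F-rep B'∈) ¬m)))
            (_ , B'∈ , ¬m , refl)))
      where
      mem : ∀ {B'} → B' ∈ filter (λ B' → ¬? (meets? B B')) F → B' ∈ F × ¬ Meets B B'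
      mem = ∈-filter⁻ (λ B' → ¬? (meets? B B')) {xs = F}

  many-pairs : length F * length F ≤ length F * (j * cap) + ∑ pairs T
  many-pairs = begin
    length F * length F  ≡⟨ ∑-const (length F) F ⟨
    ∑ (λ _ → length F) F  ≤⟨ ∑-mono F partners ⟩
    ∑ (λ B → j * cap + count (λ z → good? z B) T) F  ≡⟨ ∑-+ (λ _ → j * cap) (λ B → count (λ z → good? z B) T) F ⟩
    ∑ (λ _ → j * cap) F + ∑ (λ B → count (λ z → good? z B) T) F
      ≡⟨ cong₂ _+_ (∑-const (j * cap) F) (∑-swap (λ B z → ind (good? z B)) F T) ⟩
    length F * (j * cap) + ∑ pairs T  ∎
    where open ℕP.≤-Reasoning

  module Popular (g : ℕ) (g≥1 : 1 ≤ g) (F≥1 : 1 ≤ length F)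
    (T≤ : length T ≤ g * length F) (spread : 2 * (j * cap) ≤ length F) where

    H : ℕ
    H = 4 * g

    popular? : ∀ z → Dec (length F ≤ H * pairs z)
    popular? z = length F ≤? H * pairs z

    R : List ℕ
    R = filter popular? T

    R-unique : Unique R
    R-unique = filter-unique popular? (V-unique (j + j) A)

    -- Write `f` for the size of `F`. At least `f² / 2` pairs are disjoint. Unpopular sums account
    -- for at most `|T| f / (4g)`, hence for at most `f² / 4` of them, and a popular sum for at most
    -- `f`.
    F≤R : length F ≤ 4 * length R
    F≤R = ℕP.*-cancelˡ-≤ (H * length F) ⦃ ℕ.>-nonZero (ℕP.*-mono-≤ (ℕP.*-mono-≤ {1} {4} (s≤s z≤n) g≥1) F≥1) ⦄ (begin
        H * f * f  ≡⟨ ℕP.*-assoc H f f ⟩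
        H * (f * f)  ≤⟨ ℕP.*-monoʳ-≤ H ff≤ ⟩
        H * (2 * ∑ pairs T)  ≡⟨ l₁ H (∑ pairs T) ⟩
        2 * (H * ∑ pairs T)  ≤⟨ cancel ⟩
        H * f * (4 * length R)  ∎)
      where
      open ℕP.≤-Reasoning
      f = length F
      l₁ : ∀ a b → a * (2 * b) ≡ 2 * (a * b)
      l₁ = ring-ℕ
      ff≤ : f * f ≤ 2 * ∑ pairs T
      ff≤ = ℕP.+-cancelˡ-≤ (f * f) _ _ (begin
        f * f + f * f  ≤⟨ ℕP.+-mono-≤ many-pairs many-pairs ⟩
        (f * (j * cap) + ∑ pairs T) + (f * (j * cap) + ∑ pairs T)  ≡⟨ l₂ f (j * cap) (∑ pairs T) ⟩
        f * (2 * (j * cap)) + 2 * ∑ pairs T  ≤⟨ ℕP.+-monoˡ-≤ _ (ℕP.*-monoʳ-≤ f spread) ⟩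
        f * f + 2 * ∑ pairs T  ∎)
        where
        l₂ : ∀ a b c → (a * b + c) + (a * b + c) ≡ a * (2 * b) + 2 * c
        l₂ = ring-ℕ
      each : ∀ {z} → z ∈ T → H * pairs z ≤ H * f * ind (popular? z) + f
      each {z} z∈ with popular? z
      ... | yes _ = ℕP.≤-trans (ℕP.*-monoʳ-≤ H (count≤length (good? z) F))
                      (ℕP.≤-trans (ℕP.≤-reflexive (sym (ℕP.*-identityʳ _))) (ℕP.m≤m+n _ _))
      ... | no ¬p = ℕP.≤-trans (ℕP.<⇒≤ (ℕP.≰⇒> ¬p)) (ℕP.m≤n+m _ _)
      total : H * ∑ pairs T ≤ H * f * length R + f * (g * f)
      total = begin
        H * ∑ pairs T  ≡⟨ ∑-* H pairs T ⟨
        ∑ (λ z → H * pairs z) T  ≤⟨ ∑-mono T each ⟩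
        ∑ (λ z → H * f * ind (popular? z) + f) T  ≡⟨ ∑-+ (λ z → H * f * ind (popular? z)) (λ _ → f) T ⟩
        ∑ (λ z → H * f * ind (popular? z)) T + ∑ (λ _ → f) T
          ≡⟨ cong₂ _+_ (trans (∑-* (H * f) _ T) (cong (H * f *_) (sym (length-filter≡ popular? T)))) (trans (∑-const f T) (ℕP.*-comm (length T) f)) ⟩
        H * f * length R + f * length T  ≤⟨ ℕP.+-monoʳ-≤ _ (ℕP.*-monoʳ-≤ f T≤) ⟩
        H * f * length R + f * (g * f)  ∎
      cancel : 2 * (H * ∑ pairs T) ≤ H * f * (4 * length R)
      cancel = ℕP.+-cancelˡ-≤ (2 * (H * ∑ pairs T)) _ _ (begin
        2 * (H * ∑ pairs T) + 2 * (H * ∑ pairs T)  ≡⟨ l₃ (H * ∑ pairs T) ⟩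
        4 * (H * ∑ pairs T)  ≤⟨ ℕP.*-monoʳ-≤ 4 total ⟩
        4 * (H * f * length R + f * (g * f))  ≡⟨ l₄ g f (length R) ⟩
        H * (f * f) + H * f * (4 * length R)  ≤⟨ ℕP.+-monoˡ-≤ _ (ℕP.*-monoʳ-≤ H ff≤) ⟩
        H * (2 * ∑ pairs T) + H * f * (4 * length R)  ≡⟨ cong (_+ H * f * (4 * length R)) (l₁ H (∑ pairs T)) ⟩
        2 * (H * ∑ pairs T) + H * f * (4 * length R)  ∎)
        where
        l₃ : ∀ a → 2 * a + 2 * a ≡ 4 * a
        l₃ = ring-ℕ
        l₄ : ∀ g f r → 4 * (4 * g * f * r + f * (g * f)) ≡ 4 * g * (f * f) + 4 * g * f * (4 * r)
        l₄ = ring-ℕ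

    Avoiding : ℕ → List ℕ → List ℕ → Set
    Avoiding z Z B = ∃ λ B' → B' ∈ F × ((¬ Meets B B' × sum B + sum B' ≡ z) × ¬ Meets Z B × ¬ Meets Z B')

    avoiding? : ∀ z Z B → Dec (Avoiding z Z B)
    avoiding? z Z B = find∈? (λ B' → (¬? (meets? B B') ×-dec (sum B + sum B' ℕ.≟ z)) ×-dec (¬? (meets? Z B) ×-dec ¬? (meets? Z B'))) F

    -- A pair with sum z is determined by either member, so few pairs meet Z.
    R-robust : ∀ {z} → z ∈ R → ∀ Z → H * (2 * (length Z * cap)) < length F → z ∈ V (j + j) (A ∖ Z)
    R-robust {z} z∈ Z small with find∈? (avoiding? z Z) F
    ... | yes (B , B∈ , B' , B'∈ , (¬m , refl) , ¬mB , ¬mB') =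
      subst (_∈ V (j + j) (A ∖ Z)) (SumP.sum-++ B B') (∈-V⁺ {j + j} (rep-pair (avoid B∈ ¬mB) (avoid B'∈ ¬mB') ¬m))
      where
      avoid : ∀ {B} → B ∈ F → ¬ Meets Z B → Rep j (A ∖ Z) B
      avoid B∈ ¬m = let u , a , l = F-rep B∈ in
        u , All.tabulate (λ b∈ → ∖⁺ (All.lookup a b∈) (λ b∈Z → ¬m (_ , b∈Z , b∈))) , l
    ... | no none = ⊥-elim (ℕP.<⇒≱ small (begin
        length F  ≤⟨ proj₂ (∈-filter⁻ popular? {xs = T} z∈) ⟩
        H * pairs z  ≤⟨ ℕP.*-monoʳ-≤ H few ⟩
        H * (2 * (length Z * cap))  ∎))
      where
      open ℕP.≤-Reasoning
      hits = filter (meets? Z) F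
      G = filter (good? z) F
      hits≤ : length hits ≤ length Z * cap
      hits≤ = subst (_≤ length Z * cap) (sym (length-filter≡ (meets? Z) F)) (meets-few Z)
      in-hits : ∀ {B} → B ∈ G → sum B ∈ map sum hits ++ map (λ B' → z ∸ sum B') hits
      in-hits {B} B∈ with ∈-filter⁻ (good? z) {xs = F} B∈
      ... | B∈F , B' , B'∈ , ¬m , eq with meets? Z B | meets? Z B'
      ...   | yes m | _      = ∈-++⁺ˡ (∈-map⁺ sum (∈-filter⁺ (meets? Z) B∈F m))
      ...   | no _  | yes m' = ∈-++⁺ʳ (map sum hits)
          (subst (_∈ map (λ B' → z ∸ sum B') hits) (trans (cong (_∸ sum B') (sym eq)) (ℕP.m+n∸n≡m (sum B) (sum B')))
            (∈-map⁺ (λ B' → z ∸ sum B') (∈-filter⁺ (meets? Z) B'∈ m')))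
      ...   | no ¬mB | no ¬mB' = ⊥-elim (none (B , B∈F , B' , B'∈ , (¬m , eq) , ¬mB , ¬mB'))
      few : pairs z ≤ 2 * (length Z * cap)
      few = begin
        pairs z  ≡⟨ length-filter≡ (good? z) F ⟨
        length G  ≤⟨ length-inj sum (filter-unique (good? z) F-unique)
          (λ p q → F-inj (proj₁ (∈-filter⁻ (good? z) {xs = F} p)) (proj₁ (∈-filter⁻ (good? z) {xs = F} q))) in-hits ⟩
        length (map sum hits ++ map (λ B' → z ∸ sum B') hits) ≡⟨ ListP.length-++ (map sum hits) ⟩
        length (map sum hits) + length (map (λ B' → z ∸ sum B') hits)
          ≡⟨ cong₂ _+_ (ListP.length-map sum hits) (ListP.length-map _ hits) ⟩
        length hits + length hits  ≤⟨ ℕP.+-mono-≤ hits≤ hits≤ ⟩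
        length Z * cap + length Z * cap  ≡⟨ cong (length Z * cap +_) (ℕP.+-identityʳ _) ⟨
        2 * (length Z * cap)  ∎

-- Integer vectors and sumsets

infixl 6 _⊕_
infixl 7 _⊙_

dot : ∀ {n} → Vec ℤ n → Vec ℤ n → ℤ
dot Vec.[]       Vec.[]       = ℤ.0ℤ
dot (a Vec.∷ u) (b Vec.∷ v) = a ℤ.* b ℤ.+ dot u v

_⊕_ : ∀ {n} → Vec ℤ n → Vec ℤ n → Vec ℤ n
_⊕_ = Vec.zipWith ℤ._+_

_⊙_ : ∀ {n} → ℤ → Vec ℤ n → Vec ℤ n
k ⊙ v = Vec.map (k ℤ.*_) v

⊖_ : ∀ {n} → Vec ℤ n → Vec ℤ n
⊖ v = Vec.map ℤ.-_ v

0V : ∀ {n} → Vec ℤ n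
0V = Vec.replicate _ ℤ.0ℤ

dot-⊕ : ∀ {n} (e u v : Vec ℤ n) → dot e (u ⊕ v) ≡ dot e u ℤ.+ dot e v
dot-⊕ Vec.[] Vec.[] Vec.[] = refl
dot-⊕ (a Vec.∷ e) (b Vec.∷ u) (c Vec.∷ v) = trans (cong (λ w → a ℤ.* (b ℤ.+ c) ℤ.+ w) (dot-⊕ e u v)) (lem a b c _ _)
  where
  lem : ∀ a b c x y → a ℤ.* (b ℤ.+ c) ℤ.+ (x ℤ.+ y) ≡ a ℤ.* b ℤ.+ x ℤ.+ (a ℤ.* c ℤ.+ y)
  lem = ring-ℤ

dot-⊙ : ∀ {n} (e : Vec ℤ n) k u → dot e (k ⊙ u) ≡ k ℤ.* dot e u
dot-⊙ Vec.[] k Vec.[] = sym (ℤP.*-zeroʳ k)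
dot-⊙ (a Vec.∷ e) k (b Vec.∷ u) = trans (cong (λ w → a ℤ.* (k ℤ.* b) ℤ.+ w) (dot-⊙ e k u)) (lem a b k _)
  where
  lem : ∀ a b k x → a ℤ.* (k ℤ.* b) ℤ.+ k ℤ.* x ≡ k ℤ.* (a ℤ.* b ℤ.+ x)
  lem = ring-ℤ

dot-⊙ˡ : ∀ {n} k (e u : Vec ℤ n) → dot (k ⊙ e) u ≡ k ℤ.* dot e u
dot-⊙ˡ k Vec.[] Vec.[] = sym (ℤP.*-zeroʳ k)
dot-⊙ˡ k (a Vec.∷ e) (b Vec.∷ u) = trans (cong (λ w → k ℤ.* a ℤ.* b ℤ.+ w) (dot-⊙ˡ k e u)) (lem a b k _)
  where
  lem : ∀ a b k x → k ℤ.* a ℤ.* b ℤ.+ k ℤ.* x ≡ k ℤ.* (a ℤ.* b ℤ.+ x)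
  lem = ring-ℤ

dot-⊖ : ∀ {n} (e u : Vec ℤ n) → dot e (⊖ u) ≡ ℤ.- dot e u
dot-⊖ Vec.[] Vec.[] = refl
dot-⊖ (a Vec.∷ e) (b Vec.∷ u) = trans (cong (λ w → a ℤ.* (ℤ.- b) ℤ.+ w) (dot-⊖ e u)) (lem a b _)
  where
  lem : ∀ a b x → a ℤ.* (ℤ.- b) ℤ.+ (ℤ.- x) ≡ ℤ.- (a ℤ.* b ℤ.+ x)
  lem = ring-ℤ

dot-0 : ∀ {n} (e : Vec ℤ n) → dot e 0V ≡ ℤ.0ℤ
dot-0 Vec.[]       = refl
dot-0 (a Vec.∷ e) = cong₂ ℤ._+_ (ℤP.*-zeroʳ a) (dot-0 e)

Bnd : ∀ {n} → ℕ → Vec ℤ n → Set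
Bnd q = VAll.All (λ a → ∣ a ∣ ≤ q)

bnd-mono : ∀ {n p q} {v : Vec ℤ n} → p ≤ q → Bnd p v → Bnd q v
bnd-mono h = VAll.map (λ l → ℕP.≤-trans l h)

bnd-⊕ : ∀ {n p q} {u v : Vec ℤ n} → Bnd p u → Bnd q v → Bnd (p + q) (u ⊕ v)
bnd-⊕ {u = Vec.[]} {Vec.[]} VAll.[] VAll.[] = VAll.[]
bnd-⊕ {u = a Vec.∷ u} {b Vec.∷ v} (h VAll.∷ hs) (k VAll.∷ ks) =
  ℕP.≤-trans (ℤP.∣i+j∣≤∣i∣+∣j∣ a b) (ℕP.+-mono-≤ h k) VAll.∷ bnd-⊕ hs ks

bnd-⊙ : ∀ {n p q} k {v : Vec ℤ n} → ∣ k ∣ ≤ p → Bnd q v → Bnd (p * q) (k ⊙ v)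
bnd-⊙ k {Vec.[]} h VAll.[] = VAll.[]
bnd-⊙ k {b Vec.∷ v} h (l VAll.∷ ls) =
  ℕP.≤-trans (ℕP.≤-reflexive (ℤP.abs-* k b)) (ℕP.*-mono-≤ h l) VAll.∷ bnd-⊙ k h ls

bnd-⊖ : ∀ {n q} {v : Vec ℤ n} → Bnd q v → Bnd q (⊖ v)
bnd-⊖ {v = Vec.[]} VAll.[] = VAll.[]
bnd-⊖ {v = b Vec.∷ v} (l VAll.∷ ls) = subst (_≤ _) (sym (ℤP.∣-i∣≡∣i∣ b)) l VAll.∷ bnd-⊖ ls

bnd-0 : ∀ {n} q → Bnd {n} q 0V
bnd-0 {zero}  q = VAll.[]
bnd-0 {suc n} q = z≤n VAll.∷ bnd-0 q

⊙-cancel : ∀ {n} k (u v : Vec ℤ n) → k ≢ ℤ.0ℤ → k ⊙ u ≡ k ⊙ v → u ≡ v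
⊙-cancel k Vec.[] Vec.[] k≢0 eq = refl
⊙-cancel k (a Vec.∷ u) (b Vec.∷ v) k≢0 eq = cong₂ Vec._∷_
  (ℤP.*-cancelˡ-≡ k a b ⦃ ℤ.≢-nonZero k≢0 ⦄ (VecP.∷-injectiveˡ eq))
  (⊙-cancel k u v k≢0 (VecP.∷-injectiveʳ eq))

⊕-identityʳ : ∀ {n} (u : Vec ℤ n) → u ⊕ 0V ≡ u
⊕-identityʳ = VecP.zipWith-identityʳ ℤP.+-identityʳ

⊕-identityˡ : ∀ {n} (u : Vec ℤ n) → 0V ⊕ u ≡ u
⊕-identityˡ = VecP.zipWith-identityˡ ℤP.+-identityˡ

⊕-inverseʳ : ∀ {n} (u : Vec ℤ n) → u ⊕ ⊖ u ≡ 0V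
⊕-inverseʳ Vec.[]       = refl
⊕-inverseʳ (a Vec.∷ u) = cong₂ Vec._∷_ (ℤP.+-inverseʳ a) (⊕-inverseʳ u)

diff≡0 : ∀ {n} (u v : Vec ℤ n) → u ⊕ ⊖ v ≡ 0V → u ≡ v
diff≡0 Vec.[] Vec.[] eq = refl
diff≡0 (a Vec.∷ u) (b Vec.∷ v) eq =
  cong₂ Vec._∷_ (ℤP.i-j≡0⇒i≡j a b (VecP.∷-injectiveˡ eq)) (diff≡0 u v (VecP.∷-injectiveʳ eq))

⊙-zero : ∀ {n} (u : Vec ℤ n) → ℤ.0ℤ ⊙ u ≡ 0V
⊙-zero Vec.[]       = refl
⊙-zero (a Vec.∷ u) = cong (ℤ.0ℤ Vec.∷_) (⊙-zero u)

⊙-0V : ∀ {n} k → k ⊙ 0V {n} ≡ 0V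
⊙-0V {zero}  k = refl
⊙-0V {suc n} k = cong₂ Vec._∷_ (ℤP.*-zeroʳ k) (⊙-0V k)

⊙-suc : ∀ {n} k (u : Vec ℤ n) → pos (suc k) ⊙ u ≡ u ⊕ pos k ⊙ u
⊙-suc k Vec.[]       = refl
⊙-suc k (a Vec.∷ u) = cong₂ Vec._∷_ (ℤP.suc-* (pos k) a) (⊙-suc k u)

data Sums (P : ℤ → Set) : ℕ → ℤ → Set where
  nil : Sums P 0 ℤ.0ℤ
  more : ∀ {n x z} → P x → Sums P n z → Sums P (suc n) (x ℤ.+ z)

module _ {P : ℤ → Set} where

  one : ∀ {x} → P x → Sums P 1 x
  one {x} p = subst (Sums P 1) (ℤP.+-identityʳ x) (more p nil)

  sums-+ : ∀ {m n y z} → Sums P m y → Sums P n z → Sums P (m + n) (y ℤ.+ z)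
  sums-+ {z = z} nil t       = subst (Sums P _) (sym (ℤP.+-identityˡ z)) t
  sums-+ {z = z} (more {x = x} {y} p s) t = subst (Sums P _) (sym (ℤP.+-assoc x y z)) (more p (sums-+ s t))

  sums-join : ∀ {m n z} → Sums (Sums P m) n z → Sums P (n * m) z
  sums-join nil       = nil
  sums-join (more s t) = sums-+ s (sums-join t)

  sums-pad : P ℤ.0ℤ → ∀ {n z} m → Sums P n z → Sums P (m + n) z
  sums-pad p0 zero    s = s
  sums-pad p0 {z = z} (suc m) s = subst (Sums P _) (ℤP.+-identityˡ z) (more p0 (sums-pad p0 m s))

  sums-≤ : P ℤ.0ℤ → ∀ {m n z} → m ≤ n → Sums P m z → Sums P n z
  sums-≤ p0 {m} {n} {z} h s = subst (λ k → Sums P k z) (ℕP.m∸n+n≡m h) (sums-pad p0 (n ∸ m) s)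

  sums-neg : (∀ {x} → P x → P (ℤ.- x)) → ∀ {n z} → Sums P n z → Sums P n (ℤ.- z)
  sums-neg neg nil = nil
  sums-neg neg (more {x = x} {z} p s) =
    subst (Sums P _) (sym (ℤP.neg-distrib-+ x z)) (more (neg p) (sums-neg neg s))

  sums-⊙ : ∀ {x} n → P x → Sums P n (pos n ℤ.* x)
  sums-⊙ zero p = nil
  sums-⊙ {x} (suc n) p = subst (Sums P _) (sym (ℤP.suc-* (pos n) x)) (more p (sums-⊙ n p))

  sums-abs : (∀ {x} → P x → P (ℤ.- x)) → ∀ {x} k → P x → Sums P ∣ k ∣ (k ℤ.* x)
  sums-abs neg (pos n) p = sums-⊙ n p
  sums-abs neg {x} -[1+ n ] p = subst (Sums P (suc n)) (ℤP.neg-distribˡ-* (pos (suc n)) x) (sums-neg neg (sums-⊙ (suc n) p))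

sums-map : ∀ {P Q : ℤ → Set} → (∀ {x} → P x → Q x) → ∀ {n z} → Sums P n z → Sums Q n z
sums-map f nil       = nil
sums-map f (more p s) = more (f p) (sums-map f s)

sums-dot : ∀ {P : ℤ → Set} → P ℤ.0ℤ → (∀ {x} → P x → P (ℤ.- x)) →
  ∀ {n q} {X a : Vec ℤ n} → VAll.All P X → Bnd q a → Sums P (n * q) (dot X a)
sums-dot p0 neg {X = Vec.[]} {Vec.[]} VAll.[] VAll.[] = nil
sums-dot {P} p0 neg {X = x Vec.∷ X} {a Vec.∷ as} (p VAll.∷ ps) (l VAll.∷ ls) =
  subst (λ z → Sums P _ (z ℤ.+ dot X as)) (ℤP.*-comm a x) (sums-+ (sums-≤ p0 l (sums-abs neg a p)) (sums-dot p0 neg ps ls))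

ℤ-cancelˡ : ∀ x {y z} → x ℤ.+ y ≡ x ℤ.+ z → y ≡ z
ℤ-cancelˡ x {y} {z} eq = trans (lem x y) (trans (cong (ℤ._- x) eq) (sym (lem x z)))
  where
  lem : ∀ x y → y ≡ x ℤ.+ y ℤ.- x
  lem = ring-ℤ

ℤ-cancelʳ : ∀ x {y z} → y ℤ.+ x ≡ z ℤ.+ x → y ≡ z
ℤ-cancelʳ x {y} {z} eq = ℤ-cancelˡ x (trans (ℤP.+-comm x y) (trans eq (ℤP.+-comm z x)))

-- From few five-fold sums to a symmetric set covered by translates

infix 4 _∈ℤ?_
_∈ℤ?_ : (x : ℤ) (xs : List ℤ) → Dec (x ∈ xs)
_∈ℤ?_ = DecMembership._∈?_ ℤ._≟_

length-cartesianProductWith : ∀ {ℂ : Set} (f : 𝔸 → 𝔹 → ℂ) xs ys → length (cartesianProductWith f xs ys) ≡ length xs * length ys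
length-cartesianProductWith f []       ys = refl
length-cartesianProductWith f (x ∷ xs) ys = trans (ListP.length-++ (map (f x) ys))
  (cong₂ _+_ (ListP.length-map (f x) ys) (length-cartesianProductWith f xs ys))

-- Ruzsa covering for a set R with |R + R + R + R + R| ≤ G |R|.  The set is first
-- replaced by U ⊆ R with σ − U = U, for which differences are sums shifted by σ.
module Covering (R : List ℤ) (uR : Unique R) (r₀ : ℤ) (r₀∈ : r₀ ∈ R) (T : List ℤ)
  (five : ∀ {z} → Sums (_∈ R) 5 z → z ∈ T) (G : ℕ) (T≤ : length T ≤ G * length R) where

  private
    R≥1 : 1 ≤ length R
    R≥1 = ∈-length r₀∈

    three : Sums (_∈ R) 3 (r₀ ℤ.+ (r₀ ℤ.+ (r₀ ℤ.+ ℤ.0ℤ)))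
    three = more r₀∈ (more r₀∈ (more r₀∈ nil))

    t₀ : ℤ
    t₀ = r₀ ℤ.+ (r₀ ℤ.+ (r₀ ℤ.+ ℤ.0ℤ))

    T₂ : List ℤ
    T₂ = map (λ t → t ℤ.- t₀) T

    T₂≡ : length T₂ ≡ length T
    T₂≡ = ListP.length-map _ T

    -- Only five-fold sums are known to lie in `T`, so a sum of two is completed by the fixed
    -- threefold sum `t₀`, which is subtracted again.
    sum∈T₂ : ∀ {x y} → x ∈ R → y ∈ R → x ℤ.+ y ∈ T₂
    sum∈T₂ {x} {y} x∈ y∈ = subst (_∈ T₂) (lem x y t₀)
      (∈-map⁺ (λ t → t ℤ.- t₀) (five (sums-+ (more x∈ (more y∈ nil)) three)))
      where
      lem : ∀ x y t → x ℤ.+ (y ℤ.+ ℤ.0ℤ) ℤ.+ t ℤ.- t ≡ x ℤ.+ y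
      lem = ring-ℤ

    refl? : ∀ σ z → Dec (σ ℤ.- z ∈ R)
    refl? σ z = (σ ℤ.- z) ∈ℤ? R

    solutions : ∀ {z} → z ∈ R → length R ≤ count (λ σ → refl? σ z) T₂
    solutions {z} z∈ = subst (length R ≤_) (length-filter≡ (λ σ → refl? σ z) T₂)
      (length-inj (λ w → z ℤ.+ w) uR (λ _ _ → ℤ-cancelˡ z)
        (λ {w} w∈ → ∈-filter⁺ (λ σ → refl? σ z) (sum∈T₂ z∈ w∈) (subst (_∈ R) (lem z w) w∈)))
      where
      lem : ∀ z w → w ≡ z ℤ.+ w ℤ.- z
      lem = ring-ℤ

    abstract
      -- Averaging: the `|R|²` pairs have their sums in `T₂`, which has at most `G |R|` elements, so
      -- some value is attained by at least `|R| / G` pairs.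
      popular : ∃ λ σ → σ ∈ T₂ × length R ≤ G * count (refl? σ) R
      popular = ∑-large (λ σ → G * count (refl? σ) R) (length R) T₂ (begin
          length T₂ * length R  ≡⟨ cong (_* length R) T₂≡ ⟩
          length T * length R  ≤⟨ ℕP.*-monoˡ-≤ (length R) T≤ ⟩
          G * length R * length R  ≡⟨ ℕP.*-assoc G _ _ ⟩
          G * (length R * length R)  ≡⟨ cong (G *_) (∑-const (length R) R) ⟨
          G * ∑ (λ _ → length R) R  ≤⟨ ℕP.*-monoʳ-≤ G (∑-mono R solutions) ⟩
          G * ∑ (λ z → count (λ σ → refl? σ z) T₂) R  ≡⟨ cong (G *_) (∑-swap (λ z σ → ind (refl? σ z)) R T₂) ⟩
          G * ∑ (λ σ → count (refl? σ) R) T₂  ≡⟨ ∑-* G (λ σ → count (refl? σ) R) T₂ ⟨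
          ∑ (λ σ → G * count (refl? σ) R) T₂  ∎)
        (∈-length (sum∈T₂ r₀∈ r₀∈))
        where open ℕP.≤-Reasoning

  σ : ℤ
  σ = proj₁ popular

  U : List ℤ
  U = filter (refl? σ) R

  U⁻ : ∀ {u} → u ∈ U → u ∈ R × σ ℤ.- u ∈ R
  U⁻ = ∈-filter⁻ (refl? σ) {xs = R}

  U-unique : Unique U
  U-unique = filter-unique (refl? σ) uR

  R≤U : length R ≤ G * length U
  R≤U = subst (λ k → length R ≤ G * k) (sym (length-filter≡ (refl? σ) R)) (proj₂ (proj₂ popular))

  private
    nonempty : ∀ {xs : List ℤ} → 1 ≤ length xs → ∃ (_∈ xs)
    nonempty {x ∷ xs} _ = x , here refl

    U≥1 : 1 ≤ length U
    U≥1 with length U in eq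
    ... | suc _ = s≤s z≤n
    ... | zero  = ⊥-elim (ℕP.<⇒≱ R≥1 (ℕP.≤-trans R≤U (ℕP.≤-reflexive (trans (cong (G *_) eq) (ℕP.*-zeroʳ G)))))

  u₀ : ℤ
  u₀ = proj₁ (nonempty {U} U≥1)

  u₀∈ : u₀ ∈ U
  u₀∈ = proj₂ (nonempty {U} U≥1)

  S : List ℤ
  S = cartesianProductWith ℤ._-_ U U

  S⁺ : ∀ {u v} → u ∈ U → v ∈ U → u ℤ.- v ∈ S
  S⁺ = ∈-cartesianProductWith⁺ ℤ._-_

  S⁻ : ∀ {x} → x ∈ S → ∃₂ λ u v → u ∈ U × v ∈ U × x ≡ u ℤ.- v
  S⁻ = ∈-cartesianProductWith⁻ ℤ._-_ U U

  0∈S : ℤ.0ℤ ∈ S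
  0∈S = subst (_∈ S) (ℤP.+-inverseʳ u₀) (S⁺ u₀∈ u₀∈)

  S-neg : ∀ {x} → x ∈ S → ℤ.- x ∈ S
  S-neg x∈ with S⁻ x∈
  ... | u , v , u∈ , v∈ , refl = subst (_∈ S) (lem u v) (S⁺ v∈ u∈)
    where
    lem : ∀ u v → v ℤ.- u ≡ ℤ.- (u ℤ.- v)
    lem = ring-ℤ

  S-shift : ∀ {x} → x ∈ S → Sums (_∈ R) 2 (x ℤ.+ σ)
  S-shift x∈ with S⁻ x∈
  ... | u , v , u∈ , v∈ , refl = subst (Sums (_∈ R) 2) (lem u v σ) (more (proj₁ (U⁻ u∈)) (one (proj₂ (U⁻ v∈))))
    where
    lem : ∀ u v s → u ℤ.+ (s ℤ.- v) ≡ u ℤ.- v ℤ.+ s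
    lem = ring-ℤ

  -- A translate of `U` inside `S`. The list `S` has repetitions, so the size of `S` is measured on
  -- this part of it.
  E : List ℤ
  E = map (ℤ._- u₀) U

  E-unique : Unique E
  E-unique = UniqueP.map⁺ (ℤ-cancelʳ (ℤ.- u₀)) U-unique

  E⊑S : E ⊑ S
  E⊑S x∈ with ∈-map⁻ (ℤ._- u₀) x∈
  ... | u , u∈ , refl = S⁺ u∈ u₀∈

  R≤E : length R ≤ G * length E
  R≤E = subst (λ k → length R ≤ G * k) (sym (ListP.length-map _ U)) R≤U

  private
    Apart : ℤ → ℤ → Set
    Apart w y = w ℤ.- y ∉ S

    separated : ∀ W → ∃ λ Y → Y ⊑ W × Data.List.Relation.Unary.AllPairs.AllPairs Apart Y
                    × (∀ {w} → w ∈ W → ∃ λ y → y ∈ Y × w ℤ.- y ∈ S)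
    separated [] = [] , id , [] , λ ()
    separated (w ∷ W) with separated W
    ... | Y , sub , sep , cov with find∈? (λ y → (w ℤ.- y) ∈ℤ? S) Y
    ...   | yes near = Y , there ∘ sub , sep , λ { (here refl) → near ; (there p) → cov p }
    ...   | no far = w ∷ Y , (λ { (here refl) → here refl ; (there p) → there (sub p) })
        , (All.tabulate (λ y∈ n → far (_ , y∈ , n)) ∷ sep)
        , λ { (here refl) → w , here refl , subst (_∈ S) (sym (ℤP.+-inverseʳ w)) 0∈S
            ; (there p) → let y , y∈ , n = cov p in y , there y∈ , n }

    W = cartesianProductWith ℤ._+_ S S
    abstract
      result : ∃ λ Y → Y ⊑ W × Data.List.Relation.Unary.AllPairs.AllPairs Apart Y
             × (∀ {w} → w ∈ W → ∃ λ y → y ∈ Y × w ℤ.- y ∈ S)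
      result = separated W

  Y : List ℤ
  Y = proj₁ result

  Y-split : ∀ {y} → y ∈ Y → ∃₂ λ s s' → s ∈ S × s' ∈ S × y ≡ s ℤ.+ s'
  Y-split y∈ = ∈-cartesianProductWith⁻ ℤ._+_ S S (proj₁ (proj₂ result) y∈)

  Y-covers : ∀ {s s'} → s ∈ S → s' ∈ S → ∃₂ λ y s'' → y ∈ Y × s'' ∈ S × s ℤ.+ s' ≡ s'' ℤ.+ y
  Y-covers {s} {s'} s∈ s'∈ with proj₂ (proj₂ (proj₂ result)) (∈-cartesianProductWith⁺ ℤ._+_ s∈ s'∈)
  ... | y , y∈ , n = y , _ , y∈ , n , lem (s ℤ.+ s') y
    where
    lem : ∀ w y → w ≡ w ℤ.- y ℤ.+ y
    lem = ring-ℤ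

  -- The translates `y + U` are disjoint, because a coincidence would put `y - y'` into `S`. Shifted
  -- by `2σ`, an element of `Y + U` is a sum of `2 + 2 + 1` elements of `R`, hence lies in `T`.
  Y≤ : length Y ≤ G * G
  Y≤ = ℕP.*-cancelʳ-≤ (length Y) (G * G) (length U) ⦃ ℕ.>-nonZero U≥1 ⦄ (begin
      length Y * length U  ≡⟨ length-cartesianProductWith _,_ Y U ⟨
      length (cartesianProductWith _,_ Y U)  ≤⟨ length-inj (λ (y , u) → y ℤ.+ u) uniq inj mem ⟩
      length (map (λ t → t ℤ.- (σ ℤ.+ σ)) T)  ≡⟨ ListP.length-map _ T ⟩
      length T  ≤⟨ T≤ ⟩
      G * length R  ≤⟨ ℕP.*-monoʳ-≤ G R≤U ⟩
      G * (G * length U)  ≡⟨ ℕP.*-assoc G G _ ⟨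
      G * G * length U  ∎)
    where
    open ℕP.≤-Reasoning
    sep = proj₁ (proj₂ (proj₂ result))
    Y-unique : Unique Y
    Y-unique = Data.List.Relation.Unary.AllPairs.map
      (λ { {w} far refl → far (subst (_∈ S) (sym (ℤP.+-inverseʳ w)) 0∈S) }) sep
    uniq : Unique (cartesianProductWith _,_ Y U)
    uniq = UniqueP.cartesianProductWith⁺ _,_ (λ { refl → refl , refl }) Y-unique U-unique
    diff : ∀ y u y' u' → y ℤ.+ u ≡ y' ℤ.+ u' → y ℤ.- y' ≡ u' ℤ.- u
    diff y u y' u' eq = trans (l₁ y u y') (trans (cong (λ w → w ℤ.- u ℤ.- y') eq) (l₂ y' u' u))
      where
      l₁ : ∀ y u y' → y ℤ.- y' ≡ y ℤ.+ u ℤ.- u ℤ.- y'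
      l₁ = ring-ℤ
      l₂ : ∀ y' u' u → y' ℤ.+ u' ℤ.- u ℤ.- y' ≡ u' ℤ.- u
      l₂ = ring-ℤ
    inj : ∀ {p q} → p ∈ cartesianProductWith _,_ Y U → q ∈ cartesianProductWith _,_ Y U →
      proj₁ p ℤ.+ proj₂ p ≡ proj₁ q ℤ.+ proj₂ q → p ≡ q
    inj p∈ q∈ eq with ∈-cartesianProductWith⁻ _,_ Y U p∈ | ∈-cartesianProductWith⁻ _,_ Y U q∈
    ... | y , u , y∈ , u∈ , refl | y' , u' , y'∈ , u'∈ , refl with ∈-AllPairs₂ sep y∈ y'∈
    ...   | inj₁ refl       = cong (y ,_) (ℤ-cancelˡ y eq)
    ...   | inj₂ (inj₁ far) = ⊥-elim (far (subst (_∈ S) (sym (diff y u y' u' eq)) (S⁺ u'∈ u∈)))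
    ...   | inj₂ (inj₂ far) = ⊥-elim (far (subst (_∈ S) (sym (diff y' u' y u (sym eq))) (S⁺ u∈ u'∈)))
    mem : ∀ {p} → p ∈ cartesianProductWith _,_ Y U → proj₁ p ℤ.+ proj₂ p ∈ map (λ t → t ℤ.- (σ ℤ.+ σ)) T
    mem p∈ with ∈-cartesianProductWith⁻ _,_ Y U p∈
    ... | y , u , y∈ , u∈ , refl with Y-split y∈
    ...   | s , s' , s∈ , s'∈ , refl = subst (_∈ map (λ t → t ℤ.- (σ ℤ.+ σ)) T) (lem s s' u σ)
        (∈-map⁺ (λ t → t ℤ.- (σ ℤ.+ σ)) (five (sums-+ (S-shift s∈) (sums-+ (S-shift s'∈) (one (proj₁ (U⁻ u∈)))))))
      where
      lem : ∀ s s' u t → s ℤ.+ t ℤ.+ (s' ℤ.+ t ℤ.+ u) ℤ.- (t ℤ.+ t) ≡ s ℤ.+ s' ℤ.+ u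
      lem = ring-ℤ

  private
    -- The covering translates lie in `S + S`. Splitting each into its two summands gives generators
    -- in `S` itself, at the price of coefficients up to 2.
    generators : ∀ Y → (∀ {y} → y ∈ Y → ∃₂ λ s s' → s ∈ S × s' ∈ S × y ≡ s ℤ.+ s') →
      ∃ λ X → length X ≡ 2 * length Y × X ⊑ S × (∀ {y} → y ∈ Y → ∃₂ λ x x' → x ∈ X × x' ∈ X × y ≡ x ℤ.+ x')
    generators [] h = [] , refl , (λ ()) , λ ()
    generators (y ∷ Y) h with h (here refl) | generators Y (h ∘ there)
    ... | s , s' , s∈ , s'∈ , eq | X , l , sub , dec =
      s ∷ s' ∷ X , cong suc (trans (cong suc l) (sym (ℕP.+-suc (length Y) _)))
      , (λ { (here refl) → s∈ ; (there (here refl)) → s'∈ ; (there (there p)) → sub p })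
      , λ { (here refl) → s , s' , here refl , there (here refl) , eq
          ; (there p) → let x , x' , x∈ , x'∈ , e = dec p in x , x' , there (there x∈) , there (there x'∈) , e }

    -- Padding by zeros, which lie in `S`, gives a length that depends on `G` only, so that all
    -- later dimension bounds are uniform.
    vector : ∀ ξ X → length X ≤ ξ → X ⊑ S → ∃ λ (v : Vec ℤ ξ) → VAll.All (_∈ S) v
      × (∀ {x} → x ∈ X → ∃ λ a → Bnd 1 a × x ≡ dot v a)
    vector zero    []      _ _ = Vec.[] , VAll.[] , λ ()
    vector (suc ξ) []      _ _ = let v , h , _ = vector ξ [] z≤n (λ ()) in ℤ.0ℤ Vec.∷ v , 0∈S VAll.∷ h , λ ()
    vector (suc ξ) (x ∷ X) (s≤s l) sub with vector ξ X l (sub ∘ there)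
    ... | v , h , dec = x Vec.∷ v , sub (here refl) VAll.∷ h , λ
      { (here refl) → pos 1 Vec.∷ 0V , ℕP.≤-refl VAll.∷ bnd-0 1 ,
          sym (trans (cong (λ w → x ℤ.* pos 1 ℤ.+ w) (dot-0 v)) (trans (ℤP.+-identityʳ _) (ℤP.*-identityʳ x)))
      ; (there p) → let a , b , e = dec p in ℤ.0ℤ Vec.∷ a , z≤n VAll.∷ b ,
          trans e (sym (trans (cong (ℤ._+ dot v a) (ℤP.*-zeroʳ x)) (ℤP.+-identityˡ _))) }

  private
    pair-coords : ∀ {n} (v : Vec ℤ n) {x x'} → (∃ λ a → Bnd 1 a × x ≡ dot v a) → (∃ λ a → Bnd 1 a × x' ≡ dot v a) →
      ∃ λ a → Bnd 2 a × x ℤ.+ x' ≡ dot v a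
    pair-coords v (a , ba , refl) (a' , ba' , refl) = a ⊕ a' , bnd-⊕ ba ba' , sym (dot-⊕ v a a')

    expand : ∀ {n} (v : Vec ℤ n) → (∀ {y} → y ∈ Y → ∃ λ a → Bnd 2 a × y ≡ dot v a) →
      ∀ {z} → (∃₂ λ y s → y ∈ Y × s ∈ S × z ≡ s ℤ.+ y) → ∃₂ λ s a → s ∈ S × Bnd 2 a × z ≡ s ℤ.+ dot v a
    expand v coord (y , s , y∈ , s∈ , eq) = let a , ba , e = coord y∈ in
      s , a , s∈ , ba , trans eq (cong (λ w → s ℤ.+ w) e)

  covering : ∃ λ (X : Vec ℤ (2 * (G * G))) → VAll.All (_∈ S) X
    × (∀ {s s'} → s ∈ S → s' ∈ S → ∃₂ λ s'' a → s'' ∈ S × Bnd 2 a × s ℤ.+ s' ≡ s'' ℤ.+ dot X a)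
  covering =
    let X , l , sub , dec = generators Y Y-split
        v , h , coord = vector (2 * (G * G)) X (subst (_≤ 2 * (G * G)) (sym l) (ℕP.*-monoʳ-≤ 2 Y≤)) sub
        coord₂ : ∀ {y} → y ∈ Y → ∃ λ a → Bnd 2 a × y ≡ dot v a
        coord₂ y∈ = let x , x' , x∈ , x'∈ , e = dec y∈ ; a , ba , e' = pair-coords v (coord x∈) (coord x'∈) in a , ba , trans e e'
    in v , h , λ s∈ s'∈ → expand v coord₂ (Y-covers s∈ s'∈)

-- Frames and the lattice model

range : ℕ → List ℤ
range q = map pos (upTo (suc q)) ++ map (ℤ.-_ ∘ pos) (upTo (suc q))

∈-range⁺ : ∀ {q} a → ∣ a ∣ ≤ q → a ∈ range q
∈-range⁺ {q} (pos n)   h = ∈-++⁺ˡ {xs = map pos (upTo (suc q))} (∈-map⁺ pos (∈-upTo⁺ (s≤s h)))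
∈-range⁺ {q} -[1+ n ] h = ∈-++⁺ʳ (map pos (upTo (suc q))) (∈-map⁺ (ℤ.-_ ∘ pos) (∈-upTo⁺ (s≤s h)))

∈-range⁻ : ∀ {q} a → a ∈ range q → ∣ a ∣ ≤ q
∈-range⁻ {q} a p with ∈-++⁻ (map pos (upTo (suc q))) p
... | inj₁ m with ∈-map⁻ pos m
...   | n , n∈ , refl = ℕP.<⇒≤pred (∈-upTo⁻ n∈)
∈-range⁻ {q} a p | inj₂ m with ∈-map⁻ (ℤ.-_ ∘ pos) m
...   | n , n∈ , refl = subst (_≤ q) (sym (ℤP.∣-i∣≡∣i∣ (pos n))) (ℕP.<⇒≤pred (∈-upTo⁻ n∈))

box : ∀ r → ℕ → List (Vec ℤ r)
box zero    q = Vec.[] ∷ []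
box (suc r) q = cartesianProductWith Vec._∷_ (range q) (box r q)

∈-box⁺ : ∀ {r q} {v : Vec ℤ r} → Bnd q v → v ∈ box r q
∈-box⁺ VAll.[]       = here refl
∈-box⁺ {v = a Vec.∷ v} (h VAll.∷ hs) = ∈-cartesianProductWith⁺ Vec._∷_ (∈-range⁺ a h) (∈-box⁺ hs)

∈-box⁻ : ∀ {r q} {v : Vec ℤ r} → v ∈ box r q → Bnd q v
∈-box⁻ {zero}  {v = Vec.[]} _ = VAll.[]
∈-box⁻ {suc r} {q} p with ∈-cartesianProductWith⁻ Vec._∷_ (range q) (box r q) p
... | a , v , a∈ , v∈ , refl = ∈-range⁻ a a∈ VAll.∷ ∈-box⁻ v∈

-- The quotient is rounded towards zero: rounding down would lose the bound on `∣ m ∣ * K` for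
-- negative `b`.
truncated-division : ∀ b K → 1 ≤ K → ∃₂ λ m r → b ≡ m ℤ.* pos K ℤ.+ r × ∣ r ∣ ≤ K × ∣ m ∣ * K ≤ ∣ b ∣
truncated-division b K@(suc _) _ with nat ∣ b ∣
  where
  nat : ∀ n → ∃₂ λ m r → n ≡ m * K + r × r ≤ K × m * K ≤ n
  nat n = n ℕDM./ K , n ℕDM.% K
    , trans (ℕDM.m≡m%n+[m/n]*n n K) (ℕP.+-comm (n ℕDM.% K) _)
    , ℕP.<⇒≤ (ℕDM.m%n<n n K) , ℕDM.m/n*n≤m n K
truncated-division (pos n) K@(suc _) _ | m , r , eq , r≤ , m≤ =
  pos m , pos r , trans (cong pos eq) (cong (ℤ._+ pos r) (ℤP.pos-* m K)) , r≤ , m≤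
truncated-division -[1+ n ] K@(suc _) _ | m , r , eq , r≤ , m≤ =
  ℤ.- pos m , ℤ.- pos r
  , trans (cong (ℤ.-_ ∘ pos) eq) (trans (cong (λ w → ℤ.- (w ℤ.+ pos r)) (ℤP.pos-* m K)) (lem (pos m) (pos K) (pos r)))
  , subst (_≤ K) (sym (ℤP.∣-i∣≡∣i∣ (pos r))) r≤
  , subst (λ w → w * K ≤ suc n) (sym (ℤP.∣-i∣≡∣i∣ (pos m))) m≤
  where
  lem : ∀ m k r → ℤ.- (m ℤ.* k ℤ.+ r) ≡ (ℤ.- m) ℤ.* k ℤ.+ (ℤ.- r)
  lem = ring-ℤ

iterate : (ℕ → ℕ) → ℕ → ℕ
iterate F zero    = 1
iterate F (suc n) = F (iterate F n)

-- A frame: multiples of elements of X, independent modulo S + S at a scale far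
-- larger than the one at which they generate a multiple of every element of X.
module Frames (S : List ℤ) (0∈S : ℤ.0ℤ ∈ S) (S-neg : ∀ {x} → x ∈ S → ℤ.- x ∈ S) (T : ℕ)
  (F : ℕ → ℕ) (F-inflates : ∀ q → q ≤ F q) where

  Rel : ∀ {r} → ℕ → Vec ℤ r → ℤ → Set
  Rel q e x = ∃ λ k → (1 ≤ k × k ≤ q) × ∃ λ t → Bnd q t × ∃₂ λ s s' → s ∈ S × s' ∈ S ×
    pos k ℤ.* (pos T ℤ.* x) ≡ s ℤ.+ s' ℤ.+ dot e t

  Indep : ∀ {r} → ℕ → Vec ℤ r → Set
  Indep q e = ∀ {v s s'} → Bnd q v → s ∈ S → s' ∈ S → dot e v ≡ s ℤ.+ s' → v ≡ 0V

  rel? : ∀ {r} q (e : Vec ℤ r) x → Dec (Rel q e x)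
  rel? {r} q e x = map′ to from (find∈? (λ k → find∈? (λ t → find∈? (λ s → find∈? (λ s' → eq? k t s s') S) S) (box r q)) (map suc (upTo q)))
    where
    eq? : ∀ k (t : Vec ℤ r) s s' → Dec (pos k ℤ.* (pos T ℤ.* x) ≡ s ℤ.+ s' ℤ.+ dot e t)
    eq? k t s s' = _ ℤ.≟ _
    to : (∃ λ k → k ∈ map suc (upTo q) × ∃ λ t → t ∈ box r q × ∃ λ s → s ∈ S × ∃ λ s' → s' ∈ S ×
      pos k ℤ.* (pos T ℤ.* x) ≡ s ℤ.+ s' ℤ.+ dot e t) → Rel q e x
    to (k , k∈ , t , t∈ , s , s∈ , s' , s'∈ , eq) with ∈-map⁻ suc k∈
    ... | i , i∈ , refl = suc i , (s≤s z≤n , ∈-upTo⁻ i∈) , t , ∈-box⁻ t∈ , s , s' , s∈ , s'∈ , eq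
    from : Rel q e x → _
    from (suc i , (_ , i<) , t , bt , s , s' , s∈ , s'∈ , eq) =
      suc i , ∈-map⁺ suc (∈-upTo⁺ i<) , t , ∈-box⁺ bt , s , s∈ , s' , s'∈ , eq

  rel-mono : ∀ {r p q} {e : Vec ℤ r} {x} → p ≤ q → Rel p e x → Rel q e x
  rel-mono h (k , (1≤k , k≤) , t , bt , rest) = k , (1≤k , ℕP.≤-trans k≤ h) , t , bnd-mono h bt , rest

  rel-extend : ∀ {r q} {e : Vec ℤ r} {x} y → Rel q e x → Rel q (y Vec.∷ e) x
  rel-extend {e = e} y (k , kb , t , bt , s , s' , s∈ , s'∈ , eq) =
    k , kb , ℤ.0ℤ Vec.∷ t , z≤n VAll.∷ bt , s , s' , s∈ , s'∈ , trans eq (cong (λ w → s ℤ.+ s' ℤ.+ w) (lem y (dot e t)))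
    where
    lem : ∀ y d → d ≡ y ℤ.* ℤ.0ℤ ℤ.+ d
    lem = ring-ℤ

  rel-new : ∀ {r} (e : Vec ℤ r) y → Rel 1 ((pos T ℤ.* y) Vec.∷ e) y
  rel-new e y = 1 , (ℕP.≤-refl , ℕP.≤-refl) , pos 1 Vec.∷ 0V , ℕP.≤-refl VAll.∷ bnd-0 1 , _ , _ , 0∈S , 0∈S
    , trans (lem (pos T ℤ.* y)) (cong (λ w → ℤ.0ℤ ℤ.+ ℤ.0ℤ ℤ.+ (pos T ℤ.* y ℤ.* pos 1 ℤ.+ w)) (sym (dot-0 e)))
    where
    lem : ∀ y → pos 1 ℤ.* y ≡ ℤ.0ℤ ℤ.+ ℤ.0ℤ ℤ.+ (y ℤ.* pos 1 ℤ.+ ℤ.0ℤ)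
    lem = ring-ℤ

  -- A dependency with nonzero coefficient at the new vector, solved for that term, is an excluded
  -- relation for `y`. One sign of the coefficient needs the symmetry of `S`. With coefficient zero
  -- it is a dependency of the old frame.
  indep-extend : ∀ {r p q} {e : Vec ℤ r} y → p ≤ q → Indep q e → ¬ Rel p e y → Indep p ((pos T ℤ.* y) Vec.∷ e)
  indep-extend {e = e} y h ind ¬rel {pos 0 Vec.∷ v} (_ VAll.∷ bv) s∈ s'∈ eq =
    cong (ℤ.0ℤ Vec.∷_) (ind (bnd-mono h bv) s∈ s'∈ (trans (lem (pos T ℤ.* y) (dot e v)) eq))
    where
    lem : ∀ y d → d ≡ y ℤ.* ℤ.0ℤ ℤ.+ d
    lem = ring-ℤ
  indep-extend {e = e} y h ind ¬rel {pos (suc k) Vec.∷ v} {s} {s'} (k≤ VAll.∷ bv) s∈ s'∈ eq =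
    ⊥-elim (¬rel (suc k , (s≤s z≤n , k≤) , ⊖ v , bnd-⊖ bv , s , s' , s∈ , s'∈ ,
      trans (lem (pos (suc k)) (pos T ℤ.* y) (dot e v)) (cong₂ ℤ._+_ eq (sym (dot-⊖ e v)))))
    where
    lem : ∀ k y d → k ℤ.* y ≡ y ℤ.* k ℤ.+ d ℤ.+ (ℤ.- d)
    lem = ring-ℤ
  indep-extend {e = e} y h ind ¬rel { -[1+ k ] Vec.∷ v} {s} {s'} (k≤ VAll.∷ bv) s∈ s'∈ eq =
    ⊥-elim (¬rel (suc k , (s≤s z≤n , k≤) , v , bv , ℤ.- s , ℤ.- s' , S-neg s∈ , S-neg s'∈ ,
      trans (lem (pos (suc k)) (pos T ℤ.* y) (dot e v)) (cong (ℤ._+ dot e v) (trans (cong ℤ.-_ eq) (ℤP.neg-distrib-+ s s')))))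
    where
    lem : ∀ k y d → k ℤ.* y ≡ ℤ.- (y ℤ.* (ℤ.- k) ℤ.+ d) ℤ.+ d
    lem = ring-ℤ

  iterate≥1 : ∀ n → 1 ≤ iterate F n
  iterate≥1 zero    = ℕP.≤-refl
  iterate≥1 (suc n) = ℕP.≤-trans (iterate≥1 n) (F-inflates _)

  Frame : ∀ {ξ} → Vec ℤ ξ → Set
  Frame {ξ} X = ∃ λ r → r ≤ ξ × ∃ λ (e : Vec ℤ r) → ∃ λ n → n ≤ ξ × Indep (F (iterate F n)) e
    × VAll.All (Rel (iterate F n) e) X × VAll.All (λ y → ∃ λ x → x ∈ Vec.toList X × y ≡ pos T ℤ.* x) e

  -- The empty frame is independent at every scale. Each element that is not yet related joins the
  -- frame and costs one level of the tower, so independence always holds one application of `F`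
  -- above the level at which relations are sought. After at most `ξ` rounds nothing is left
  -- unrelated.
  frame-from : ∀ {ξ} (X : Vec ℤ ξ) m Y → length Y ≡ m → Y ⊑ Vec.toList X → ∀ {r} (e : Vec ℤ r) → r + m ≤ ξ →
    Indep (iterate F (suc m)) e → VAll.All (λ x → x ∈ Y ⊎ Rel 1 e x) X →
    VAll.All (λ y → ∃ λ x → x ∈ Vec.toList X × y ≡ pos T ℤ.* x) e → Frame X
  frame-from X zero [] _ sub e r≤ ind rels orig =
    _ , ℕP.≤-trans (ℕP.m≤m+n _ 0) r≤ , e , 0 , z≤n , ind , VAll.map (λ { (inj₁ ()) ; (inj₂ p) → p }) rels , orig
  frame-from {ξ} X (suc m) Y len sub {r} e r≤ ind rels orig with find∈? (λ y → ¬? (rel? (iterate F (suc m)) e y)) Y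
  ... | no none = _ , ℕP.≤-trans (ℕP.m≤m+n r (suc m)) r≤ , e , suc m , ℕP.≤-trans (ℕP.m≤n+m (suc m) r) r≤ , ind , VAll.map found rels , orig
    where
    found : ∀ {x} → x ∈ Y ⊎ Rel 1 e x → Rel (iterate F (suc m)) e x
    found {x} (inj₁ x∈) = decidable-stable (rel? (iterate F (suc m)) e x) (λ ¬r → none (x , x∈ , ¬r))
    found (inj₂ p) = rel-mono {e = e} (iterate≥1 (suc m)) p
  ... | yes (y , y∈ , ¬rel) with ∈-∃++ y∈
  ... | ys , zs , refl = frame-from X m (ys ++ zs) (ℕP.suc-injective (trans (sym (split-len ys)) len))
      (sub ∘ keep) ((pos T ℤ.* y) Vec.∷ e) (subst (_≤ ξ) (ℕP.+-suc r m) r≤)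
      (indep-extend {q = iterate F (suc (suc m))} y (F-inflates _) ind ¬rel) (VAll.map next rels)
      ((y , sub y∈ , refl) VAll.∷ orig)
    where
    split-len : ∀ ys → length (ys ++ y ∷ zs) ≡ suc (length (ys ++ zs))
    split-len []       = refl
    split-len (_ ∷ ys) = cong suc (split-len ys)
    keep : ys ++ zs ⊑ ys ++ y ∷ zs
    keep p with ∈-++⁻ ys p
    ... | inj₁ q = ∈-++⁺ˡ q
    ... | inj₂ q = ∈-++⁺ʳ ys (there q)
    next : ∀ {x} → x ∈ ys ++ y ∷ zs ⊎ Rel 1 e x → x ∈ ys ++ zs ⊎ Rel 1 ((pos T ℤ.* y) Vec.∷ e) x
    next (inj₂ p) = inj₂ (rel-extend (pos T ℤ.* y) p)
    next (inj₁ p) with ∈-++⁻ ys p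
    ... | inj₁ q           = inj₁ (∈-++⁺ˡ q)
    ... | inj₂ (here refl) = inj₂ (rel-new e y)
    ... | inj₂ (there q)   = inj₁ (∈-++⁺ʳ ys q)

  abstract
    frame : ∀ {ξ} (X : Vec ℤ ξ) → Frame X
    frame {ξ} X = frame-from X ξ (Vec.toList X) (VecP.length-toList X) id Vec.[] ℕP.≤-refl
      (λ { {Vec.[]} _ _ _ _ → refl }) (start X) VAll.[]
      where
      start : ∀ {n} (Z : Vec ℤ n) → VAll.All (λ x → x ∈ Vec.toList Z ⊎ Rel 1 Vec.[] x) Z
      start Vec.[]       = VAll.[]
      start (z Vec.∷ Z) = inj₁ (here refl) VAll.∷ VAll.map (λ { (inj₁ p) → inj₁ (there p) ; (inj₂ p) → inj₂ p }) (start Z)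

-- The finite group modulo a frame and its coordinates

module Constants (ξ k₀ κ₀ : ℕ) where

  T : ℕ
  T = suc (4 * (ξ * k₀))

  -- All are functions of the scale `q` of the relations. `κ` bounds coefficients over `X`, `C` the
  -- frame vector carried by one addition, and `C'` the integral part of a lattice vector. `Q₁` is
  -- the defect bound `7C` plus the change of one step, `N` the number of coefficient vectors, `F`
  -- the independence needed for `N` steps, and `L` counts summands from `S`.
  μ κ C C' Q₁ N F L : ℕ → ℕ
  μ q  = 2 * (q * T) + 3 * k₀
  κ q  = q * T + (1 + ξ * (2 * μ q)) * k₀
  C q  = ξ * (μ q * q)
  C' q = κ₀ * C q + C q
  Q₁ q = 7 * C q + (C q + C q + C q + C' q)
  N q  = length (box ξ (κ q))
  F q  = q + (N q * (Q₁ q + 6 * C q) + N q * C q)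
  L q  = (1 + ξ * κ q) + (ξ * C' q) * T

  Lmax : ℕ
  Lmax = ∑ (L ∘ iterate F) (upTo (suc ξ))

  -- This identity dictates `T` and `μ`. Adding two coefficient vectors and covering once gives
  -- `k₀ + 2κ`, while reduction returns `2ξμ` summands of `S`, which enter `κ` again. The resulting
  -- term `4ξk₀μ` is absorbed because `T` exceeds `4ξk₀` by one.
  coefficients : ∀ q → k₀ + (κ q + κ q) ≡ μ q * T
  coefficients q = trans (lem (q * T) ξ k₀ (μ q)) (sym (ℕP.*-suc (μ q) _))
    where
    lem : ∀ a ξ k m → k + ((a + (1 + ξ * (2 * m)) * k) + (a + (1 + ξ * (2 * m)) * k)) ≡ (2 * a + 3 * k) + m * (4 * (ξ * k))
    lem = ring-ℕ

-- A symmetric set S with S + S inside S plus small combinations of X ⊆ S is, up to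
-- bounded error, a box in a lattice Λ ⊆ ℤʳ, the map back to ℤ being dot e / h.
record LatticeModel (S : List ℤ) (ξ κ₀ L : ℕ) : Set₁ where
  field
    r C h   : ℕ
    r≤      : r ≤ ξ
    h≢0     : NonZero h
    e       : Vec ℤ r
    Λ       : Vec ℤ r → Set
    Λ-minus : ∀ {u v} → Λ u → Λ v → Λ (u ⊕ ⊖ v)
    Λ-elem  : ∀ {u} → Λ u → Bnd (κ₀ * C * h) u → ∃ λ z → Sums (_∈ S) L z × dot e u ≡ pos h ℤ.* z
    Λ-inj   : ∀ {u} → Λ u → Bnd (κ₀ * C * h) u → dot e u ≡ ℤ.0ℤ → u ≡ 0V
    Λ-coord : ∀ {s} → s ∈ S → ∃ λ u → Λ u × Bnd (C * h) u × dot e u ≡ pos h ℤ.* s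

n∣n! : ∀ n → 1 ≤ n → n ∣ n !
n∣n! (suc n) _ = ℕD.m∣m*n (n !)

bnd-cancel : ∀ {n} k .⦃ _ : NonZero k ⦄ c (v : Vec ℤ n) → Bnd (k * c) (pos k ⊙ v) → Bnd c v
bnd-cancel k c Vec.[] VAll.[] = VAll.[]
bnd-cancel k c (a Vec.∷ v) (h VAll.∷ hs) =
  ℕP.*-cancelˡ-≤ k (subst (_≤ k * c) (ℤP.abs-* (pos k) a) h) VAll.∷ bnd-cancel k c v hs

bnd-zero : ∀ {n} W (v : Vec ℤ n) → Bnd W (pos (suc W) ⊙ v) → v ≡ 0V
bnd-zero W Vec.[] VAll.[] = refl
bnd-zero W (a Vec.∷ v) (h VAll.∷ hs) = cong₂ Vec._∷_ (ℤP.∣i∣≡0⇒i≡0 (small ∣ a ∣ (subst (_≤ W) (ℤP.abs-* (pos (suc W)) a) h))) (bnd-zero W v hs)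
  where
  small : ∀ x → suc W * x ≤ W → x ≡ 0
  small zero    _ = refl
  small (suc x) p = ⊥-elim (ℕP.<⇒≱ (ℕP.≤-trans (ℕP.n<1+n W) (ℕP.m≤m*n (suc W) (suc x))) p)

module LocalGroup (S : List ℤ) (0∈S : ℤ.0ℤ ∈ S) (S-neg : ∀ {x} → x ∈ S → ℤ.- x ∈ S)
  (ξ k₀ κ₀ : ℕ) (X : Vec ℤ ξ) (X⊆S : VAll.All (_∈ S) X)
  (cover : ∀ {s s'} → s ∈ S → s' ∈ S → ∃₂ λ s'' a → s'' ∈ S × Bnd k₀ a × s ℤ.+ s' ≡ s'' ℤ.+ dot X a) where

  private module K = Constants ξ k₀ κ₀
  open K using (T)
  open Frames S 0∈S S-neg T K.F (λ q → ℕP.m≤m+n q _)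

  multi : ∀ {n z} → Sums (_∈ S) n z → ∃₂ λ s a → s ∈ S × Bnd (n * k₀) a × z ≡ s ℤ.+ dot X a
  multi nil = ℤ.0ℤ , 0V , 0∈S , bnd-0 0 , sym (cong (λ w → ℤ.0ℤ ℤ.+ w) (dot-0 X))
  multi (more {x = x} x∈ s) with multi s
  ... | s' , a , s'∈ , ba , refl with cover x∈ s'∈
  ... | s'' , a' , s''∈ , ba' , eq = s'' , a' ⊕ a , s''∈ , bnd-⊕ ba' ba ,
    trans (sym (ℤP.+-assoc x s' _)) (trans (cong (ℤ._+ dot X a) eq)
      (trans (ℤP.+-assoc s'' _ _) (cong (λ w → s'' ℤ.+ w) (sym (dot-⊕ X a' a)))))

  module WithFrame (q : ℕ) {r : ℕ} (r≤ξ : r ≤ ξ) (e : Vec ℤ r) (indep : Indep (K.F q) e)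
    (rels : VAll.All (Rel q e) X) (e-orig : VAll.All (λ y → ∃ λ x → x ∈ Vec.toList X × y ≡ pos T ℤ.* x) e) where

    μ κ C C' Q₁ : ℕ
    μ  = K.μ q
    κ  = K.κ q
    C  = K.C q
    C' = K.C' q
    Q₁ = K.Q₁ q

    -- Each coefficient is divided by `k * T`, where `k` is the factor in the relation of its
    -- element. The multiple of `k * T` is replaced by that relation, at the cost of at most `2μ`
    -- summands of `S` and of frame coefficients up to `μ * q`.
    reduce : ∀ {n} (Y b : Vec ℤ n) → VAll.All (Rel q e) Y → Bnd (μ * T) b →
      ∃ λ c → ∃₂ λ z t → Bnd (q * T) c × Sums (_∈ S) (n * (2 * μ)) z × Bnd (n * (μ * q)) t
        × dot Y b ≡ dot Y c ℤ.+ z ℤ.+ dot e t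
    reduce Vec.[] Vec.[] VAll.[] VAll.[] = Vec.[] , ℤ.0ℤ , 0V , VAll.[] , nil , bnd-0 0 , sym (cong (λ w → ℤ.0ℤ ℤ.+ w) (dot-0 e))
    reduce (y Vec.∷ Y) (b Vec.∷ bs) ((k , (1≤k , k≤q) , t , bt , s , s' , s∈ , s'∈ , eq) VAll.∷ rs) (b≤ VAll.∷ bbs)
      with truncated-division b (k * T) (ℕP.*-mono-≤ 1≤k (s≤s z≤n)) | reduce Y bs rs bbs
    ... | m , c , b≡ , c≤ , m≤ | cs , z , t' , bcs , sz , bt' , eq' =
      c Vec.∷ cs , m ℤ.* s ℤ.+ (m ℤ.* s' ℤ.+ ℤ.0ℤ) ℤ.+ z , m ⊙ t ⊕ t'
      , ℕP.≤-trans c≤ (ℕP.*-monoˡ-≤ T k≤q) VAll.∷ bcs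
      , sums-+ (sums-+ (times s∈) (sums-+ (times s'∈) nil)) sz
      , bnd-⊕ (bnd-⊙ m m≤μ bt) bt'
      , trans (cong₂ (λ b d → y ℤ.* b ℤ.+ d) (trans b≡ (cong (λ w → m ℤ.* w ℤ.+ c) (ℤP.pos-* k T))) eq')
          (trans (lem₁ y m (pos k) (pos T) c (dot Y cs) z (dot e t'))
            (trans (cong (λ w → y ℤ.* c ℤ.+ m ℤ.* w ℤ.+ (dot Y cs ℤ.+ z ℤ.+ dot e t')) eq)
              (trans (lem₂ (y ℤ.* c) m s s' (dot e t) (dot Y cs) z (dot e t'))
                (cong (λ w → y ℤ.* c ℤ.+ dot Y cs ℤ.+ (m ℤ.* s ℤ.+ (m ℤ.* s' ℤ.+ ℤ.0ℤ) ℤ.+ z) ℤ.+ w)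
                  (sym (trans (dot-⊕ e (m ⊙ t) t') (cong (ℤ._+ dot e t') (dot-⊙ e m t))))))))
      where
      m≤μ : ∣ m ∣ ≤ μ
      m≤μ = ℕP.*-cancelʳ-≤ ∣ m ∣ μ T (ℕP.≤-trans (ℕP.*-monoʳ-≤ ∣ m ∣ (ℕP.m≤n*m T k ⦃ ℕ.>-nonZero 1≤k ⦄)) (ℕP.≤-trans m≤ b≤))
      times : ∀ {x} → x ∈ S → Sums (_∈ S) μ (m ℤ.* x)
      times x∈ = sums-≤ 0∈S m≤μ (sums-abs S-neg m x∈)
      lem₁ : ∀ y m k T c d z f → y ℤ.* (m ℤ.* (k ℤ.* T) ℤ.+ c) ℤ.+ (d ℤ.+ z ℤ.+ f) ≡ y ℤ.* c ℤ.+ m ℤ.* (k ℤ.* (T ℤ.* y)) ℤ.+ (d ℤ.+ z ℤ.+ f)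
      lem₁ = ring-ℤ
      lem₂ : ∀ yc m s s' g d z f → yc ℤ.+ m ℤ.* (s ℤ.+ s' ℤ.+ g) ℤ.+ (d ℤ.+ z ℤ.+ f)
        ≡ yc ℤ.+ d ℤ.+ (m ℤ.* s ℤ.+ (m ℤ.* s' ℤ.+ ℤ.0ℤ) ℤ.+ z) ℤ.+ (m ℤ.* g ℤ.+ f)
      lem₂ = ring-ℤ

    B : ℤ → Set
    B z = ∃₂ λ s b → s ∈ S × Bnd κ b × z ≡ s ℤ.+ dot X b

    S⊆B : ∀ {s} → s ∈ S → B s
    S⊆B {s} s∈ = s , 0V , s∈ , bnd-0 κ , sym (trans (cong (λ w → s ℤ.+ w) (dot-0 X)) (ℤP.+-identityʳ s))

    B-0 : B ℤ.0ℤ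
    B-0 = S⊆B 0∈S

    B-neg : ∀ {z} → B z → B (ℤ.- z)
    B-neg (s , b , s∈ , bb , refl) = ℤ.- s , ⊖ b , S-neg s∈ , bnd-⊖ bb ,
      trans (ℤP.neg-distrib-+ s (dot X b)) (cong (λ w → ℤ.- s ℤ.+ w) (sym (dot-⊖ X b)))

    abstract
      B-add : ∀ {y z} → B y → B z → ∃₂ λ w t → B w × Bnd C t × y ℤ.+ z ≡ w ℤ.+ dot e t
      B-add (s , b , s∈ , bb , refl) (s' , b' , s'∈ , bb' , refl) with cover s∈ s'∈
      ... | s₁ , a , s₁∈ , ba , eq with reduce X (a ⊕ (b ⊕ b')) rels
             (subst (λ w → Bnd w (a ⊕ (b ⊕ b'))) (K.coefficients q) (bnd-⊕ ba (bnd-⊕ bb bb')))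
      ... | c , z , t , bc , sz , bt , eq' with multi (more s₁∈ sz)
      ... | s₂ , a' , s₂∈ , ba' , eq'' = s₂ ℤ.+ dot X (c ⊕ a') , t , (s₂ , c ⊕ a' , s₂∈ , bnd-⊕ bc ba' , refl) , bt , (begin
        s ℤ.+ dot X b ℤ.+ (s' ℤ.+ dot X b')  ≡⟨ lem₁ s s' (dot X b) (dot X b') ⟩
        s ℤ.+ s' ℤ.+ (dot X b ℤ.+ dot X b')  ≡⟨ cong₂ ℤ._+_ eq (sym (dot-⊕ X b b')) ⟩
        s₁ ℤ.+ dot X a ℤ.+ dot X (b ⊕ b')  ≡⟨ ℤP.+-assoc s₁ _ _ ⟩
        s₁ ℤ.+ (dot X a ℤ.+ dot X (b ⊕ b'))  ≡⟨ cong (λ w → s₁ ℤ.+ w) (trans (sym (dot-⊕ X a (b ⊕ b'))) eq') ⟩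
        s₁ ℤ.+ (dot X c ℤ.+ z ℤ.+ dot e t)  ≡⟨ lem₂ s₁ (dot X c) z (dot e t) ⟩
        s₁ ℤ.+ z ℤ.+ dot X c ℤ.+ dot e t  ≡⟨ cong (λ w → w ℤ.+ dot X c ℤ.+ dot e t) eq'' ⟩
        s₂ ℤ.+ dot X a' ℤ.+ dot X c ℤ.+ dot e t  ≡⟨ lem₃ s₂ (dot X a') (dot X c) (dot e t) ⟩
        s₂ ℤ.+ (dot X c ℤ.+ dot X a') ℤ.+ dot e t  ≡⟨ cong (λ w → s₂ ℤ.+ w ℤ.+ dot e t) (dot-⊕ X c a') ⟨
        s₂ ℤ.+ dot X (c ⊕ a') ℤ.+ dot e t  ∎)
        where
        open ≡-Reasoning
        lem₁ : ∀ s s' x y → s ℤ.+ x ℤ.+ (s' ℤ.+ y) ≡ s ℤ.+ s' ℤ.+ (x ℤ.+ y)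
        lem₁ = ring-ℤ
        lem₂ : ∀ s x z t → s ℤ.+ (x ℤ.+ z ℤ.+ t) ≡ s ℤ.+ z ℤ.+ x ℤ.+ t
        lem₂ = ring-ℤ
        lem₃ : ∀ s x y t → s ℤ.+ x ℤ.+ y ℤ.+ t ≡ s ℤ.+ (y ℤ.+ x) ℤ.+ t
        lem₃ = ring-ℤ

    B-multi : ∀ {n z} → Sums B n z → ∃₂ λ w t → B w × Bnd (n * C) t × z ≡ w ℤ.+ dot e t
    B-multi nil = ℤ.0ℤ , 0V , B-0 , bnd-0 0 , sym (cong (λ w → ℤ.0ℤ ℤ.+ w) (dot-0 e))
    B-multi (more {x = x} bx s) with B-multi s
    ... | w , t , bw , bt , refl with B-add bx bw
    ... | w' , t' , bw' , bt' , eq = w' , t' ⊕ t , bw' , bnd-⊕ bt' bt ,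
      trans (sym (ℤP.+-assoc x w _)) (trans (cong (ℤ._+ dot e t) eq)
        (trans (ℤP.+-assoc w' _ _) (cong (λ u → w' ℤ.+ u) (sym (dot-⊕ e t' t)))))

    BL : List ℤ
    BL = cartesianProductWith (λ s b → s ℤ.+ dot X b) S (box ξ κ)

    ∈-BL : ∀ {z} → B z → z ∈ BL
    ∈-BL (s , b , s∈ , bb , refl) = ∈-cartesianProductWith⁺ (λ s b → s ℤ.+ dot X b) s∈ (∈-box⁺ bb)

    -- Repeated addition of `b`, the last index being the total carry. Any sum and carry are allowed
    -- in a step: carries are computed from a representation, and a walk may return to the same
    -- integer with another representation. Closed paths can nevertheless be repeated.
    data Path (b : ℤ) : ℕ → ℤ → ℤ → Vec ℤ r → Set where
      stay : ∀ {z} → B z → Path b 0 z z 0V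
      advance : ∀ {n z w w' θ δ} → Path b n z w θ → B w' → Bnd C δ → w ℤ.+ b ≡ w' ℤ.+ dot e δ →
        Path b (suc n) z w' (θ ⊕ δ)

    path-start : ∀ {b n z w θ} → Path b n z w θ → B z
    path-start (stay bz)      = bz
    path-start (advance p _ _ _) = path-start p

    path-end : ∀ {b n z w θ} → Path b n z w θ → B w
    path-end (stay bz)       = bz
    path-end (advance _ bw _ _) = bw

    path-bnd : ∀ {b n z w θ} → Path b n z w θ → Bnd (n * C) θ
    path-bnd (stay _) = bnd-0 0
    path-bnd {n = suc n} (advance {θ = θ} {δ} p _ bδ _) = subst (λ k → Bnd k (θ ⊕ δ)) (ℕP.+-comm (n * C) C) (bnd-⊕ (path-bnd p) bδ)

    path-eq : ∀ {b n z w θ} → Path b n z w θ → pos n ℤ.* b ℤ.+ z ≡ w ℤ.+ dot e θ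
    path-eq {z = z} (stay _) = trans (ℤP.+-identityˡ z) (sym (trans (cong (λ w → z ℤ.+ w) (dot-0 e)) (ℤP.+-identityʳ z)))
    path-eq {b} {suc n} {z} (advance {w = w} {w'} {θ} {δ} p _ _ eq) = begin
      pos (suc n) ℤ.* b ℤ.+ z  ≡⟨ cong (ℤ._+ z) (ℤP.suc-* (pos n) b) ⟩
      b ℤ.+ pos n ℤ.* b ℤ.+ z  ≡⟨ ℤP.+-assoc b _ z ⟩
      b ℤ.+ (pos n ℤ.* b ℤ.+ z)  ≡⟨ cong (λ u → b ℤ.+ u) (path-eq p) ⟩
      b ℤ.+ (w ℤ.+ dot e θ)  ≡⟨ lem b w (dot e θ) ⟩
      w ℤ.+ b ℤ.+ dot e θ  ≡⟨ cong (ℤ._+ dot e θ) eq ⟩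
      w' ℤ.+ dot e δ ℤ.+ dot e θ  ≡⟨ lem' w' (dot e δ) (dot e θ) ⟩
      w' ℤ.+ (dot e θ ℤ.+ dot e δ)  ≡⟨ cong (λ u → w' ℤ.+ u) (dot-⊕ e θ δ) ⟨
      w' ℤ.+ dot e (θ ⊕ δ)  ∎
      where
      open ≡-Reasoning
      lem : ∀ b w x → b ℤ.+ (w ℤ.+ x) ≡ w ℤ.+ b ℤ.+ x
      lem = ring-ℤ
      lem' : ∀ w x y → w ℤ.+ x ℤ.+ y ≡ w ℤ.+ (y ℤ.+ x)
      lem' = ring-ℤ

    path-join : ∀ {b m n x y z θ θ'} → Path b m y z θ' → Path b n x y θ → Path b (m + n) x z (θ ⊕ θ')
    path-join {θ = θ} (stay _) p = subst (Path _ _ _ _) (sym (⊕-identityʳ θ)) p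
    path-join {θ = θ} (advance {θ = θ'} {δ} p' bw bδ eq) p =
      subst (Path _ _ _ _) (VecP.zipWith-assoc ℤP.+-assoc θ θ' δ) (advance (path-join p' p) bw bδ eq)

    path-loop : ∀ {b k z θ} n → Path b k z z θ → Path b (n * k) z z (pos n ⊙ θ)
    path-loop {θ = θ} zero p = subst (Path _ _ _ _) (sym (⊙-zero θ)) (stay (path-start p))
    path-loop {θ = θ} (suc n) p = subst (Path _ _ _ _)
      (trans (VecP.zipWith-comm ℤP.+-comm (pos n ⊙ θ) θ) (sym (⊙-suc n θ))) (path-join p (path-loop n p))

    module Walk {b : ℤ} (bb : B b) where

      next : ∃ B → ∃ B
      next (z , bz) = let w , t , bw , _ = B-add bz bb in w , bw

      state : ℕ → ∃ B
      state zero    = ℤ.0ℤ , B-0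
      state (suc n) = next (state n)

      segment : ∀ i k → ∃ λ θ → Path b k (proj₁ (state i)) (proj₁ (state (i + k))) θ
      segment i zero = 0V , subst (λ n → Path b 0 (proj₁ (state i)) (proj₁ (state n)) 0V) (sym (ℕP.+-identityʳ i)) (stay (proj₂ (state i)))
      segment i (suc k) with segment i k
      ... | θ , p with B-add (proj₂ (state (i + k))) bb in same
      ...   | w , t , bw , bt , eq = θ ⊕ t , subst (λ n → Path b (suc k) (proj₁ (state i)) (proj₁ (state n)) (θ ⊕ t)) (sym (ℕP.+-suc i k))
              (subst (λ z → Path b (suc k) (proj₁ (state i)) z (θ ⊕ t)) (cong proj₁ (sym same)) (advance p bw bt eq))

      label : ℕ → Vec ℤ ξ
      label n = proj₁ (proj₂ (proj₂ (state n)))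

      label∈ : ∀ n → label n ∈ box ξ κ
      label∈ n = let _ , _ , _ , bb , _ = proj₂ (state n) in ∈-box⁺ bb

      abstract
        -- Pigeonhole on the coefficient vector alone: the walk returns up to an element of `S + S`
        -- within a number of steps independent of the size of `S`. The exact return in `loop` has
        -- no such bound, and independence of the frame is only available at a fixed scale.
        recurrence : ∃ λ k → (1 ≤ k × k ≤ K.N q) × ∃₂ λ z w → ∃ λ θ → Path b k z w θ ×
          ∃₂ λ s s' → s ∈ S × s' ∈ S × w ℤ.- z ≡ s ℤ.+ s'
        recurrence = let i , k , 1≤k , i+k≤ , eq = pigeonhole-list label (box ξ κ) label∈ ; θ , p = segment i k in
          k , (1≤k , ℕP.≤-trans (ℕP.m≤n+m k i) i+k≤) , _ , _ , θ , p , difference (proj₂ (state (i + k))) (proj₂ (state i)) (sym eq)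
          where
          difference : ∀ {w z} (bw : B w) (bz : B z) → proj₁ (proj₂ bw) ≡ proj₁ (proj₂ bz) →
            ∃₂ λ s s' → s ∈ S × s' ∈ S × w ℤ.- z ≡ s ℤ.+ s'
          difference (s , b , s∈ , _ , refl) (s' , .b , s'∈ , _ , refl) refl = s , ℤ.- s' , s∈ , S-neg s'∈ , lem s s' (dot X b)
            where
            lem : ∀ s s' x → s ℤ.+ x ℤ.- (s' ℤ.+ x) ≡ s ℤ.+ (ℤ.- s')
            lem = ring-ℤ

      loop : ∃ λ k → (1 ≤ k × k ≤ length BL) × ∃₂ λ z θ → Path b k z z θ
      loop = closed (pigeonhole-list (proj₁ ∘ state) BL (λ n → ∈-BL (proj₂ (state n))))
        where
        closed : (∃₂ λ i k → 1 ≤ k × i + k ≤ length BL × proj₁ (state i) ≡ proj₁ (state (i + k))) →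
          ∃ λ k → (1 ≤ k × k ≤ length BL) × ∃₂ λ z θ → Path b k z z θ
        closed (i , k , 1≤k , i+k≤ , eq) = let θ , p = segment i k in
          k , (1≤k , ℕP.≤-trans (ℕP.m≤n+m k i) i+k≤) , _ , θ , subst (λ w → Path b k (proj₁ (state i)) w θ) (sym eq) p

    -- Adding `dot e v` to itself returns up to `S + S` after `k ≤ N` steps with total carry `θ`.
    -- Independence then forces `k v = θ`, and `θ` is at most `C` per step.
    small-in-B : ∀ {v} → Bnd (Q₁ + 6 * C) v → B (dot e v) → Bnd C v
    small-in-B {v} bv b with Walk.recurrence b
    ... | suc k , (_ , k≤N) , z , w , θ , p , s , s' , s∈ , s'∈ , eq =
      bnd-cancel (suc k) C v (subst (Bnd (suc k * C)) (sym same) (path-bnd p))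
      where
      N = K.N q
      eq' : dot e (pos (suc k) ⊙ v ⊕ ⊖ θ) ≡ s ℤ.+ s'
      eq' = begin
        dot e (pos (suc k) ⊙ v ⊕ ⊖ θ)  ≡⟨ dot-⊕ e (pos (suc k) ⊙ v) (⊖ θ) ⟩
        dot e (pos (suc k) ⊙ v) ℤ.+ dot e (⊖ θ)  ≡⟨ cong₂ ℤ._+_ (dot-⊙ e (pos (suc k)) v) (dot-⊖ e θ) ⟩
        pos (suc k) ℤ.* dot e v ℤ.- dot e θ  ≡⟨ lem₁ (pos (suc k) ℤ.* dot e v) z (dot e θ) ⟩
        pos (suc k) ℤ.* dot e v ℤ.+ z ℤ.- z ℤ.- dot e θ  ≡⟨ cong (λ u → u ℤ.- z ℤ.- dot e θ) (path-eq p) ⟩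
        w ℤ.+ dot e θ ℤ.- z ℤ.- dot e θ  ≡⟨ lem₂ w z (dot e θ) ⟩
        w ℤ.- z  ≡⟨ eq ⟩
        s ℤ.+ s'  ∎
        where
        open ≡-Reasoning
        lem₁ : ∀ a z x → a ℤ.- x ≡ a ℤ.+ z ℤ.- z ℤ.- x
        lem₁ = ring-ℤ
        lem₂ : ∀ w z x → w ℤ.+ x ℤ.- z ℤ.- x ≡ w ℤ.- z
        lem₂ = ring-ℤ
      bounded : Bnd (K.F q) (pos (suc k) ⊙ v ⊕ ⊖ θ)
      bounded = bnd-mono (ℕP.m≤n+m _ q) (bnd-⊕ (bnd-⊙ (pos (suc k)) k≤N bv)
        (bnd-mono (ℕP.*-monoˡ-≤ C k≤N) (bnd-⊖ (path-bnd p))))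
      same : pos (suc k) ⊙ v ≡ θ
      same = diff≡0 _ _ (indep bounded s∈ s'∈ eq')

    -- Six elements of `B` add up to one element and a carry of size at most `6C`. Without the carry
    -- `small-in-B` applies, so the weak bound `Q₁` improves itself to `7C`.
    proper : ∀ {v} → Bnd Q₁ v → Sums B 6 (dot e v) → Bnd (7 * C) v
    proper {v} bv s with B-multi s
    ... | w , t , bw , bt , eq = subst (Bnd (7 * C)) (lem v t)
      (bnd-⊕ (small-in-B (bnd-⊕ bv (bnd-⊖ bt)) (subst B eq' bw)) bt)
      where
      lem : ∀ {n} (v t : Vec ℤ n) → (v ⊕ ⊖ t) ⊕ t ≡ v
      lem Vec.[] Vec.[] = refl
      lem (a Vec.∷ v) (b Vec.∷ t) = cong₂ Vec._∷_ (l a b) (lem v t)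
        where
        l : ∀ a b → a ℤ.+ (ℤ.- b) ℤ.+ b ≡ a
        l = ring-ℤ
      eq' : w ≡ dot e (v ⊕ ⊖ t)
      eq' = sym (trans (dot-⊕ e v (⊖ t)) (trans (cong₂ ℤ._+_ eq (dot-⊖ e t)) (l w (dot e t))))
        where
        l : ∀ w x → w ℤ.+ x ℤ.+ (ℤ.- x) ≡ w
        l = ring-ℤ

    -- A common multiple of all loop lengths: every `b` closes up after the same number of steps,
    -- and `h` is the common denominator of all coordinates. Its size does not matter, since
    -- coordinate bounds are proportional to it.
    h : ℕ
    h = length BL !

    instance
      h≢0 : NonZero h
      h≢0 = ℕP._!≢0 (length BL)

    Coords : ℤ → Vec ℤ r → Set
    Coords b c = ∃ λ z → Path b h z z c

    abstract
      coord : ∀ {b} → B b → ∃ (Coords b)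
      coord {b} bb = let k , (1≤k , k≤) , z , θ , p = Walk.loop bb in
        unroll p (ℕD.∣-trans (n∣n! k 1≤k) (ℕD.m≤n⇒m!∣n! k≤))
        where
        unroll : ∀ {k z θ} → Path b k z z θ → k ∣ h → ∃ (Coords b)
        unroll {z = z} {θ} p (divides m eq) = pos m ⊙ θ , z , subst (λ n → Path b n z z (pos m ⊙ θ)) (sym eq) (path-loop m p)

    coord-bnd : ∀ {b c} → Coords b c → Bnd (C * h) c
    coord-bnd {c = c} (_ , p) = subst (λ k → Bnd k c) (ℕP.*-comm h C) (path-bnd p)

    coord-eq : ∀ {b c} → Coords b c → dot e c ≡ pos h ℤ.* b
    coord-eq {b} {c} (z , p) = sym (ℤ-cancelʳ z (trans (path-eq p) (ℤP.+-comm z (dot e c))))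

    displacement : Vec ℤ r → Vec ℤ r → Vec ℤ r → ℕ → Vec ℤ r → Vec ℤ r
    displacement θ θ' θ'' n t = (θ ⊕ θ') ⊕ (⊖ θ'' ⊕ ⊖ (pos n ⊙ t))

    -- After `n` parallel steps the multiples of `b`, `b'`, `b''` and `t` cancel by `eq`. Only the
    -- six endpoints remain, and they stay in `B` however large `n` is.
    displacement-sum : ∀ {b b' b'' t n z z' z'' w w' w'' θ θ' θ''} → b ℤ.+ b' ≡ b'' ℤ.+ dot e t →
      Path b n z w θ → Path b' n z' w' θ' → Path b'' n z'' w'' θ'' → Sums B 6 (dot e (displacement θ θ' θ'' n t))
    displacement-sum {b} {b'} {b''} {t} {n} {z} {z'} {z''} {w} {w'} {w''} {θ} {θ'} {θ''} eq p p' p'' =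
      subst (Sums B 6) (sym total) (more (path-start p) (more (B-neg (path-end p)) (more (path-start p') (more (B-neg (path-end p'))
        (more (B-neg (path-start p'')) (more (path-end p'') nil))))))
      where
      open ≡-Reasoning
      solved : ∀ {b z w θ} → Path b n z w θ → dot e θ ≡ pos n ℤ.* b ℤ.+ (z ℤ.- w)
      solved {b} {z} {w} {θ} p = trans (l w (dot e θ)) (trans (cong (ℤ._- w) (sym (path-eq p))) (ℤP.+-assoc (pos n ℤ.* b) z (ℤ.- w)))
        where
        l : ∀ w x → x ≡ w ℤ.+ x ℤ.- w
        l = ring-ℤ
      l₁ : ∀ n b b' b'' y d d' d'' → n ℤ.* b ℤ.+ d ℤ.+ (n ℤ.* b' ℤ.+ d') ℤ.+ (ℤ.- (n ℤ.* b'' ℤ.+ d'') ℤ.+ (ℤ.- (n ℤ.* y)))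
        ≡ n ℤ.* (b ℤ.+ b') ℤ.- n ℤ.* (b'' ℤ.+ y) ℤ.+ (d ℤ.+ d' ℤ.- d'')
      l₁ = ring-ℤ
      l₂ : ∀ m d d' d'' → m ℤ.- m ℤ.+ (d ℤ.+ d' ℤ.- d'') ≡ d ℤ.+ d' ℤ.- d''
      l₂ = ring-ℤ
      l₃ : ∀ z w z' w' z'' w'' → z ℤ.- w ℤ.+ (z' ℤ.- w') ℤ.- (z'' ℤ.- w'')
        ≡ z ℤ.+ (ℤ.- w ℤ.+ (z' ℤ.+ (ℤ.- w' ℤ.+ (ℤ.- z'' ℤ.+ (w'' ℤ.+ ℤ.0ℤ)))))
      l₃ = ring-ℤ
      total : dot e (displacement θ θ' θ'' n t) ≡ z ℤ.+ (ℤ.- w ℤ.+ (z' ℤ.+ (ℤ.- w' ℤ.+ (ℤ.- z'' ℤ.+ (w'' ℤ.+ ℤ.0ℤ)))))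
      total = begin
        dot e (displacement θ θ' θ'' n t)
          ≡⟨ trans (dot-⊕ e _ _) (cong₂ ℤ._+_ (dot-⊕ e θ θ') (trans (dot-⊕ e _ _) (cong₂ ℤ._+_ (dot-⊖ e θ'') (trans (dot-⊖ e _) (cong ℤ.-_ (dot-⊙ e (pos n) t)))))) ⟩
        dot e θ ℤ.+ dot e θ' ℤ.+ (ℤ.- dot e θ'' ℤ.+ (ℤ.- (pos n ℤ.* dot e t)))
          ≡⟨ cong₂ ℤ._+_ (cong₂ ℤ._+_ (solved p) (solved p')) (cong (λ u → ℤ.- u ℤ.+ (ℤ.- (pos n ℤ.* dot e t))) (solved p'')) ⟩
        pos n ℤ.* b ℤ.+ (z ℤ.- w) ℤ.+ (pos n ℤ.* b' ℤ.+ (z' ℤ.- w')) ℤ.+ (ℤ.- (pos n ℤ.* b'' ℤ.+ (z'' ℤ.- w'')) ℤ.+ (ℤ.- (pos n ℤ.* dot e t)))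
          ≡⟨ l₁ (pos n) b b' b'' (dot e t) (z ℤ.- w) (z' ℤ.- w') (z'' ℤ.- w'') ⟩
        pos n ℤ.* (b ℤ.+ b') ℤ.- pos n ℤ.* (b'' ℤ.+ dot e t) ℤ.+ (z ℤ.- w ℤ.+ (z' ℤ.- w') ℤ.- (z'' ℤ.- w''))
          ≡⟨ cong (λ u → pos n ℤ.* u ℤ.- pos n ℤ.* (b'' ℤ.+ dot e t) ℤ.+ (z ℤ.- w ℤ.+ (z' ℤ.- w') ℤ.- (z'' ℤ.- w''))) eq ⟩
        pos n ℤ.* (b'' ℤ.+ dot e t) ℤ.- pos n ℤ.* (b'' ℤ.+ dot e t) ℤ.+ (z ℤ.- w ℤ.+ (z' ℤ.- w') ℤ.- (z'' ℤ.- w''))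
          ≡⟨ l₂ (pos n ℤ.* (b'' ℤ.+ dot e t)) (z ℤ.- w) (z' ℤ.- w') (z'' ℤ.- w'') ⟩
        z ℤ.- w ℤ.+ (z' ℤ.- w') ℤ.- (z'' ℤ.- w'')
          ≡⟨ l₃ z w z' w' z'' w'' ⟩
        z ℤ.+ (ℤ.- w ℤ.+ (z' ℤ.+ (ℤ.- w' ℤ.+ (ℤ.- z'' ℤ.+ (w'' ℤ.+ ℤ.0ℤ))))) ∎

    -- A discrete continuity argument: one step changes the defect by at most `3C + C'`, which keeps
    -- it below `Q₁`, and there `proper` pushes it back below `7C`.
    displacement-bnd : ∀ {b b' b'' t} → b ℤ.+ b' ≡ b'' ℤ.+ dot e t → Bnd C' t →
      ∀ n {z z' z'' w w' w'' θ θ' θ''} → Path b n z w θ → Path b' n z' w' θ' → Path b'' n z'' w'' θ'' →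
      Bnd (7 * C) (displacement θ θ' θ'' n t)
    displacement-bnd {t = t} eq bt zero (stay _) (stay _) (stay _) =
      bnd-mono z≤n (bnd-⊕ (bnd-⊕ (bnd-0 0) (bnd-0 0)) (bnd-⊕ (bnd-⊖ (bnd-0 0)) (bnd-⊖ (bnd-⊙ {p = 0} (pos 0) z≤n bt))))
    displacement-bnd {t = t} eq bt (suc n) q@(advance {θ = θ} {δ} p _ bδ _) q'@(advance {θ = θ'} {δ'} p' _ bδ' _) q''@(advance {θ = θ''} {δ''} p'' _ bδ'' _) =
      proper (subst (Bnd Q₁) (sym (lem θ δ θ' δ' θ'' δ'' t))
        (bnd-⊕ (displacement-bnd eq bt n p p' p'') (bnd-⊕ (bnd-⊕ (bnd-⊕ bδ bδ') (bnd-⊖ bδ'')) (bnd-⊖ bt))))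
        (displacement-sum eq q q' q'')
      where
      lem : ∀ {m} (θ δ θ' δ' θ'' δ'' t : Vec ℤ m) →
        ((θ ⊕ δ) ⊕ (θ' ⊕ δ')) ⊕ (⊖ (θ'' ⊕ δ'') ⊕ ⊖ (pos (suc n) ⊙ t))
          ≡ ((θ ⊕ θ') ⊕ (⊖ θ'' ⊕ ⊖ (pos n ⊙ t))) ⊕ (((δ ⊕ δ') ⊕ ⊖ δ'') ⊕ ⊖ t)
      lem Vec.[] Vec.[] Vec.[] Vec.[] Vec.[] Vec.[] Vec.[] = refl
      lem (a Vec.∷ θ) (b Vec.∷ δ) (a' Vec.∷ θ') (b' Vec.∷ δ') (a'' Vec.∷ θ'') (b'' Vec.∷ δ'') (t Vec.∷ ts) = cong₂ Vec._∷_
        (trans (cong (λ u → a ℤ.+ b ℤ.+ (a' ℤ.+ b') ℤ.+ (ℤ.- (a'' ℤ.+ b'') ℤ.+ (ℤ.- u))) (ℤP.suc-* (pos n) t)) (l a b a' b' a'' b'' t (pos n ℤ.* t)))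
        (lem θ δ θ' δ' θ'' δ'' ts)
        where
        l : ∀ a b a' b' a'' b'' t nt → a ℤ.+ b ℤ.+ (a' ℤ.+ b') ℤ.+ (ℤ.- (a'' ℤ.+ b'') ℤ.+ (ℤ.- (t ℤ.+ nt)))
          ≡ a ℤ.+ a' ℤ.+ (ℤ.- a'' ℤ.+ (ℤ.- nt)) ℤ.+ (b ℤ.+ b' ℤ.+ (ℤ.- b'') ℤ.+ (ℤ.- t))
        l = ring-ℤ

    -- Run around the loops often enough: a nonzero defect would exceed every bound.
    coord-additive : ∀ {b b' b'' c c' c'' t} → Coords b c → Coords b' c' → Coords b'' c'' →
      b ℤ.+ b' ≡ b'' ℤ.+ dot e t → Bnd C' t → c ⊕ c' ≡ c'' ⊕ pos h ⊙ t
    coord-additive {c = c} {c'} {c''} {t} (_ , p) (_ , p') (_ , p'') eq bt =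
      diff≡0 _ _ (trans (lem₂ c c' c'' t) (bnd-zero (7 * C) _ (subst (Bnd (7 * C)) (lem c c' c'' t)
        (displacement-bnd eq bt (M * h) (path-loop M p) (path-loop M p') (path-loop M p'')))))
      where
      M = suc (7 * C)
      lem : ∀ {m} (c c' c'' t : Vec ℤ m) → (pos M ⊙ c ⊕ pos M ⊙ c') ⊕ (⊖ (pos M ⊙ c'') ⊕ ⊖ (pos (M * h) ⊙ t))
        ≡ pos M ⊙ ((c ⊕ c') ⊕ (⊖ c'' ⊕ ⊖ (pos h ⊙ t)))
      lem Vec.[] Vec.[] Vec.[] Vec.[] = refl
      lem (a Vec.∷ c) (a' Vec.∷ c') (a'' Vec.∷ c'') (t Vec.∷ ts) = cong₂ Vec._∷_
        (trans (cong (λ u → pos M ℤ.* a ℤ.+ pos M ℤ.* a' ℤ.+ (ℤ.- (pos M ℤ.* a'') ℤ.+ (ℤ.- (u ℤ.* t)))) (ℤP.pos-* M h))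
          (l (pos M) (pos h) a a' a'' t))
        (lem c c' c'' ts)
        where
        l : ∀ M h a a' a'' t → M ℤ.* a ℤ.+ M ℤ.* a' ℤ.+ (ℤ.- (M ℤ.* a'') ℤ.+ (ℤ.- (M ℤ.* h ℤ.* t))) ≡ M ℤ.* (a ℤ.+ a' ℤ.+ (ℤ.- a'' ℤ.+ (ℤ.- (h ℤ.* t))))
        l = ring-ℤ
      lem₂ : ∀ {m} (c c' c'' t : Vec ℤ m) → (c ⊕ c') ⊕ ⊖ (c'' ⊕ pos h ⊙ t) ≡ (c ⊕ c') ⊕ (⊖ c'' ⊕ ⊖ (pos h ⊙ t))
      lem₂ Vec.[] Vec.[] Vec.[] Vec.[] = refl
      lem₂ (a Vec.∷ c) (a' Vec.∷ c') (a'' Vec.∷ c'') (t Vec.∷ ts) =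
        cong₂ Vec._∷_ (cong (λ u → a ℤ.+ a' ℤ.+ u) (ℤP.neg-distrib-+ a'' (pos h ℤ.* t))) (lem₂ c c' c'' ts)

    -- Numerators, over the denominator `h`, of the coordinates of all `b + dot e t`. The
    -- translations by `t` absorb the carries and make the set closed under subtraction.
    Λ : Vec ℤ r → Set
    Λ u = ∃ λ b → ∃₂ λ c t → B b × Coords b c × u ≡ c ⊕ pos h ⊙ t

    C≤C' : C ≤ C'
    C≤C' = ℕP.m≤n+m C (κ₀ * C)

    Λ-minus : ∀ {u v} → Λ u → Λ v → Λ (u ⊕ ⊖ v)
    Λ-minus (b , c , t , bb , cb , refl) (b' , c' , t' , bb' , cb' , refl) with B-add bb (B-neg bb')
    ... | w , δ , bw , bδ , eq with coord bw
    ...   | c'' , cw = w , c'' , δ ⊕ (t ⊕ ⊖ t') , bw , cw , lem c c' c'' t t' δ (coord-additive cw cb' cb eq' (bnd-mono C≤C' (bnd-⊖ bδ)))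
      where
      eq' : w ℤ.+ b' ≡ b ℤ.+ dot e (⊖ δ)
      eq' = trans (l₁ w b' (dot e δ)) (trans (cong (λ u → u ℤ.+ b' ℤ.- dot e δ) (sym eq))
              (trans (l₂ b b' (dot e δ)) (cong (λ u → b ℤ.+ u) (sym (dot-⊖ e δ)))))
        where
        l₁ : ∀ w b x → w ℤ.+ b ≡ w ℤ.+ x ℤ.+ b ℤ.- x
        l₁ = ring-ℤ
        l₂ : ∀ b b' x → b ℤ.+ (ℤ.- b') ℤ.+ b' ℤ.- x ≡ b ℤ.+ (ℤ.- x)
        l₂ = ring-ℤ
      lem : ∀ {m} (c c' c'' t t' δ : Vec ℤ m) → c'' ⊕ c' ≡ c ⊕ pos h ⊙ (⊖ δ) →
        (c ⊕ pos h ⊙ t) ⊕ ⊖ (c' ⊕ pos h ⊙ t') ≡ c'' ⊕ pos h ⊙ (δ ⊕ (t ⊕ ⊖ t'))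
      lem Vec.[] Vec.[] Vec.[] Vec.[] Vec.[] Vec.[] _ = refl
      lem (a Vec.∷ c) (a' Vec.∷ c') (a'' Vec.∷ c'') (t Vec.∷ ts) (t' Vec.∷ ts') (d Vec.∷ δ) eq = cong₂ Vec._∷_
        (trans (l₁ a a' t t' d (pos h)) (trans (cong (λ u → u ℤ.- a' ℤ.+ pos h ℤ.* (d ℤ.+ (t ℤ.+ (ℤ.- t')))) (sym (VecP.∷-injectiveˡ eq)))
          (l₂ a'' a' (pos h ℤ.* (d ℤ.+ (t ℤ.+ (ℤ.- t')))))))
        (lem c c' c'' ts ts' δ (VecP.∷-injectiveʳ eq))
        where
        l₁ : ∀ a a' t t' d h → a ℤ.+ h ℤ.* t ℤ.+ (ℤ.- (a' ℤ.+ h ℤ.* t')) ≡ a ℤ.+ h ℤ.* (ℤ.- d) ℤ.- a' ℤ.+ h ℤ.* (d ℤ.+ (t ℤ.+ (ℤ.- t')))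
        l₁ = ring-ℤ
        l₂ : ∀ a'' a' x → a'' ℤ.+ a' ℤ.- a' ℤ.+ x ≡ a'' ℤ.+ x
        l₂ = ring-ℤ

    Λ-value : ∀ {b c t} → Coords b c → dot e (c ⊕ pos h ⊙ t) ≡ pos h ℤ.* (b ℤ.+ dot e t)
    Λ-value {b} {c} {t} cb = trans (dot-⊕ e c _) (trans (cong₂ ℤ._+_ (coord-eq cb) (dot-⊙ e (pos h) t)) (sym (ℤP.*-distribˡ-+ (pos h) b (dot e t))))

    Λ-shift : ∀ {b c t} → Coords b c → Bnd (κ₀ * C * h) (c ⊕ pos h ⊙ t) → Bnd C' t
    Λ-shift {c = c} {t} cb bu = bnd-cancel h C' t (subst₂ Bnd (lem (κ₀ * C) C h) (lem' c t)
      (bnd-⊕ bu (bnd-⊖ (coord-bnd cb))))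
      where
      lem : ∀ a c h → a * h + c * h ≡ h * (a + c)
      lem = ring-ℕ
      lem' : ∀ {m} (c t : Vec ℤ m) → (c ⊕ pos h ⊙ t) ⊕ ⊖ c ≡ pos h ⊙ t
      lem' Vec.[] Vec.[] = refl
      lem' (a Vec.∷ c) (t Vec.∷ ts) = cong₂ Vec._∷_ (l a (pos h ℤ.* t)) (lem' c ts)
        where
        l : ∀ a x → a ℤ.+ x ℤ.+ (ℤ.- a) ≡ x
        l = ring-ℤ

    ∈-toList : ∀ {n} {P : ℤ → Set} {Y : Vec ℤ n} → VAll.All P Y → ∀ {x} → x ∈ Vec.toList Y → P x
    ∈-toList (p VAll.∷ ps) (here refl) = p
    ∈-toList (p VAll.∷ ps) (there x∈)  = ∈-toList ps x∈

    e-sums : VAll.All (Sums (_∈ S) T) e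
    e-sums = VAll.map (λ { (x , x∈ , refl) → sums-⊙ T (∈-toList X⊆S x∈) }) e-orig

    value-sums : ∀ {b t} → B b → Bnd C' t → Sums (_∈ S) (K.L q) (b ℤ.+ dot e t)
    value-sums (s , b , s∈ , bb , refl) bt = sums-+ (more s∈ (sums-dot 0∈S S-neg X⊆S bb))
      (sums-≤ 0∈S (ℕP.*-monoˡ-≤ T (ℕP.*-monoˡ-≤ C' r≤ξ))
        (sums-join (sums-dot (sums-≤ 0∈S z≤n nil) (sums-neg S-neg) e-sums bt)))

    model : ∀ {L} → K.L q ≤ L → LatticeModel S ξ κ₀ L
    model L≤ = record
      { r = r ; C = C ; h = h ; r≤ = r≤ξ ; h≢0 = h≢0 ; e = e ; Λ = Λ ; Λ-minus = Λ-minus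
      ; Λ-elem  = λ { (b , c , t , bb , cb , refl) bu →
          b ℤ.+ dot e t , sums-≤ 0∈S L≤ (value-sums bb (Λ-shift cb bu)) , Λ-value cb }
      ; Λ-inj   = λ { (b , c , t , bb , cb , refl) bu eq → injective bb cb (Λ-shift cb bu) eq }
      ; Λ-coord = λ {s} s∈ → let c , cs = coord (S⊆B s∈) in
          c , (s , c , 0V , S⊆B s∈ , cs , sym (trans (cong (c ⊕_) (⊙-0V (pos h))) (⊕-identityʳ c))) , coord-bnd cs , coord-eq cs
      }
      where
      injective : ∀ {b c t} → B b → Coords b c → Bnd C' t → dot e (c ⊕ pos h ⊙ t) ≡ ℤ.0ℤ → c ⊕ pos h ⊙ t ≡ 0V
      injective {b} {c} {t} bb cb bt eq with coord B-0
      -- The value zero means `b = - dot e t`. Additivity is applied to `b + 0 = 0 + dot e (⊖ t)`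
      -- with the same coordinates `c₀` of zero on both sides; they cancel, whatever they are.
      ... | c₀ , cb₀ = lem c c₀ t (coord-additive cb cb₀ cb₀ eq' (bnd-⊖ bt))
        where
        zero' : b ℤ.+ dot e t ≡ ℤ.0ℤ
        zero' = ℤP.*-cancelˡ-≡ (pos h) _ ℤ.0ℤ (trans (sym (Λ-value cb)) (trans eq (sym (ℤP.*-zeroʳ (pos h)))))
        eq' : b ℤ.+ ℤ.0ℤ ≡ ℤ.0ℤ ℤ.+ dot e (⊖ t)
        eq' = trans (l b (dot e t)) (trans (cong (ℤ._- dot e t) zero') (cong (λ u → ℤ.0ℤ ℤ.+ u) (sym (dot-⊖ e t))))
          where
          l : ∀ b x → b ℤ.+ ℤ.0ℤ ≡ b ℤ.+ x ℤ.- x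
          l = ring-ℤ
        lem : ∀ {m} (c c₀ t : Vec ℤ m) → c ⊕ c₀ ≡ c₀ ⊕ pos h ⊙ (⊖ t) → c ⊕ pos h ⊙ t ≡ 0V
        lem Vec.[] Vec.[] Vec.[] _ = refl
        lem (a Vec.∷ c) (a₀ Vec.∷ c₀) (t Vec.∷ ts) eq = cong₂ Vec._∷_
          (trans (l₁ a a₀ t (pos h)) (trans (cong (λ u → u ℤ.- a₀ ℤ.+ pos h ℤ.* t) (VecP.∷-injectiveˡ eq)) (l₂ a₀ t (pos h))))
          (lem c c₀ ts (VecP.∷-injectiveʳ eq))
          where
          l₁ : ∀ a a₀ t h → a ℤ.+ h ℤ.* t ≡ a ℤ.+ a₀ ℤ.- a₀ ℤ.+ h ℤ.* t
          l₁ = ring-ℤ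
          l₂ : ∀ a₀ t h → a₀ ℤ.+ h ℤ.* (ℤ.- t) ℤ.- a₀ ℤ.+ h ℤ.* t ≡ ℤ.0ℤ
          l₂ = ring-ℤ

  latticeModel : LatticeModel S ξ κ₀ K.Lmax
  latticeModel = modelOf (frame X)
    where
    modelOf : Frame X → LatticeModel S ξ κ₀ K.Lmax
    modelOf (r , r≤ , e , n , n≤ , indep , rels , orig) =
      WithFrame.model (iterate K.F n) r≤ e indep rels orig (member≤∑ (K.L ∘ iterate K.F) (∈-upTo⁺ (s≤s n≤)))

-- Short vectors

‖_‖ : ∀ {n} → Vec ℤ n → ℕ
‖ Vec.[] ‖    = 0
‖ a Vec.∷ v ‖ = ∣ a ∣ ℕ.⊔ ‖ v ‖

bnd-norm : ∀ {n} (v : Vec ℤ n) → Bnd ‖ v ‖ v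
bnd-norm Vec.[]       = VAll.[]
bnd-norm (a Vec.∷ v) = ℕP.m≤m⊔n _ _ VAll.∷ bnd-mono (ℕP.m≤n⊔m ∣ a ∣ _) (bnd-norm v)

norm-≤ : ∀ {n q} {v : Vec ℤ n} → Bnd q v → ‖ v ‖ ≤ q
norm-≤ {v = Vec.[]}    VAll.[]        = z≤n
norm-≤ {v = a Vec.∷ v} (h VAll.∷ hs) = ℕP.⊔-lub h (norm-≤ hs)

norm≡0 : ∀ {n} (v : Vec ℤ n) → ‖ v ‖ ≤ 0 → v ≡ 0V
norm≡0 Vec.[]       _ = refl
norm≡0 (a Vec.∷ v) h = cong₂ Vec._∷_ (ℤP.∣i∣≡0⇒i≡0 (ℕP.n≤0⇒n≡0 (ℕP.≤-trans (ℕP.m≤m⊔n _ _) h)))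
  (norm≡0 v (ℕP.≤-trans (ℕP.m≤n⊔m ∣ a ∣ _) h))

norm-attained : ∀ {n} (v : Vec ℤ (suc n)) → ∃ λ i → ∣ Vec.lookup v i ∣ ≡ ‖ v ‖
norm-attained (a Vec.∷ Vec.[]) = Fin.zero , sym (ℕP.⊔-identityʳ ∣ a ∣)
norm-attained (a Vec.∷ v@(_ Vec.∷ _)) with ℕP.⊔-sel ∣ a ∣ ‖ v ‖ | norm-attained v
... | inj₁ eq | _      = Fin.zero , sym eq
... | inj₂ eq | i , eq' = Fin.suc i , trans eq' (sym eq)

del : ∀ {n} {A : Set} → Fin (suc n) → Vec A (suc n) → Vec A n
del Fin.zero               (x Vec.∷ xs) = xs
del {suc n} (Fin.suc i) (x Vec.∷ xs) = x Vec.∷ del i xs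

del-All : ∀ {n} {P : ℤ → Set} (i : Fin (suc n)) {v} → VAll.All P v → VAll.All P (del i v)
del-All Fin.zero            (p VAll.∷ ps) = ps
del-All {suc n} (Fin.suc i) (p VAll.∷ ps) = p VAll.∷ del-All i ps

undel-All : ∀ {n} {P : ℤ → Set} (i : Fin (suc n)) {v} → P (Vec.lookup v i) → VAll.All P (del i v) → VAll.All P v
undel-All Fin.zero            {x Vec.∷ v} p ps               = p VAll.∷ ps
undel-All {suc n} (Fin.suc i) {x Vec.∷ v} p (q VAll.∷ qs) = q VAll.∷ undel-All i p qs

del-injective : ∀ {n} (i : Fin (suc n)) {u v : Vec ℤ (suc n)} → Vec.lookup u i ≡ Vec.lookup v i → del i u ≡ del i v → u ≡ v
del-injective Fin.zero            {x Vec.∷ u} {y Vec.∷ v} p q = cong₂ Vec._∷_ p q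
del-injective {suc n} (Fin.suc i) {x Vec.∷ u} {y Vec.∷ v} p q =
  cong₂ Vec._∷_ (VecP.∷-injectiveˡ q) (del-injective i p (VecP.∷-injectiveʳ q))

del-⊕ : ∀ {n} (i : Fin (suc n)) u v → del i (u ⊕ v) ≡ del i u ⊕ del i v
del-⊕ Fin.zero            (x Vec.∷ u) (y Vec.∷ v) = refl
del-⊕ {suc n} (Fin.suc i) (x Vec.∷ u) (y Vec.∷ v) = cong (_ Vec.∷_) (del-⊕ i u v)

del-⊙ : ∀ {n} (i : Fin (suc n)) k u → del i (k ⊙ u) ≡ k ⊙ del i u
del-⊙ Fin.zero            k (x Vec.∷ u) = refl
del-⊙ {suc n} (Fin.suc i) k (x Vec.∷ u) = cong (_ Vec.∷_) (del-⊙ i k u)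

rounding : ∀ a p → p ≢ ℤ.0ℤ → ∃ λ m → 2 * ∣ a ℤ.- m ℤ.* p ∣ ≤ ∣ p ∣
rounding a p p≢0 = signed p refl
  where
  K = ∣ p ∣
  instance
    K≢0 : NonZero K
    K≢0 = ℕ.≢-nonZero (p≢0 ∘ ℤP.∣i∣≡0⇒i≡0)
  r = a ℤDM.%ℕ K
  m₀ = a ℤDM./ℕ K
  a≡ : a ≡ pos r ℤ.+ m₀ ℤ.* pos K
  a≡ = ℤDM.a≡a%ℕn+[a/ℕn]*n a K
  nearest : ∃ λ m → 2 * ∣ a ℤ.- m ℤ.* pos K ∣ ≤ K
  nearest with 2 * r ≤? K
  ... | yes h = m₀ , subst (λ w → 2 * ∣ w ∣ ≤ K) (sym (trans (cong (ℤ._- m₀ ℤ.* pos K) a≡) (lem (pos r) (m₀ ℤ.* pos K)))) h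
    where
    lem : ∀ r x → r ℤ.+ x ℤ.- x ≡ r
    lem = ring-ℤ
  ... | no ¬h = m₀ ℤ.+ pos 1 , subst (λ w → 2 * w ≤ K) (sym dist) far
    where
    r<K : r ≤ K
    r<K = ℕP.<⇒≤ (ℤDM.n%ℕd<d a K)
    lem : ∀ r m k → r ℤ.+ m ℤ.* k ℤ.- (m ℤ.+ pos 1) ℤ.* k ≡ ℤ.- (k ℤ.- r)
    lem = ring-ℤ
    dist : ∣ a ℤ.- (m₀ ℤ.+ pos 1) ℤ.* pos K ∣ ≡ K ∸ r
    dist = trans (cong ∣_∣ (trans (cong (ℤ._- (m₀ ℤ.+ pos 1) ℤ.* pos K) a≡) (lem (pos r) m₀ (pos K))))
      (trans (ℤP.∣-i∣≡∣i∣ (pos K ℤ.- pos r)) (trans (cong ∣_∣ (ℤP.m-n≡m⊖n K r)) (cong ∣_∣ (ℤP.⊖-≥ r<K))))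
    far : 2 * (K ∸ r) ≤ K
    far = ℕP.+-cancelʳ-≤ (2 * r) _ _ (begin
      2 * (K ∸ r) + 2 * r  ≡⟨ ℕP.*-distribˡ-+ 2 (K ∸ r) r ⟨
      2 * (K ∸ r + r)  ≡⟨ cong (2 *_) (ℕP.m∸n+n≡m r<K) ⟩
      2 * K  ≡⟨ cong (K +_) (ℕP.+-identityʳ K) ⟩
      K + K  ≤⟨ ℕP.+-monoʳ-≤ K (ℕP.<⇒≤ (ℕP.≰⇒> ¬h)) ⟩
      K + 2 * r  ∎)
      where open ℕP.≤-Reasoning
  signed : ∀ p' → p ≡ p' → ∃ λ m → 2 * ∣ a ℤ.- m ℤ.* p ∣ ≤ ∣ p ∣
  signed (pos n) refl = nearest
  signed -[1+ n ] refl = let m , h = nearest in ℤ.- m , subst (λ w → 2 * ∣ a ℤ.- w ∣ ≤ K) (lem m (pos (suc n))) h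
    where
    lem : ∀ m k → m ℤ.* k ≡ (ℤ.- m) ℤ.* (ℤ.- k)
    lem = ring-ℤ

module Subgroup {n} (Λ : Vec ℤ n → Set) (Λ-minus : ∀ {u v} → Λ u → Λ v → Λ (u ⊕ ⊖ v)) where

  Λ-0 : ∀ {u} → Λ u → Λ 0V
  Λ-0 {u} l = subst Λ (⊕-inverseʳ u) (Λ-minus l l)

  Λ-neg : ∀ {u} → Λ u → Λ (⊖ u)
  Λ-neg {u} l = subst Λ (⊕-identityˡ (⊖ u)) (Λ-minus (Λ-0 l) l)

  Λ-plus : ∀ {u v} → Λ u → Λ v → Λ (u ⊕ v)
  Λ-plus {u} {v} l l' = subst Λ (cong (u ⊕_) (lem v)) (Λ-minus l (Λ-neg l'))
    where
    lem : ∀ {n} (v : Vec ℤ n) → ⊖ (⊖ v) ≡ v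
    lem Vec.[]       = refl
    lem (a Vec.∷ v) = cong₂ Vec._∷_ (ℤP.neg-involutive a) (lem v)

  Λ-timesℕ : ∀ {u} k → Λ u → Λ (pos k ⊙ u)
  Λ-timesℕ {u} zero    l = subst Λ (sym (⊙-zero u)) (Λ-0 l)
  Λ-timesℕ {u} (suc k) l = subst Λ (sym (⊙-suc k u)) (Λ-plus l (Λ-timesℕ k l))

  Λ-times : ∀ {u} k → Λ u → Λ (k ⊙ u)
  Λ-times {u} (pos k)  l = Λ-timesℕ k l
  Λ-times {u} -[1+ k ] l = subst Λ (lem u) (Λ-neg (Λ-timesℕ (suc k) l))
    where
    lem : ∀ {n} (u : Vec ℤ n) → ⊖ (pos (suc k) ⊙ u) ≡ -[1+ k ] ⊙ u
    lem Vec.[]       = refl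
    lem (a Vec.∷ u) = cong₂ Vec._∷_ (ℤP.neg-distribˡ-* (pos (suc k)) a) (lem u)

comb : ∀ {n k} → Vec (Vec ℤ n) k → Vec ℤ k → Vec ℤ n
comb Vec.[]       Vec.[]       = 0V
comb (w Vec.∷ ws) (x Vec.∷ xs) = x ⊙ w ⊕ comb ws xs

Independent : ∀ {n k} → Vec (Vec ℤ n) k → Set
Independent ws = ∀ x → comb ws x ≡ 0V → x ≡ 0V

comb-0 : ∀ {n k} (ws : Vec (Vec ℤ n) k) → comb ws 0V ≡ 0V
comb-0 Vec.[]       = refl
comb-0 (w Vec.∷ ws) = trans (cong₂ _⊕_ (⊙-zero w) (comb-0 ws)) (⊕-identityʳ 0V)

⊙-one : ∀ {n} (u : Vec ℤ n) → pos 1 ⊙ u ≡ u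
⊙-one Vec.[]       = refl
⊙-one (a Vec.∷ u) = cong₂ Vec._∷_ (ℤP.*-identityˡ a) (⊙-one u)

independent-nonzero : ∀ {n k} (ws : Vec (Vec ℤ n) k) → Independent ws → VAll.All (_≢ 0V) ws
independent-nonzero Vec.[]       ind = VAll.[]
independent-nonzero (w Vec.∷ ws) ind =
  (λ w≡0 → case VecP.∷-injectiveˡ (ind (pos 1 Vec.∷ 0V) (trans (cong₂ _⊕_ (trans (⊙-one w) w≡0) (comb-0 ws)) (⊕-identityʳ 0V))) of λ ())
  VAll.∷ independent-nonzero ws (λ x eq → VecP.∷-injectiveʳ (ind (ℤ.0ℤ Vec.∷ x) (trans (cong₂ _⊕_ (⊙-zero w) eq) (⊕-identityʳ 0V))))

data Fits {n} (Q : ℕ) : ∀ {k} → Vec (Vec ℤ n) k → Vec ℕ k → Set where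
  []  : Fits Q Vec.[] Vec.[]
  _∷_ : ∀ {k w N} {ws : Vec (Vec ℤ n) k} {Ns} → N * ‖ w ‖ ≤ Q → Fits Q ws Ns → Fits Q (w Vec.∷ ws) (N Vec.∷ Ns)

prodV : ∀ {k} → Vec ℕ k → ℕ
prodV Vec.[]       = 1
prodV (N Vec.∷ Ns) = N * prodV Ns

module Projection {n} (w : Vec ℤ (suc n)) (i : Fin (suc n)) where

  p : ℤ
  p = Vec.lookup w i

  -- Projection along `w` to the hyperplane where coordinate `i` vanishes, multiplied by `p` to stay
  -- integral.
  Π : Vec ℤ (suc n) → Vec ℤ (suc n)
  Π x = p ⊙ x ⊕ ⊖ (Vec.lookup x i ⊙ w)

  π : Vec ℤ (suc n) → Vec ℤ n
  π x = del i (Π x)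

  lookup-⊕ : ∀ (u v : Vec ℤ (suc n)) → Vec.lookup (u ⊕ v) i ≡ Vec.lookup u i ℤ.+ Vec.lookup v i
  lookup-⊕ u v = VecP.lookup-zipWith ℤ._+_ i u v

  lookup-⊙ : ∀ k (u : Vec ℤ (suc n)) → Vec.lookup (k ⊙ u) i ≡ k ℤ.* Vec.lookup u i
  lookup-⊙ k u = VecP.lookup-map i (k ℤ.*_) u

  lookup-⊖ : ∀ (u : Vec ℤ (suc n)) → Vec.lookup (⊖ u) i ≡ ℤ.- Vec.lookup u i
  lookup-⊖ u = VecP.lookup-map i ℤ.-_ u

  Π-i : ∀ x → Vec.lookup (Π x) i ≡ ℤ.0ℤ
  Π-i x = trans (lookup-⊕ (p ⊙ x) _) (trans (cong₂ ℤ._+_ (lookup-⊙ p x) (trans (lookup-⊖ (Vec.lookup x i ⊙ w)) (cong ℤ.-_ (lookup-⊙ (Vec.lookup x i) w))))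
    (lem p (Vec.lookup x i)))
    where
    lem : ∀ p x → p ℤ.* x ℤ.+ (ℤ.- (x ℤ.* p)) ≡ ℤ.0ℤ
    lem = ring-ℤ

  Π-linear : ∀ k u v → Π (k ⊙ u ⊕ v) ≡ k ⊙ Π u ⊕ Π v
  Π-linear k u v = trans (cong (λ c → p ⊙ (k ⊙ u ⊕ v) ⊕ ⊖ (c ⊙ w)) (trans (lookup-⊕ (k ⊙ u) v) (cong (ℤ._+ Vec.lookup v i) (lookup-⊙ k u))))
    (lem u v w (Vec.lookup u i) (Vec.lookup v i))
    where
    lem : ∀ {m} (u v w : Vec ℤ m) a b → p ⊙ (k ⊙ u ⊕ v) ⊕ ⊖ ((k ℤ.* a ℤ.+ b) ⊙ w) ≡ k ⊙ (p ⊙ u ⊕ ⊖ (a ⊙ w)) ⊕ (p ⊙ v ⊕ ⊖ (b ⊙ w))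
    lem Vec.[] Vec.[] Vec.[] a b = refl
    lem (x Vec.∷ u) (y Vec.∷ v) (z Vec.∷ w) a b = cong₂ Vec._∷_ (l p k x y z a b) (lem u v w a b)
      where
      l : ∀ p k x y z a b → p ℤ.* (k ℤ.* x ℤ.+ y) ℤ.+ (ℤ.- ((k ℤ.* a ℤ.+ b) ℤ.* z)) ≡ k ℤ.* (p ℤ.* x ℤ.+ (ℤ.- (a ℤ.* z))) ℤ.+ (p ℤ.* y ℤ.+ (ℤ.- (b ℤ.* z)))
      l = ring-ℤ

  π-linear : ∀ k u v → π (k ⊙ u ⊕ v) ≡ k ⊙ π u ⊕ π v
  π-linear k u v = trans (cong (del i) (Π-linear k u v)) (trans (del-⊕ i _ _) (cong (_⊕ π v) (del-⊙ i k (Π u))))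

  π-w : π w ≡ 0V
  π-w = trans (cong (del i) (⊕-inverseʳ (p ⊙ w))) (del-0 i)
    where
    del-0 : ∀ {m} (i : Fin (suc m)) → del i (0V {suc m}) ≡ 0V
    del-0 Fin.zero            = refl
    del-0 {suc m} (Fin.suc i) = cong (ℤ.0ℤ Vec.∷_) (del-0 i)

  π-0 : π 0V ≡ 0V
  π-0 = trans (cong π (sym (⊙-zero 0V))) (trans (cong π (sym (⊕-identityʳ (ℤ.0ℤ ⊙ 0V))))
    (trans (π-linear ℤ.0ℤ 0V 0V) (trans (cong (_⊕ π 0V) (⊙-zero (π 0V))) (trans (⊕-identityˡ (π 0V)) (cancel (π 0V) (trans (sym (π-linear (pos 1) 0V 0V)) (cong π (trans (cong (_⊕ 0V) (⊙-one 0V)) (⊕-identityʳ 0V)))))))))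
    where
    cancel : ∀ {m} (u : Vec ℤ m) → pos 1 ⊙ u ⊕ u ≡ u → u ≡ 0V
    cancel Vec.[] _ = refl
    cancel (a Vec.∷ u) eq = cong₂ Vec._∷_ (trans (lem a) (trans (cong (ℤ._- a) (VecP.∷-injectiveˡ eq)) (ℤP.+-inverseʳ a))) (cancel u (VecP.∷-injectiveʳ eq))
      where
      lem : ∀ a → a ≡ pos 1 ℤ.* a ℤ.+ a ℤ.- a
      lem = ring-ℤ

  ⊖≡ : ∀ {m} (u : Vec ℤ m) → ⊖ u ≡ ℤ.-1ℤ ⊙ u
  ⊖≡ Vec.[]       = refl
  ⊖≡ (a Vec.∷ u) = cong₂ Vec._∷_ (sym (ℤP.-1*i≡-i a)) (⊖≡ u)

  π-minus : ∀ u v → π (u ⊕ ⊖ v) ≡ π u ⊕ ⊖ π v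
  π-minus u v = trans (cong π (trans (VecP.zipWith-comm ℤP.+-comm u (⊖ v)) (cong (_⊕ u) (⊖≡ v))))
    (trans (π-linear ℤ.-1ℤ v u) (trans (cong (_⊕ π u) (sym (⊖≡ (π v)))) (VecP.zipWith-comm ℤP.+-comm (⊖ π v) (π u))))

  π-comb : ∀ {k} (ws : Vec (Vec ℤ (suc n)) k) x → π (comb ws x) ≡ comb (Vec.map π ws) x
  π-comb Vec.[]        Vec.[]       = π-0
  π-comb (u Vec.∷ ws) (x Vec.∷ xs) = trans (π-linear x u (comb ws xs)) (cong (x ⊙ π u ⊕_) (π-comb ws xs))

  independent-extend : ∀ {k} (ws : Vec (Vec ℤ (suc n)) k) → w ≢ 0V → Independent (Vec.map π ws) → Independent (w Vec.∷ ws)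
  independent-extend ws w≢0 ind (a Vec.∷ x) eq = cong₂ Vec._∷_ a≡0 x≡0
    where
    x≡0 : x ≡ 0V
    x≡0 = ind x (trans (sym (trans (π-linear a w (comb ws x)) (trans (cong₂ _⊕_ (trans (cong (a ⊙_) π-w) (⊙-0V a)) (π-comb ws x)) (⊕-identityˡ _))))
      (trans (cong π eq) π-0))
    aw≡0 : a ⊙ w ≡ 0V
    aw≡0 = trans (sym (trans (cong (λ y → a ⊙ w ⊕ comb ws y) x≡0) (trans (cong (a ⊙ w ⊕_) (comb-0 ws)) (⊕-identityʳ _)))) eq
    a≡0 : a ≡ ℤ.0ℤ
    a≡0 with a ℤ.≟ ℤ.0ℤ
    ... | yes z = z
    ... | no ¬z = ⊥-elim (w≢0 (⊙-cancel a w 0V ¬z (trans aw≡0 (sym (⊙-0V a)))))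

infix 4 _≟V_
_≟V_ : ∀ {n} → DecidableEquality (Vec ℤ n)
_≟V_ = VecP.≡-dec ℤ._≟_

/-equal⇒close : ∀ ρ .⦃ _ : NonZero ρ ⦄ a b → a ℕDM./ ρ ≡ b ℕDM./ ρ → ∣ pos a ℤ.- pos b ∣ < ρ
/-equal⇒close ρ a b eq = subst (_< ρ) (cong ∣_∣ (sym same)) (ℕP.≤-<-trans (ℤP.∣m⊝n∣≤m⊔n (a ℕDM.% ρ) (b ℕDM.% ρ))
    (ℕP.⊔-lub (ℕDM.m%n<n a ρ) (ℕDM.m%n<n b ρ)))
  where
  open ≡-Reasoning
  lem : ∀ x y q → x ℤ.+ q ℤ.- (y ℤ.+ q) ≡ x ℤ.- y
  lem = ring-ℤ
  same : pos a ℤ.- pos b ≡ (a ℕDM.% ρ) ℤ.⊖ (b ℕDM.% ρ)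
  same = begin
    pos a ℤ.- pos b
      ≡⟨ cong₂ (λ x y → pos x ℤ.- pos y) (ℕDM.m≡m%n+[m/n]*n a ρ) (trans (ℕDM.m≡m%n+[m/n]*n b ρ) (cong (λ q → b ℕDM.% ρ + q * ρ) (sym eq))) ⟩
    pos (a ℕDM.% ρ + a ℕDM./ ρ * ρ) ℤ.- pos (b ℕDM.% ρ + a ℕDM./ ρ * ρ)
      ≡⟨ cong₂ ℤ._-_ (ℤP.pos-+ (a ℕDM.% ρ) _) (ℤP.pos-+ (b ℕDM.% ρ) _) ⟩
    pos (a ℕDM.% ρ) ℤ.+ pos (a ℕDM./ ρ * ρ) ℤ.- (pos (b ℕDM.% ρ) ℤ.+ pos (a ℕDM./ ρ * ρ))
      ≡⟨ lem (pos (a ℕDM.% ρ)) (pos (b ℕDM.% ρ)) (pos (a ℕDM./ ρ * ρ)) ⟩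
    pos (a ℕDM.% ρ) ℤ.- pos (b ℕDM.% ρ)  ≡⟨ ℤP.m-n≡m⊖n (a ℕDM.% ρ) (b ℕDM.% ρ) ⟩
    (a ℕDM.% ρ) ℤ.⊖ (b ℕDM.% ρ)  ∎

record Basis {n} (Λ : Vec ℤ n → Set) (Q c size : ℕ) : Set where
  field
    k     : ℕ
    k≤    : k ≤ n
    ws    : Vec (Vec ℤ n) k
    Ns    : Vec ℕ k
    ws∈Λ  : VAll.All Λ ws
    indep : Independent ws
    fits  : Fits Q ws Ns
    Ns≥1  : VAll.All (1 ≤_) Ns
    count≤ : size ≤ c * prodV Ns

trivialBasis : ∀ {n} {Λ : Vec ℤ n → Set} {Q c size} → size ≤ c → Basis Λ Q c size
trivialBasis {c = c} h = record
  { k = 0 ; k≤ = z≤n ; ws = Vec.[] ; Ns = Vec.[] ; ws∈Λ = VAll.[] ; indep = λ { Vec.[] _ → refl } ; fits = [] ; Ns≥1 = VAll.[]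
  ; count≤ = subst (_ ≤_) (sym (ℕP.*-identityʳ c)) h }

-- Minkowski-type basis by induction on the dimension: project along a short vector
-- w of Λ.  Whenever w turns out not to be shortest, a shorter one has been found.
module ShortVectors {n} (Λ : Vec ℤ (suc n) → Set) (Λ-minus : ∀ {u v} → Λ u → Λ v → Λ (u ⊕ ⊖ v))
  (R : ℕ) (E : List (Vec ℤ (suc n))) (E-unique : Unique E) (E⊆Λ : ∀ {u} → u ∈ E → Λ u) (E-bnd : ∀ {u} → u ∈ E → Bnd R u)
  (IH : ∀ (Λ' : Vec ℤ n → Set) → (∀ {u v} → Λ' u → Λ' v → Λ' (u ⊕ ⊖ v)) → ∀ R' E' → Unique E' →
    (∀ {u} → u ∈ E' → Λ' u) → (∀ {u} → u ∈ E' → Bnd R' u) → Basis Λ' (4 ^ n * R') (2 ^ n) (length E')) where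

  open Subgroup Λ Λ-minus

  Result : Set
  Result = Basis Λ (4 ^ suc n * R) (2 ^ suc n) (length E)

  Shorter : ℕ → Set
  Shorter ρ = ∃ λ u → Λ u × u ≢ 0V × ‖ u ‖ < ρ

  module Along (w : Vec ℤ (suc n)) (w∈ : Λ w) (w≢0 : w ≢ 0V) (w≤ : ‖ w ‖ ≤ 2 * R) where

    ρ : ℕ
    ρ = ‖ w ‖

    i : Fin (suc n)
    i = proj₁ (norm-attained w)

    open Projection w i

    ∣p∣≡ρ : ∣ p ∣ ≡ ρ
    ∣p∣≡ρ = proj₂ (norm-attained w)

    instance
      ρ≢0 : NonZero ρ
      ρ≢0 = ℕ.≢-nonZero (λ ρ≡0 → w≢0 (norm≡0 w (ℕP.≤-reflexive ρ≡0)))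

    p≢0 : p ≢ ℤ.0ℤ
    p≢0 p≡0 = ℕ.≢-nonZero⁻¹ ρ (trans (sym ∣p∣≡ρ) (cong ∣_∣ p≡0))

    recover : ∀ {b c} x → Bnd b (Π x) → ∣ Vec.lookup x i ∣ ≤ c → Bnd (b + c * ρ) (p ⊙ x)
    recover {b} {c} x bΠ xi≤ = subst (Bnd (b + c * ρ)) (lem (p ⊙ x) (Vec.lookup x i ⊙ w))
      (bnd-⊕ bΠ (bnd-⊙ (Vec.lookup x i) xi≤ (bnd-norm w)))
      where
      lem : ∀ {m} (u v : Vec ℤ m) → (u ⊕ ⊖ v) ⊕ v ≡ u
      lem Vec.[] Vec.[] = refl
      lem (a Vec.∷ u) (b Vec.∷ v) = cong₂ Vec._∷_ (l a b) (lem u v)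
        where
        l : ∀ a b → a ℤ.+ (ℤ.- b) ℤ.+ b ≡ a
        l = ring-ℤ

    norm-p : ∀ {q} (x : Vec ℤ (suc n)) → Bnd q (p ⊙ x) → ρ * ‖ x ‖ ≤ q
    norm-p {q} x bx with norm-attained {n} x
    ... | j , eq = subst (_≤ q) (trans (cong ∣_∣ (VecP.lookup-map j (p ℤ.*_) x)) (trans (ℤP.abs-* p _) (cong₂ _*_ ∣p∣≡ρ eq))) (lookup-bnd j bx)
      where
      lookup-bnd : ∀ {m} {v : Vec ℤ m} j → Bnd q v → ∣ Vec.lookup v j ∣ ≤ q
      lookup-bnd Fin.zero    (h VAll.∷ _)  = h
      lookup-bnd (Fin.suc j) (_ VAll.∷ hs) = lookup-bnd j hs

    N₁ : ℕ
    N₁ = 2 * R ℕDM./ ρ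

    cell : Vec ℤ (suc n) → ℕ
    cell x = ∣ Vec.lookup x i ℤ.+ pos R ∣ ℕDM./ ρ

    key : Vec ℤ (suc n) → Vec ℤ n × ℕ
    key x = π x , cell x

    lookup≤ : ∀ {q} {x : Vec ℤ (suc n)} → Bnd q x → ∣ Vec.lookup x i ∣ ≤ q
    lookup≤ b = go i b
      where
      go : ∀ {m q} {v : Vec ℤ m} j → Bnd q v → ∣ Vec.lookup v j ∣ ≤ q
      go Fin.zero    (h VAll.∷ _)  = h
      go (Fin.suc j) (_ VAll.∷ hs) = go j hs

    shifted : ∀ a → ∣ a ∣ ≤ R → pos ∣ a ℤ.+ pos R ∣ ≡ a ℤ.+ pos R × ∣ a ℤ.+ pos R ∣ ≤ 2 * R
    shifted a h = ℤP.0≤i⇒+∣i∣≡i (nonneg a h) , ℕP.≤-trans (ℤP.∣i+j∣≤∣i∣+∣j∣ a (pos R))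
      (ℕP.≤-trans (ℕP.+-monoˡ-≤ R h) (ℕP.≤-reflexive (cong (R +_) (sym (ℕP.+-identityʳ R)))))
      where
      nonneg : ∀ a → ∣ a ∣ ≤ R → ℤ.0ℤ ℤ.≤ a ℤ.+ pos R
      nonneg (pos m)  _ = ℤ.+≤+ z≤n
      nonneg -[1+ m ] h = subst (ℤ.0ℤ ℤ.≤_) (sym (ℤP.⊖-≥ h)) (ℤ.+≤+ z≤n)

    -- Points with equal projection differ by a rational multiple of `w`. If their `i`-th
    -- coordinates lie in the same cell of width `ρ`, that multiple is below one in absolute value,
    -- so the difference is shorter than `w`.
    collision : ∀ {x y} → x ∈ E → y ∈ E → key x ≡ key y → ¬ (x ≡ y) → Shorter ρ
    collision {x} {y} x∈ y∈ eq x≢y = x ⊕ ⊖ y , Λ-minus (E⊆Λ x∈) (E⊆Λ y∈) , x≢y ∘ diff≡0 x y , short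
      where
      xi = Vec.lookup x i
      yi = Vec.lookup y i
      δ : ℕ
      δ = ∣ xi ℤ.- yi ∣
      lem : ∀ a b r → a ℤ.+ r ℤ.- (b ℤ.+ r) ≡ a ℤ.- b
      lem = ring-ℤ
      δ<ρ : δ < ρ
      δ<ρ = subst (_< ρ) (cong ∣_∣ (trans (cong₂ ℤ._-_ (proj₁ (shifted xi (lookup≤ (E-bnd x∈)))) (proj₁ (shifted yi (lookup≤ (E-bnd y∈))))) (lem xi yi (pos R))))
        (/-equal⇒close ρ _ _ (cong proj₂ eq))
      π≡0 : π (x ⊕ ⊖ y) ≡ 0V
      π≡0 = trans (π-minus x y) (trans (cong (λ u → u ⊕ ⊖ π y) (cong proj₁ eq)) (⊕-inverseʳ (π y)))
      Πbnd : Bnd 0 (Π (x ⊕ ⊖ y))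
      Πbnd = undel-All i (ℕP.≤-reflexive (cong ∣_∣ (Π-i (x ⊕ ⊖ y)))) (subst (Bnd 0) (sym π≡0) (bnd-0 0))
      short : ‖ x ⊕ ⊖ y ‖ < ρ
      short = ℕP.≤-<-trans (ℕP.*-cancelˡ-≤ ρ (ℕP.≤-trans (norm-p (x ⊕ ⊖ y) (recover {0} {δ} (x ⊕ ⊖ y) Πbnd
        (ℕP.≤-reflexive (cong ∣_∣ (trans (lookup-⊕ x (⊖ y)) (cong (λ u → xi ℤ.+ u) (lookup-⊖ y))))))) (ℕP.≤-reflexive (ℕP.*-comm δ ρ)))) δ<ρ

    E' : List (Vec ℤ n)
    E' = deduplicate _≟V_ (map π E)

    N₁≥1 : 1 ≤ N₁
    N₁≥1 = ℕDM.m≥n⇒m/n>0 w≤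

    E≤E' : (∀ {x y} → x ∈ E → y ∈ E → key x ≡ key y → x ≡ y) → length E ≤ length E' * (2 * N₁)
    E≤E' inj = begin
      length E  ≤⟨ length-inj key E-unique inj mem ⟩
      length (cartesianProductWith _,_ E' (upTo (suc N₁)))  ≡⟨ length-cartesianProductWith _,_ E' (upTo (suc N₁)) ⟩
      length E' * length (upTo (suc N₁))  ≡⟨ cong (length E' *_) (ListP.length-upTo (suc N₁)) ⟩
      -- The cells are numbered from `0` to `N₁`; `N₁ + 1 ≤ 2 N₁` is the source of the factor 2 per
      -- dimension in the count.
      length E' * suc N₁  ≤⟨ ℕP.*-monoʳ-≤ (length E') (ℕP.+-mono-≤ N₁≥1 (ℕP.≤-reflexive (sym (ℕP.+-identityʳ N₁)))) ⟩
      length E' * (N₁ + (N₁ + 0))  ∎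
      where
      open ℕP.≤-Reasoning
      mem : ∀ {x} → x ∈ E → key x ∈ cartesianProductWith _,_ E' (upTo (suc N₁))
      mem {x} x∈ = ∈-cartesianProductWith⁺ _,_ (∈-deduplicate⁺ _≟V_ (∈-map⁺ π x∈))
        (∈-upTo⁺ (s≤s (ℕDM./-monoˡ-≤ ρ (proj₂ (shifted (Vec.lookup x i) (lookup≤ (E-bnd x∈)))))))

    Λ' : Vec ℤ n → Set
    Λ' y = ∃ λ x → Λ x × π x ≡ y

    R' : ℕ
    R' = ρ * R + R * ρ

    basis' : Basis Λ' (4 ^ n * R') (2 ^ n) (length E')
    basis' = IH Λ' (λ { (x , l , refl) (y , l' , refl) → x ⊕ ⊖ y , Λ-minus l l' , π-minus x y }) R' E' (deduplicate-! _≟V_ _) inΛ' bnd'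
      where
      origin : ∀ {y} → y ∈ E' → ∃ λ x → x ∈ E × y ≡ π x
      origin y∈ = ∈-map⁻ π (∈-deduplicate⁻ _≟V_ (map π E) y∈)
      inΛ' : ∀ {y} → y ∈ E' → Λ' y
      inΛ' y∈ with origin y∈
      ... | x , x∈ , refl = x , E⊆Λ x∈ , refl
      bnd' : ∀ {y} → y ∈ E' → Bnd R' y
      bnd' y∈ with origin y∈
      ... | x , x∈ , refl = del-All i (bnd-⊕ (bnd-⊙ p (ℕP.≤-reflexive ∣p∣≡ρ) (E-bnd x∈))
        (bnd-⊖ (bnd-⊙ (Vec.lookup x i) (lookup≤ (E-bnd x∈)) (bnd-norm w))))

    -- The lift is shifted along `w` until its `i`-th coordinate is at most `ρ / 2`. If it is then
    -- not shorter than `w`, the term along `w` makes up at most half of `ρ * ‖ x ‖`, which is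
    -- therefore at most twice the norm of the projection. Together with `R' = 2ρR` this gives the
    -- factor 4 per dimension.
    lift : ∀ {y N} → Λ' y → y ≢ 0V → N * ‖ y ‖ ≤ 4 ^ n * R' → Shorter ρ ⊎ (∃ λ x → Λ x × π x ≡ y × N * ‖ x ‖ ≤ 4 ^ suc n * R)
    lift {N = N} (x₀ , l₀ , refl) y≢0 fit with rounding (Vec.lookup x₀ i) p p≢0
    ... | m , near = decide (‖ x ‖ <? ρ)
      where
      x : Vec ℤ (suc n)
      x = x₀ ⊕ ⊖ (m ⊙ w)
      l : Λ x
      l = Λ-minus l₀ (Λ-times m w∈)
      same : π x ≡ π x₀
      same = trans (π-minus x₀ (m ⊙ w)) (trans (cong (λ u → π x₀ ⊕ ⊖ u) mw) (trans (cong (π x₀ ⊕_) ⊖0) (⊕-identityʳ (π x₀))))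
        where
        mw : π (m ⊙ w) ≡ 0V
        mw = trans (cong π (sym (⊕-identityʳ (m ⊙ w)))) (trans (π-linear m w 0V) (trans (cong₂ (λ u v → m ⊙ u ⊕ v) π-w π-0) (trans (⊕-identityʳ _) (⊙-0V m))))
        ⊖0 : ⊖ (0V {n}) ≡ 0V
        ⊖0 = trans (sym (⊕-identityˡ (⊖ 0V))) (⊕-inverseʳ 0V)
      xi : ∣ Vec.lookup x i ∣ ≡ ∣ Vec.lookup x₀ i ℤ.- m ℤ.* p ∣
      xi = cong ∣_∣ (trans (lookup-⊕ x₀ (⊖ (m ⊙ w))) (cong (λ u → Vec.lookup x₀ i ℤ.+ u) (trans (lookup-⊖ (m ⊙ w)) (cong ℤ.-_ (lookup-⊙ m w)))))
      Y = ‖ π x₀ ‖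
      Πbnd : Bnd Y (Π x)
      Πbnd = undel-All i (subst (λ u → ∣ u ∣ ≤ Y) (sym (Π-i x)) z≤n) (subst (Bnd Y) (sym same) (bnd-norm (π x₀)))
      bound-x : ρ * ‖ x ‖ ≤ Y + ∣ Vec.lookup x i ∣ * ρ
      bound-x = norm-p x (recover {Y} {∣ Vec.lookup x i ∣} x Πbnd ℕP.≤-refl)
      near' : 2 * ∣ Vec.lookup x i ∣ ≤ ρ
      near' = subst₂ _≤_ (cong (2 *_) (sym xi)) ∣p∣≡ρ near
      fits : ρ ≤ ‖ x ‖ → N * ‖ x ‖ ≤ 4 ^ suc n * R
      fits ρ≤ = ℕP.*-cancelˡ-≤ ρ (begin
          ρ * (N * ‖ x ‖)  ≡⟨ l₁ ρ N ‖ x ‖ ⟩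
          N * (ρ * ‖ x ‖)  ≤⟨ ℕP.*-monoʳ-≤ N short ⟩
          N * (2 * Y)  ≡⟨ l₂ N Y ⟩
          2 * (N * Y)  ≤⟨ ℕP.*-monoʳ-≤ 2 fit ⟩
          2 * (4 ^ n * R')  ≡⟨ l₃ (4 ^ n) ρ R ⟩
          ρ * (4 ^ suc n * R)  ∎)
        where
        open ℕP.≤-Reasoning
        l₁ : ∀ a b c → a * (b * c) ≡ b * (a * c)
        l₁ = ring-ℕ
        l₂ : ∀ a b → a * (2 * b) ≡ 2 * (a * b)
        l₂ = ring-ℕ
        l₃ : ∀ a b c → 2 * (a * (b * c + c * b)) ≡ b * (4 * a * c)
        l₃ = ring-ℕ
        l₄ : ∀ a → 2 * a ≡ a + a
        l₄ = ring-ℕ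
        l₅ : ∀ y a r → 2 * (y + a * r) ≡ 2 * y + 2 * a * r
        l₅ = ring-ℕ
        short : ρ * ‖ x ‖ ≤ 2 * Y
        short = ℕP.+-cancelʳ-≤ (ρ * ‖ x ‖) _ _ (begin
          ρ * ‖ x ‖ + ρ * ‖ x ‖  ≡⟨ l₄ (ρ * ‖ x ‖) ⟨
          2 * (ρ * ‖ x ‖)  ≤⟨ ℕP.*-monoʳ-≤ 2 bound-x ⟩
          2 * (Y + ∣ Vec.lookup x i ∣ * ρ)  ≡⟨ l₅ Y ∣ Vec.lookup x i ∣ ρ ⟩
          2 * Y + 2 * ∣ Vec.lookup x i ∣ * ρ  ≤⟨ ℕP.+-monoʳ-≤ (2 * Y) (ℕP.*-mono-≤ near' ρ≤) ⟩
          2 * Y + ρ * ‖ x ‖  ∎)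
      decide : Dec (‖ x ‖ < ρ) → Shorter ρ ⊎ (∃ λ x' → Λ x' × π x' ≡ π x₀ × N * ‖ x' ‖ ≤ 4 ^ suc n * R)
      decide (yes s) = inj₁ (x , l , (λ x≡0 → y≢0 (trans (sym same) (trans (cong π x≡0) π-0))) , s)
      decide (no ¬s) = inj₂ (x , l , same , fits (ℕP.≮⇒≥ ¬s))

    lift-all : ∀ {k} {ys : Vec (Vec ℤ n) k} {Ns} → VAll.All Λ' ys → VAll.All (_≢ 0V) ys → Fits (4 ^ n * R') ys Ns →
      Shorter ρ ⊎ (∃ λ xs → VAll.All Λ xs × Vec.map π xs ≡ ys × Fits (4 ^ suc n * R) xs Ns)
    lift-all VAll.[] VAll.[] [] = inj₂ (Vec.[] , VAll.[] , refl , [])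
    lift-all {Ns = N Vec.∷ _} (l VAll.∷ ls) (z VAll.∷ zs) (f ∷ fs) with lift {N = N} l z f | lift-all ls zs fs
    ... | inj₁ s | _      = inj₁ s
    ... | inj₂ _ | inj₁ s = inj₁ s
    ... | inj₂ (x , lx , eq , fx) | inj₂ (xs , lxs , eqs , fxs) = inj₂ (x Vec.∷ xs , lx VAll.∷ lxs , cong₂ Vec._∷_ eq eqs , fx ∷ fxs)

    attempt : Shorter ρ ⊎ Result
    attempt with find∈? (λ x → find∈? (λ y → (π x ≟V π y) ×-dec ((cell x ℕ.≟ cell y) ×-dec ¬? (x ≟V y))) E) E
    ... | yes (x , x∈ , y , y∈ , eq , eq' , x≢y) = inj₁ (collision x∈ y∈ (cong₂ _,_ eq eq') x≢y)
    ... | no nil' with lift-all (Basis.ws∈Λ basis') (independent-nonzero _ (Basis.indep basis')) (Basis.fits basis')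
    ...   | inj₁ s = inj₁ s
    ...   | inj₂ (xs , lxs , eqs , fxs) = inj₂ record
      { k = suc (Basis.k basis') ; k≤ = s≤s (Basis.k≤ basis') ; ws = w Vec.∷ xs ; Ns = N₁ Vec.∷ Basis.Ns basis'
      ; ws∈Λ = w∈ VAll.∷ lxs
      ; indep = independent-extend xs w≢0 (subst Independent (sym eqs) (Basis.indep basis'))
      ; fits = fit₁ ∷ fxs ; Ns≥1 = N₁≥1 VAll.∷ Basis.Ns≥1 basis' ; count≤ = counted }
      where
      inj : ∀ {x y} → x ∈ E → y ∈ E → key x ≡ key y → x ≡ y
      inj {x} {y} x∈ y∈ eq = decidable-stable (x ≟V y) (λ x≢y → nil' (x , x∈ , y , y∈ , cong proj₁ eq , cong proj₂ eq , x≢y))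
      fit₁ : N₁ * ρ ≤ 4 ^ suc n * R
      fit₁ = ℕP.≤-trans (ℕDM.m/n*n≤m (2 * R) ρ) (ℕP.*-monoˡ-≤ R (ℕP.≤-trans (s≤s (s≤s z≤n)) (ℕP.m≤m*n 4 (4 ^ n) ⦃ ℕP.m^n≢0 4 n ⦄)))
      open ℕP.≤-Reasoning
      l₁ : ∀ a b c → a * b * (2 * c) ≡ 2 * a * (c * b)
      l₁ = ring-ℕ
      counted : length E ≤ 2 ^ suc n * (N₁ * prodV (Basis.Ns basis'))
      counted = begin
        length E  ≤⟨ E≤E' inj ⟩
        length E' * (2 * N₁)  ≤⟨ ℕP.*-monoˡ-≤ (2 * N₁) (Basis.count≤ basis') ⟩
        2 ^ n * prodV (Basis.Ns basis') * (2 * N₁)  ≡⟨ l₁ (2 ^ n) (prodV (Basis.Ns basis')) N₁ ⟩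
        2 ^ suc n * (N₁ * prodV (Basis.Ns basis'))  ∎

  descend : ∀ fuel w → Λ w → w ≢ 0V → ‖ w ‖ ≤ 2 * R → ‖ w ‖ ≤ fuel → Result
  descend fuel w w∈ w≢0 w≤ h with Along.attempt w w∈ w≢0 w≤
  descend fuel       w w∈ w≢0 w≤ h | inj₂ result = result
  descend zero       w w∈ w≢0 w≤ h | inj₁ _ = ⊥-elim (w≢0 (norm≡0 w h))
  descend (suc fuel) w w∈ w≢0 w≤ h | inj₁ (u , u∈ , u≢0 , u<) =
    descend fuel u u∈ u≢0 (ℕP.≤-trans (ℕP.<⇒≤ u<) w≤) (ℕP.<⇒≤pred (ℕP.<-≤-trans u< h))

-- Two distinct points supply a first nonzero lattice vector, of norm at most `2 * R`; smaller sets
-- are counted by the constant alone.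
short-basis : ∀ n (Λ : Vec ℤ n → Set) → (∀ {u v} → Λ u → Λ v → Λ (u ⊕ ⊖ v)) → ∀ R E → Unique E →
  (∀ {u} → u ∈ E → Λ u) → (∀ {u} → u ∈ E → Bnd R u) → Basis Λ (4 ^ n * R) (2 ^ n) (length E)
short-basis n Λ minus R [] u mem bnd = trivialBasis z≤n
short-basis n Λ minus R (x ∷ []) u mem bnd = trivialBasis (ℕP.m^n>0 2 n)
short-basis zero Λ minus R (Vec.[] ∷ (Vec.[] ∷ _)) ((p ∷ _) ∷ _) mem bnd = ⊥-elim (p refl)
short-basis (suc n) Λ minus R E@(x ∷ (y ∷ _)) u@((x≢y ∷ _) ∷ _) mem bnd =
  ShortVectors.descend Λ minus R E u mem bnd (short-basis n) ‖ x ⊕ ⊖ y ‖ (x ⊕ ⊖ y)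
    (minus (mem (here refl)) (mem (there (here refl)))) (x≢y ∘ diff≡0 x y)
    (subst (λ k → ‖ x ⊕ ⊖ y ‖ ≤ R + k) (sym (ℕP.+-identityʳ R)) (norm-≤ (bnd-⊕ (bnd (here refl)) (bnd-⊖ (bnd (there (here refl)))))))
    ℕP.≤-refl

-- Progressions in multiples of a set of small doubling

data Below : ∀ {k} → Vec ℕ k → Vec ℕ k → Set where
  []  : Below Vec.[] Vec.[]
  _∷_ : ∀ {k x N} {xs Ns : Vec ℕ k} → x ≤ N → Below xs Ns → Below (x Vec.∷ xs) (N Vec.∷ Ns)

posV : ∀ {k} → Vec ℕ k → Vec ℤ k
posV = Vec.map pos

posV-injective : ∀ {k} {x y : Vec ℕ k} → posV x ≡ posV y → x ≡ y
posV-injective {x = Vec.[]}    {Vec.[]}    eq = refl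
posV-injective {x = a Vec.∷ x} {b Vec.∷ y} eq =
  cong₂ Vec._∷_ (ℤP.+-injective (VecP.∷-injectiveˡ eq)) (posV-injective (VecP.∷-injectiveʳ eq))

comb-minus : ∀ {n k} (ws : Vec (Vec ℤ n) k) x y → comb ws (x ⊕ ⊖ y) ≡ comb ws x ⊕ ⊖ comb ws y
comb-minus Vec.[] Vec.[] Vec.[] = sym (⊕-inverseʳ 0V)
comb-minus (w Vec.∷ ws) (a Vec.∷ x) (b Vec.∷ y) = trans (cong ((a ℤ.+ (ℤ.- b)) ⊙ w ⊕_) (comb-minus ws x y)) (lem w (comb ws x) (comb ws y))
  where
  lem : ∀ {m} (w u v : Vec ℤ m) → (a ℤ.+ (ℤ.- b)) ⊙ w ⊕ (u ⊕ ⊖ v) ≡ (a ⊙ w ⊕ u) ⊕ ⊖ (b ⊙ w ⊕ v)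
  lem Vec.[] Vec.[] Vec.[] = refl
  lem (z Vec.∷ w) (c Vec.∷ u) (d Vec.∷ v) = cong₂ Vec._∷_ (l a b z c d) (lem w u v)
    where
    l : ∀ a b z c d → (a ℤ.+ (ℤ.- b)) ℤ.* z ℤ.+ (c ℤ.+ (ℤ.- d)) ≡ a ℤ.* z ℤ.+ c ℤ.+ (ℤ.- (b ℤ.* z ℤ.+ d))
    l = ring-ℤ

comb-bnd : ∀ {n k Q t} {ws : Vec (Vec ℤ n) k} {Ns x} → Fits Q ws Ns → Below x (Vec.map (t *_) Ns) → Bnd (k * (t * Q)) (comb ws (posV x))
comb-bnd [] [] = bnd-0 0
comb-bnd {Q = Q} {t} {w Vec.∷ ws} {N Vec.∷ Ns} {x Vec.∷ xs} (f ∷ fs) (b ∷ bs) =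
  bnd-⊕ (bnd-mono x‖w‖≤ (bnd-⊙ (pos x) ℕP.≤-refl (bnd-norm w))) (comb-bnd {t = t} fs bs)
  where
  x‖w‖≤ : x * ‖ w ‖ ≤ t * Q
  x‖w‖≤ = ℕP.≤-trans (ℕP.*-monoˡ-≤ ‖ w ‖ b) (ℕP.≤-trans (ℕP.≤-reflexive (ℕP.*-assoc t N ‖ w ‖)) (ℕP.*-monoʳ-≤ t f))

comb-values : ∀ {n k} (e : Vec ℤ n) h (ws : Vec (Vec ℤ n) k) → VAll.All (λ w → ∃ λ z → dot e w ≡ h ℤ.* z) ws →
  ∃ λ zs → ∀ x → dot e (comb ws x) ≡ h ℤ.* dot zs x
comb-values e h Vec.[] VAll.[] = Vec.[] , λ { Vec.[] → trans (dot-0 e) (sym (ℤP.*-zeroʳ h)) }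
comb-values e h (w Vec.∷ ws) ((z , eq) VAll.∷ eqs) with comb-values e h ws eqs
... | zs , val = z Vec.∷ zs , λ { (x Vec.∷ xs) → trans (dot-⊕ e _ _) (trans (cong₂ ℤ._+_ (trans (dot-⊙ e x w) (cong (x ℤ.*_) eq)) (val xs)) (lem h x z (dot zs xs))) }
  where
  lem : ∀ h x z d → x ℤ.* (h ℤ.* z) ℤ.+ h ℤ.* d ≡ h ℤ.* (z ℤ.* x ℤ.+ d)
  lem = ring-ℤ

fits-norm : ∀ {n k Q} {ws : Vec (Vec ℤ n) k} {Ns} → VAll.All (1 ≤_) Ns → Fits Q ws Ns → VAll.All (λ w → ‖ w ‖ ≤ Q) ws
fits-norm VAll.[] [] = VAll.[]
fits-norm {ws = w Vec.∷ _} {N Vec.∷ _} (N≥1 VAll.∷ ns) (f ∷ fs) = ℕP.≤-trans (ℕP.m≤n*m ‖ w ‖ N ⦃ ℕ.>-nonZero N≥1 ⦄) f VAll.∷ fits-norm ns fs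

divide-vector : ∀ {n} τ q → 1 ≤ τ → (c : Vec ℤ n) → Bnd (q * τ) c → ∃₂ λ m r → Bnd q m × Bnd τ r × c ≡ pos τ ⊙ m ⊕ r
divide-vector τ q τ≥1 Vec.[] VAll.[] = Vec.[] , Vec.[] , VAll.[] , VAll.[] , refl
divide-vector τ q τ≥1 (c Vec.∷ cs) (h VAll.∷ hs) with truncated-division c τ τ≥1 | divide-vector τ q τ≥1 cs hs
... | m , r , eq , r≤ , m≤ | ms , rs , bm , br , eqs = m Vec.∷ ms , r Vec.∷ rs
  , ℕP.*-cancelʳ-≤ ∣ m ∣ q τ ⦃ ℕ.>-nonZero τ≥1 ⦄ (ℕP.≤-trans m≤ h) VAll.∷ bm , r≤ VAll.∷ br
  , cong₂ Vec._∷_ (trans eq (cong (ℤ._+ r) (ℤP.*-comm m (pos τ)))) eqs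

module GapConstants (ξ : ℕ) where

  -- In units of `C * h`, points of the progression have norm at most `reach`, so injectivity must
  -- cover twice that for their differences. The summand 3 serves the comparison in `coords-scale`.
  reach κ₀ : ℕ
  reach = ξ * 4 ^ ξ
  κ₀    = 3 + (reach + reach)

  open Constants ξ 4 κ₀ public using (Lmax)

  abstract
    L : ℕ
    L = Lmax * (1 + ξ * 2)

    L-unfold : L ≡ Lmax * (1 + ξ * 2)
    L-unfold = refl

record SumGap (S : List ℤ) (ξ t size : ℕ) : Set where
  field
    rank      : ℕ
    rank≤     : rank ≤ ξ
    zs        : Vec ℤ rank
    Ns        : Vec ℕ rank
    size≤     : size ≤ 2 ^ ξ * prodV Ns
    contained : ∀ {x} → Below x (Vec.map (t *_) Ns) → Sums (_∈ S) (GapConstants.L ξ * t) (dot zs (posV x))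
    injective : ∀ {x y} → Below x (Vec.map (t *_) Ns) → Below y (Vec.map (t *_) Ns) →
      dot zs (posV x) ≡ dot zs (posV y) → x ≡ y

-- The lattice model is applied to S + [-2t,2t]X, which contains i s for i ≤ t, s ∈ S;
-- hence the coordinates of S are t times smaller than those of the enlarged set.
module BuildGap (S : List ℤ) (0∈S : ℤ.0ℤ ∈ S) (S-neg : ∀ {x} → x ∈ S → ℤ.- x ∈ S)
  (ξ : ℕ) (X : Vec ℤ ξ) (X⊆S : VAll.All (_∈ S) X)
  (cover : ∀ {s s'} → s ∈ S → s' ∈ S → ∃₂ λ s'' a → s'' ∈ S × Bnd 2 a × s ℤ.+ s' ≡ s'' ℤ.+ dot X a)
  (E : List ℤ) (E-unique : Unique E) (E⊑S : E ⊑ S) (t : ℕ) (t≥1 : 1 ≤ t) where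

  open GapConstants ξ using (reach; κ₀; Lmax)

  τ : ℕ
  τ = t * 2

  τ≥1 : 1 ≤ τ
  τ≥1 = ℕP.≤-trans t≥1 (ℕP.m≤m*n t 2)

  S' : List ℤ
  S' = cartesianProductWith (λ s b → s ℤ.+ dot X b) S (box ξ τ)

  S'⁺ : ∀ {s b} → s ∈ S → Bnd τ b → s ℤ.+ dot X b ∈ S'
  S'⁺ s∈ bb = ∈-cartesianProductWith⁺ (λ s b → s ℤ.+ dot X b) s∈ (∈-box⁺ bb)

  S'⁻ : ∀ {z} → z ∈ S' → ∃₂ λ s b → s ∈ S × Bnd τ b × z ≡ s ℤ.+ dot X b
  S'⁻ z∈ with ∈-cartesianProductWith⁻ (λ s b → s ℤ.+ dot X b) S (box ξ τ) z∈
  ... | s , b , s∈ , b∈ , eq = s , b , s∈ , ∈-box⁻ b∈ , eq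

  S⊑S' : S ⊑ S'
  S⊑S' {s} s∈ = subst (_∈ S') (trans (cong (λ w → s ℤ.+ w) (dot-0 X)) (ℤP.+-identityʳ s)) (S'⁺ s∈ (bnd-0 τ))

  S'-neg : ∀ {z} → z ∈ S' → ℤ.- z ∈ S'
  S'-neg z∈ with S'⁻ z∈
  ... | s , b , s∈ , bb , refl = subst (_∈ S')
    (trans (cong (λ w → ℤ.- s ℤ.+ w) (dot-⊖ X b)) (sym (ℤP.neg-distrib-+ s (dot X b)))) (S'⁺ (S-neg s∈) (bnd-⊖ bb))

  X' : Vec ℤ ξ
  X' = pos τ ⊙ X

  X'⊆S' : VAll.All (_∈ S') X'
  X'⊆S' = VAll.map (λ { (b , bb , refl) → subst (_∈ S') (ℤP.+-identityˡ _) (S'⁺ 0∈S bb) }) (units X)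
    where
    units : ∀ {n} (Y : Vec ℤ n) → VAll.All (λ z → ∃ λ b → Bnd τ b × z ≡ dot Y b) (pos τ ⊙ Y)
    units Vec.[]       = VAll.[]
    units (y Vec.∷ Y) =
      (pos τ Vec.∷ 0V , ℕP.≤-refl VAll.∷ bnd-0 τ , trans (ℤP.*-comm (pos τ) y) (trans (sym (ℤP.+-identityʳ _)) (cong (λ w → y ℤ.* pos τ ℤ.+ w) (sym (dot-0 Y)))))
      VAll.∷ VAll.map (λ (b , bb , eq) → ℤ.0ℤ Vec.∷ b , z≤n VAll.∷ bb , trans eq (lem y (dot Y b))) (units Y)
      where
      lem : ∀ y d → d ≡ y ℤ.* ℤ.0ℤ ℤ.+ d
      lem = ring-ℤ

  -- Coefficients of size `2 + 2τ ≤ 4τ` are divided by `τ`: the quotients become coefficients of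
  -- `X'`, the remainders stay inside `S'`. The covering bound 4 is thus independent of `t`.
  cover' : ∀ {s s'} → s ∈ S' → s' ∈ S' → ∃₂ λ s'' a → s'' ∈ S' × Bnd 4 a × s ℤ.+ s' ≡ s'' ℤ.+ dot X' a
  cover' z∈ z'∈ with S'⁻ z∈ | S'⁻ z'∈
  ... | s , b , s∈ , bb , refl | s' , b' , s'∈ , bb' , refl with cover s∈ s'∈
  ... | s₁ , a , s₁∈ , ba , eq with divide-vector τ 4 τ≥1 (a ⊕ (b ⊕ b')) (bnd-mono four (bnd-⊕ ba (bnd-⊕ bb bb')))
    where
    four : 2 + (τ + τ) ≤ 4 * τ
    four = ℕP.≤-trans (ℕP.+-monoˡ-≤ (τ + τ) (ℕP.+-mono-≤ τ≥1 τ≥1)) (ℕP.≤-reflexive (lem τ))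
      where
      lem : ∀ a → a + a + (a + a) ≡ 4 * a
      lem = ring-ℕ
  ... | m , r , bm , br , eq' = s₁ ℤ.+ dot X r , m , S'⁺ s₁∈ br , bm , (begin
      s ℤ.+ dot X b ℤ.+ (s' ℤ.+ dot X b')  ≡⟨ l₁ s s' (dot X b) (dot X b') ⟩
      s ℤ.+ s' ℤ.+ (dot X b ℤ.+ dot X b')  ≡⟨ cong₂ ℤ._+_ eq (sym (dot-⊕ X b b')) ⟩
      s₁ ℤ.+ dot X a ℤ.+ dot X (b ⊕ b')  ≡⟨ trans (ℤP.+-assoc s₁ _ _) (cong (λ w → s₁ ℤ.+ w) (sym (dot-⊕ X a (b ⊕ b')))) ⟩
      s₁ ℤ.+ dot X (a ⊕ (b ⊕ b'))  ≡⟨ cong (λ w → s₁ ℤ.+ dot X w) eq' ⟩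
      s₁ ℤ.+ dot X (pos τ ⊙ m ⊕ r)  ≡⟨ cong (λ w → s₁ ℤ.+ w) (trans (dot-⊕ X (pos τ ⊙ m) r) (cong (ℤ._+ dot X r) (trans (dot-⊙ X (pos τ) m) (sym (dot-⊙ˡ (pos τ) X m))))) ⟩
      s₁ ℤ.+ (dot X' m ℤ.+ dot X r)  ≡⟨ l₂ s₁ (dot X' m) (dot X r) ⟩
      s₁ ℤ.+ dot X r ℤ.+ dot X' m  ∎)
    where
    open ≡-Reasoning
    l₁ : ∀ s s' x y → s ℤ.+ x ℤ.+ (s' ℤ.+ y) ≡ s ℤ.+ s' ℤ.+ (x ℤ.+ y)
    l₁ = ring-ℤ
    l₂ : ∀ s x y → s ℤ.+ (x ℤ.+ y) ≡ s ℤ.+ y ℤ.+ x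
    l₂ = ring-ℤ

  S'-sums : ∀ {z} → z ∈ S' → Sums (_∈ S) (1 + ξ * τ) z
  S'-sums z∈ with S'⁻ z∈
  ... | s , b , s∈ , bb , refl = more s∈ (sums-dot 0∈S S-neg X⊆S bb)

  multiples : ∀ {s} → s ∈ S → ∀ n → n ≤ t → pos n ℤ.* s ∈ S'
  multiples {s} s∈ n n≤ with go n
    where
    go : ∀ n → ∃₂ λ s' a → s' ∈ S × Bnd (n * 2) a × pos n ℤ.* s ≡ s' ℤ.+ dot X a
    go zero = ℤ.0ℤ , 0V , 0∈S , bnd-0 0 , sym (cong (λ w → ℤ.0ℤ ℤ.+ w) (dot-0 X))
    go (suc n) with go n
    ... | s' , a , s'∈ , ba , eq with cover s∈ s'∈
    ...   | s'' , a' , s''∈ , ba' , eq' = s'' , a' ⊕ a , s''∈ , bnd-⊕ ba' ba ,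
      trans (ℤP.suc-* (pos n) s) (trans (cong (λ w → s ℤ.+ w) eq) (trans (sym (ℤP.+-assoc s s' _)) (trans (cong (ℤ._+ dot X a) eq')
        (trans (ℤP.+-assoc s'' _ _) (cong (λ w → s'' ℤ.+ w) (sym (dot-⊕ X a' a)))))))
  ... | s' , a , s'∈ , ba , eq = subst (_∈ S') (sym eq) (S'⁺ s'∈ (bnd-mono (ℕP.*-monoˡ-≤ 2 n≤) ba))

  abstract
    latticeModel : LatticeModel S' ξ κ₀ Lmax
    latticeModel = LocalGroup.latticeModel S' (S⊑S' 0∈S) S'-neg ξ 4 κ₀ X' X'⊆S' cover'

  open LatticeModel latticeModel
  open Subgroup Λ Λ-minus
  private instance _ = h≢0

  cancel-h : ∀ {x y} → pos h ℤ.* x ≡ pos h ℤ.* y → x ≡ y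
  cancel-h {x} {y} = ℤP.*-cancelˡ-≡ (pos h) x y

  within : ∀ {k n} {u : Vec ℤ n} → k ≤ κ₀ → Bnd (k * (C * h)) u → Bnd (κ₀ * C * h) u
  within {k} k≤ b = bnd-mono (ℕP.≤-trans (ℕP.*-monoˡ-≤ (C * h) k≤) (ℕP.≤-reflexive (sym (ℕP.*-assoc κ₀ C h)))) b

  -- The multiple `n s` lies in `S'` and so has coordinates of its own within `C * h`; injectivity
  -- identifies them with `n ⊙ u`. Passing from `n` to `n + 1` keeps the vector to be compared
  -- within `3 * (C * h)`.
  coords-scale : ∀ {s u} → s ∈ S → Λ u → Bnd (C * h) u → dot e u ≡ pos h ℤ.* s →
    ∀ n → n ≤ t → Bnd (C * h) (pos n ⊙ u)
  coords-scale {u = u} s∈ l b eq zero n≤ = subst (Bnd (C * h)) (sym (⊙-zero u)) (bnd-0 (C * h))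
  coords-scale {s} {u} s∈ l b eq (suc n) n≤ with Λ-coord (multiples s∈ (suc n) n≤)
  ... | v , lv , bv , eqv = subst (Bnd (C * h)) (trans v≡ (sym (⊙-suc n u))) bv
    where
    nu = pos n ⊙ u
    bnu : Bnd (C * h) nu
    bnu = coords-scale s∈ l b eq n (ℕP.≤-trans (ℕP.n≤1+n n) n≤)
    three : Bnd (3 * (C * h)) (v ⊕ ⊖ (u ⊕ nu))
    three = subst (λ k → Bnd k (v ⊕ ⊖ (u ⊕ nu))) (lem (C * h)) (bnd-⊕ bv (bnd-⊖ (bnd-⊕ b bnu)))
      where
      lem : ∀ a → a + (a + a) ≡ 3 * a
      lem = ring-ℕ
    dot≡0 : dot e (v ⊕ ⊖ (u ⊕ nu)) ≡ ℤ.0ℤ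
    dot≡0 = trans (dot-⊕ e v _) (trans (cong₂ ℤ._+_ eqv (trans (dot-⊖ e _) (cong ℤ.-_ (trans (dot-⊕ e u nu) (cong₂ ℤ._+_ eq (trans (dot-⊙ e (pos n) u) (cong (pos n ℤ.*_) eq)))))))
      (trans (cong (λ w → pos h ℤ.* w ℤ.+ (ℤ.- (pos h ℤ.* s ℤ.+ pos n ℤ.* (pos h ℤ.* s)))) (ℤP.suc-* (pos n) s)) (lem (pos h) s (pos n))))
      where
      lem : ∀ h s n → h ℤ.* (s ℤ.+ n ℤ.* s) ℤ.+ (ℤ.- (h ℤ.* s ℤ.+ n ℤ.* (h ℤ.* s))) ≡ ℤ.0ℤ
      lem = ring-ℤ
    v≡ : v ≡ u ⊕ nu
    v≡ = diff≡0 v _ (Λ-inj (Λ-minus lv (Λ-plus l (Λ-times (pos n) l))) (within (ℕP.m≤m+n 3 _) three) dot≡0)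

  private instance
    t≢0 : NonZero t
    t≢0 = ℕ.>-nonZero t≥1

  R : ℕ
  R = C * h ℕDM./ t

  shrink : ∀ {n} (u : Vec ℤ n) → Bnd (C * h) (pos t ⊙ u) → Bnd R u
  shrink Vec.[]       VAll.[]        = VAll.[]
  shrink (a Vec.∷ u) (p VAll.∷ ps) =
    subst (_≤ R) (trans (cong (ℕDM._/ t) (trans (ℤP.abs-* (pos t) a) (ℕP.*-comm t ∣ a ∣))) (ℕDM.m*n/n≡m ∣ a ∣ t)) (ℕDM./-monoˡ-≤ t p) VAll.∷ shrink u ps

  coordinates : ∀ F → Unique F → F ⊑ S → ∃ λ G → length G ≡ length F × Unique G ×
    (∀ {u} → u ∈ G → Λ u × Bnd R u × ∃ λ s → s ∈ F × dot e u ≡ pos h ℤ.* s)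
  coordinates [] _ _ = [] , refl , [] , λ ()
  coordinates (s ∷ F) (s∉ ∷ uF) sub with Λ-coord (S⊑S' (sub (here refl))) | coordinates F uF (sub ∘ there)
  ... | u , l , b , eq | G , len , uG , spec = u ∷ G , cong suc len
    , (All.tabulate (λ v∈ u≡v → let _ , _ , s' , s'∈ , eq' = spec v∈ in
         All.lookup s∉ s'∈ (cancel-h (trans (sym eq) (trans (cong (dot e) u≡v) eq')))) ∷ uG)
    , λ { (here refl) → l , shrink u (coords-scale (sub (here refl)) l b eq t ℕP.≤-refl) , s , here refl , eq
        ; (there p) → let l' , b' , s' , s'∈ , eq' = spec p in l' , b' , s' , there s'∈ , eq' }

  private
    points = coordinates E E-unique E⊑S

  abstract
    basis : Basis Λ (4 ^ r * R) (2 ^ r) (length (proj₁ points))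
    basis = let _ , _ , uG , spec = points in
      short-basis r Λ Λ-minus R (proj₁ points) uG (proj₁ ∘ spec) (proj₁ ∘ proj₂ ∘ spec)

  open Basis basis

  Λ-zero : Λ 0V
  Λ-zero = let _ , l , _ = Λ-coord (S⊑S' 0∈S) in Λ-0 l

  Λ-comb : ∀ {k} {us : Vec (Vec ℤ r) k} → VAll.All Λ us → ∀ x → Λ (comb us x)
  Λ-comb VAll.[] Vec.[]              = Λ-zero
  Λ-comb (l VAll.∷ ls) (x Vec.∷ xs) = Λ-plus (Λ-times x l) (Λ-comb ls xs)

  tR≤ : t * (4 ^ r * R) ≤ 4 ^ ξ * (C * h)
  tR≤ = begin
    t * (4 ^ r * R)  ≡⟨ lem t (4 ^ r) R ⟩
    4 ^ r * (R * t)  ≤⟨ ℕP.*-mono-≤ (ℕP.^-monoʳ-≤ 4 r≤) (ℕDM.m/n*n≤m (C * h) t) ⟩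
    4 ^ ξ * (C * h)  ∎
    where
    open ℕP.≤-Reasoning
    lem : ∀ a b c → a * (b * c) ≡ b * (c * a)
    lem = ring-ℕ

  point-bnd : ∀ {x} → Below x (Vec.map (t *_) Ns) → Bnd (reach * (C * h)) (comb ws (posV x))
  point-bnd bx = bnd-mono (ℕP.≤-trans (ℕP.*-mono-≤ (ℕP.≤-trans k≤ r≤) tR≤) (ℕP.≤-reflexive (sym (ℕP.*-assoc ξ (4 ^ ξ) (C * h))))) (comb-bnd {t = t} fits bx)

  reach≤κ₀ : reach ≤ κ₀
  reach≤κ₀ = ℕP.≤-trans (ℕP.m≤m+n reach reach) (ℕP.m≤n+m _ 3)

  values : ∃ λ zs → ∀ x → dot e (comb ws x) ≡ pos h ℤ.* dot zs x
  values = comb-values e (pos h) ws (VAll.map (λ { (l , n≤) → value l n≤ }) (VAll.zip (ws∈Λ , fits-norm Ns≥1 fits)))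
    where
    bound-w : ∀ {u : Vec ℤ r} → ‖ u ‖ ≤ 4 ^ r * R → Bnd (4 ^ ξ * (C * h)) u
    bound-w {u} n≤ = bnd-mono (ℕP.≤-trans n≤ (ℕP.≤-trans (ℕP.m≤n*m (4 ^ r * R) t) tR≤)) (bnd-norm u)
    widen : ∀ {n} {u : Vec ℤ n} → n ≤ ξ → Bnd (4 ^ ξ * (C * h)) u → Bnd (κ₀ * C * h) u
    -- The estimate through `reach` needs `ξ` nonzero, which any coordinate guarantees; without
    -- coordinates the bound is empty.
    widen {u = Vec.[]}    _   _ = VAll.[]
    widen {u = _ Vec.∷ _} n≤ b = within′ b
      where
      within′ : ∀ {n} {u : Vec ℤ n} → Bnd (4 ^ ξ * (C * h)) u → Bnd (κ₀ * C * h) u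
      within′ b = bnd-mono (ℕP.≤-trans (ℕP.*-monoˡ-≤ (C * h) (ℕP.≤-trans (ℕP.m≤n*m (4 ^ ξ) ξ ⦃ ℕ.>-nonZero (ℕP.≤-trans (s≤s z≤n) n≤) ⦄) reach≤κ₀))
        (ℕP.≤-reflexive (sym (ℕP.*-assoc κ₀ C h)))) b
    value : ∀ {u} → Λ u → ‖ u ‖ ≤ 4 ^ r * R → ∃ λ z → dot e u ≡ pos h ℤ.* z
    value {u} l n≤ = let z , _ , eq = Λ-elem l (widen r≤ (bound-w n≤)) in z , eq

  sumGap : SumGap S ξ t (length E)
  sumGap = record
    { rank = k ; rank≤ = ℕP.≤-trans k≤ r≤ ; zs = proj₁ values ; Ns = Ns
    ; size≤ = subst (_≤ 2 ^ ξ * prodV Ns) (proj₁ (proj₂ points)) (ℕP.≤-trans count≤ (ℕP.*-monoˡ-≤ (prodV Ns) (ℕP.^-monoʳ-≤ 2 r≤)))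
    ; contained = λ {x} bx → let z , s , eq = Λ-elem (Λ-comb ws∈Λ (posV x)) (within reach≤κ₀ (point-bnd bx)) in
        subst₂ (Sums (_∈ S)) refl (cancel-h (trans (sym eq) (proj₂ values (posV x))))
          (sums-≤ 0∈S scale (sums-join (sums-map S'-sums s)))
    ; injective = λ {x} {y} bx by eq → posV-injective (diff≡0 _ _ (indep _ (trans (comb-minus ws (posV x) (posV y))
        (Λ-inj (Λ-minus (Λ-comb ws∈Λ (posV x)) (Λ-comb ws∈Λ (posV y)))
          (within {reach + reach} (ℕP.m≤n+m _ 3) (subst (λ q → Bnd q (comb ws (posV x) ⊕ ⊖ comb ws (posV y))) (sym (ℕP.*-distribʳ-+ (C * h) reach reach)) (bnd-⊕ (point-bnd bx) (bnd-⊖ (point-bnd by)))))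
          (trans (dot-⊕ e _ _) (trans (cong₂ ℤ._+_ (proj₂ values (posV x)) (trans (dot-⊖ e _) (cong ℤ.-_ (proj₂ values (posV y)))))
            (trans (cong (λ w → pos h ℤ.* w ℤ.- pos h ℤ.* dot (proj₁ values) (posV y)) eq) (ℤP.+-inverseʳ (pos h ℤ.* dot (proj₁ values) (posV y))))))))))
    }
    where
    scale : Lmax * (1 + ξ * (t * 2)) ≤ GapConstants.L ξ * t
    scale = subst (λ L → Lmax * (1 + ξ * (t * 2)) ≤ L * t) (sym (GapConstants.L-unfold ξ)) (ℕP.≤-trans (ℕP.*-monoʳ-≤ Lmax (ℕP.+-monoˡ-≤ (ξ * (t * 2)) t≥1)) (ℕP.≤-reflexive (lem Lmax t ξ)))
      where
      lem : ∀ a t x → a * (t + x * (t * 2)) ≡ a * (1 + x * 2) * t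
      lem = ring-ℕ

sumGap-of-covering : ∀ {S ξ} → ℤ.0ℤ ∈ S → (∀ {x} → x ∈ S → ℤ.- x ∈ S) →
  (∃ λ (X : Vec ℤ ξ) → VAll.All (_∈ S) X
    × (∀ {s s'} → s ∈ S → s' ∈ S → ∃₂ λ s'' a → s'' ∈ S × Bnd 2 a × s ℤ.+ s' ≡ s'' ℤ.+ dot X a)) →
  ∀ {E} → Unique E → E ⊑ S → ∀ t → 1 ≤ t → SumGap S ξ t (length E)
sumGap-of-covering {S} {ξ} 0∈S S-neg (X , X⊆S , cover) {E} uE E⊑S t t≥1 =
  BuildGap.sumGap S 0∈S S-neg ξ X X⊆S cover E uE E⊑S t t≥1

-- Robust scales

^-mono : ∀ {a b} n → a ≤ b → a ^ n ≤ b ^ n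
^-mono n h = ℕP.^-monoˡ-≤ n h

^-distrib-* : ∀ a b n → (a * b) ^ n ≡ a ^ n * b ^ n
^-distrib-* a b zero    = refl
^-distrib-* a b (suc n) = trans (cong (a * b *_) (^-distrib-* a b n)) (lem a b (a ^ n) (b ^ n))
  where
  lem : ∀ a b x y → a * b * (x * y) ≡ a * x * (b * y)
  lem = ring-ℕ

4^≡ : ∀ i → 4 ^ i ≡ 2 ^ i * 2 ^ i
4^≡ i = ^-distrib-* 2 2 i

n<2^n : ∀ n → n < 2 ^ n
n<2^n zero    = s≤s z≤n
n<2^n (suc n) = ℕP.≤-trans (ℕP.+-mono-≤ (ℕP.m^n>0 2 n) (n<2^n n)) (ℕP.≤-reflexive (cong (λ k → 2 ^ n + k) (sym (ℕP.+-identityʳ (2 ^ n)))))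

-- Maximises the ratio of `f` to `w`, compared by cross multiplication.
argmax : ∀ (f w : ℕ → ℕ) → (∀ i → 1 ≤ w i) → ∀ I → ∃ λ i → ∀ i' → i' ≤ I → f i' * w i ≤ f i * w i'
argmax f w w≥1 zero = 0 , λ { .0 z≤n → ℕP.≤-refl }
argmax f w w≥1 (suc I) with argmax f w w≥1 I
... | i , best with f (suc I) * w i ≤? f i * w (suc I)
...   | yes h = i , λ i' i'≤ → case ℕP.m≤n⇒m<n∨m≡n i'≤ of λ { (inj₁ lt) → best i' (ℕP.<⇒≤pred lt) ; (inj₂ refl) → h }
...   | no ¬h = suc I , λ i' i'≤ → case ℕP.m≤n⇒m<n∨m≡n i'≤ of λ
  { (inj₁ lt) → trans-ratio i' (best i' (ℕP.<⇒≤pred lt)) ; (inj₂ refl) → ℕP.≤-refl }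
  where
  l₁ : ∀ a b c → a * b * c ≡ a * c * b
  l₁ = ring-ℕ
  trans-ratio : ∀ i' → f i' * w i ≤ f i * w i' → f i' * w (suc I) ≤ f (suc I) * w i'
  trans-ratio i' h = ℕP.*-cancelʳ-≤ _ _ (w i) ⦃ ℕ.>-nonZero (w≥1 i) ⦄ (begin
    f i' * w (suc I) * w i  ≡⟨ l₁ (f i') (w (suc I)) (w i) ⟩
    f i' * w i * w (suc I)  ≤⟨ ℕP.*-monoˡ-≤ (w (suc I)) h ⟩
    f i * w i' * w (suc I)  ≡⟨ l₁ (f i) (w i') (w (suc I)) ⟩
    f i * w (suc I) * w i'  ≤⟨ ℕP.*-monoˡ-≤ (w i') (ℕP.<⇒≤ (ℕP.≰⇒> ¬h)) ⟩
    f (suc I) * w i * w i'  ≡⟨ l₁ (f (suc I)) (w i) (w i') ⟩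
    f (suc I) * w i' * w i  ∎)
    where open ℕP.≤-Reasoning

last-true : ∀ {P : ℕ → Set} → (∀ u → Dec (P u)) → P 0 → ∀ N → (∃ λ u → u < N × P u × ¬ P (suc u)) ⊎ P N
last-true P? p0 zero = inj₂ p0
last-true P? p0 (suc N) with last-true P? p0 N
... | inj₁ (u , u< , p , q) = inj₁ (u , ℕP.m≤n⇒m≤1+n u< , p , q)
... | inj₂ p with P? (suc N)
...   | yes q = inj₂ q
...   | no ¬q = inj₁ (N , ℕP.≤-refl , p , ¬q)

dyadic : ∀ M → 1 ≤ M → ∀ l → M ≤ l → ∃ λ Λ → 2 ^ Λ * M ≤ l × l < 2 ^ suc Λ * M
dyadic M M≥1 l M≤l with last-true (λ u → 2 ^ u * M ≤? l) (subst (_≤ l) (sym (ℕP.*-identityˡ M)) M≤l) l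
... | inj₁ (u , _ , p , q) = u , p , ℕP.≰⇒> q
... | inj₂ p = ⊥-elim (ℕP.<⇒≱ (n<2^n l) (ℕP.≤-trans (ℕP.m≤m*n (2 ^ l) M ⦃ ℕ.>-nonZero M≥1 ⦄) p))

∑-++ : ∀ (f : 𝔸 → ℕ) xs ys → ∑ f (xs ++ ys) ≡ ∑ f xs + ∑ f ys
∑-++ f []       ys = refl
∑-++ f (x ∷ xs) ys = trans (cong (f x +_) (∑-++ f xs ys)) (sym (ℕP.+-assoc (f x) _ _))

∑-map : ∀ (f : 𝔹 → ℕ) (g : 𝔸 → 𝔹) xs → ∑ f (map g xs) ≡ ∑ (f ∘ g) xs
∑-map f g []       = refl
∑-map f g (x ∷ xs) = cong (f (g x) +_) (∑-map f g xs)

rep-length : ∀ {j A B} → Rep j A B → j ≤ length A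
rep-length (u , a , refl) = length-⊆ u (All.lookup a)

V-empty : ∀ j A → length A < j → length (V j A) ≡ 0
V-empty j A h with V j A in eq
... | []    = refl
... | x ∷ _ = let B , r , _ = ∈-V⁻ {j} {A} (subst (x ∈_) (sym eq) (here refl)) in ⊥-elim (ℕP.<⇒≱ h (rep-length r))

length≤V₁ : ∀ A → Unique A → length A ≤ length (V 1 A)
length≤V₁ A u = length-⊆ u (λ {a} a∈ → subst (_∈ V 1 A) (ℕP.+-identityʳ a) (∈-V⁺ {1} ([] ∷ [] , a∈ ∷ [] , refl)))

-- A dense part of A and a scale j = 2ⁱ with controlled growth which loses only a
-- constant factor when any 2ᵛ elements are deleted.
record RobustScale (d K Λ : ℕ) (A : List ℕ) : Set where
  field
    A₁       : List ℕ
    A₁-unique : Unique A₁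
    A₁⊑A     : A₁ ⊑ A
    i v      : ℕ
    v≤Λ      : v ≤ Λ
    room     : K * 4 ^ i ≤ 2 ^ v
    half     : length A ≤ 2 * length A₁
    A₁≤V     : length A₁ ≤ length (V (2 ^ i) A₁)
    growth   : ∀ k → length (V (2 ^ (k + i)) A₁) ≤ 2 ^ (k * suc (suc d + suc d)) * length (V (2 ^ i) A₁)
    robust   : ∀ Z → length Z ≤ 2 ^ v → length (V (2 ^ i) A₁) ≤ 2 ^ suc d * length (V (2 ^ i) (A₁ ∖ Z))
    large    : length A * (4 ^ i * 2 ^ Λ) ^ suc d ≤ 2 * (length (V (2 ^ i) A₁) * (2 ^ v) ^ suc d)

module Scale (d K C : ℕ) (K≥2 : 2 ≤ K) (C≥5 : 5 ≤ C) (C≥ : 4 * (2 * (8 * suc d) * K) ^ suc d < C)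
  (n l : ℕ) (n≥1 : 1 ≤ n) (l≥1 : 1 ≤ l) (A : List ℕ) (uA : Unique A) (A≤n : ∀ {a} → a ∈ A → a ≤ n)
  (l≤A : l ≤ length A) (dense : C * n ≤ l ^ d * length A)
  (Λ : ℕ) (lo : 2 ^ Λ * (8 * suc d) ≤ l) (hi : l < 2 ^ suc Λ * (8 * suc d)) where

  private
    e = suc d
    D = suc (e + e)
    M = 8 * e
    m = length A
    L = 2 ^ Λ

  -- With the budget `ρ = 2 ^ (Λ ∸ u)` and denominators cleared, this reads
  -- `m L^e ≤ 2 V (ρ / 4^i)^e`: the volume count for rank `e = d + 1`, where `L` replaces `l` up to
  -- a constant factor.
  alive : ℕ × ℕ → List ℕ → Set
  alive (i , u) A' = m * (4 ^ i * L) ^ e ≤ 2 * (length (V (2 ^ i) A') * (2 ^ (Λ ∸ u)) ^ e)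

  alive? : ∀ p A' → Dec (alive p A')
  alive? (i , u) A' = _ ≤? _

  alive-mono : ∀ p {A' A''} → A'' ⊑ A' → alive p A'' → alive p A'
  alive-mono (i , u) {A'} {A''} sub h = ℕP.≤-trans h (ℕP.*-monoʳ-≤ 2 (ℕP.*-monoˡ-≤ ((2 ^ (Λ ∸ u)) ^ e) (V-mono (2 ^ i) {A''} {A'} sub)))

  cost : ℕ × ℕ → ℕ
  cost (i , u) = 2 ^ (Λ ∸ u)

  -- Only pairs with `i < (u + 1) e` are listed, since by `i-small` no other pair can be a last
  -- alive level at the chosen scale. This keeps the total cost at most `4eL`, and `M = 8e` makes
  -- twice that at most `l`, so half of the set survives.
  rows : ℕ → List (ℕ × ℕ)
  rows zero    = []
  rows (suc k) = map (_, k) (upTo (suc k * e)) ++ rows k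

  ∈-rows : ∀ {i u} k → u < k → i < suc u * e → (i , u) ∈ rows k
  ∈-rows {i} {u} (suc k) (s≤s u≤) i< with ℕP.m≤n⇒m<n∨m≡n u≤
  ... | inj₁ u<   = ∈-++⁺ʳ (map (_, k) (upTo (suc k * e))) (∈-rows k u< i<)
  ... | inj₂ refl = ∈-++⁺ˡ (∈-map⁺ (_, k) (∈-upTo⁺ i<))

  -- ∑_{u<k} (u+1) 2^(Λ-u) telescopes against (k+2) 2^(Λ+1-k).
  rows-cost : ∀ k → k ≤ suc Λ → ∑ cost (rows k) + (2 + k) * e * 2 ^ (suc Λ ∸ k) ≡ 4 * e * L
  rows-cost zero    _ = lem e L
    where
    lem : ∀ a b → 2 * a * (2 * b) ≡ 4 * a * b
    lem = ring-ℕ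
  rows-cost (suc k) (s≤s k≤) = begin
      ∑ cost (map (_, k) (upTo (suc k * e)) ++ rows k) + (3 + k) * e * p
        ≡⟨ cong (_+ (3 + k) * e * p) (trans (∑-++ cost (map (_, k) (upTo (suc k * e))) (rows k)) (cong (_+ ∑ cost (rows k)) row)) ⟩
      suc k * e * p + ∑ cost (rows k) + (3 + k) * e * p  ≡⟨ lem k e p (∑ cost (rows k)) ⟩
      ∑ cost (rows k) + (2 + k) * e * (2 * p)  ≡⟨ cong (λ q → ∑ cost (rows k) + (2 + k) * e * 2 ^ q) (ℕP.+-∸-assoc 1 k≤) ⟨
      ∑ cost (rows k) + (2 + k) * e * 2 ^ (suc Λ ∸ k)  ≡⟨ rows-cost k (ℕP.m≤n⇒m≤1+n k≤) ⟩
      4 * e * L  ∎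
    where
    open ≡-Reasoning
    p = 2 ^ (Λ ∸ k)
    row : ∑ cost (map (_, k) (upTo (suc k * e))) ≡ suc k * e * p
    row = trans (∑-map cost (_, k) (upTo (suc k * e))) (trans (∑-const p (upTo (suc k * e))) (cong (_* p) (ListP.length-upTo (suc k * e))))
    lem : ∀ k e p s → suc k * e * p + s + (3 + k) * e * p ≡ s + (2 + k) * e * (2 * p)
    lem = ring-ℕ

  open Stabilise alive alive? alive-mono cost

  private
    abstract
      stable : ∃ (Stable (rows (suc Λ)) A)
      stable = stabilise (rows (suc Λ)) A uA

  A₁ : List ℕ
  A₁ = proj₁ stable

  A₁-unique : Unique A₁
  A₁-unique = proj₁ (proj₂ stable)

  A₁⊑A : A₁ ⊑ A
  A₁⊑A = proj₁ (proj₂ (proj₂ stable))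

  half : m ≤ 2 * length A₁
  half = ℕP.+-cancelʳ-≤ m _ _ (begin
    m + m  ≤⟨ ℕP.+-mono-≤ loss loss ⟩
    (a + s) + (a + s)  ≡⟨ l₁ a s ⟩
    2 * a + 2 * s  ≤⟨ ℕP.+-monoʳ-≤ (2 * a) (ℕP.*-monoʳ-≤ 2 s≤) ⟩
    2 * a + 2 * (4 * e * L)  ≡⟨ cong (2 * a +_) (l₂ e L) ⟩
    2 * a + L * M  ≤⟨ ℕP.+-monoʳ-≤ (2 * a) (ℕP.≤-trans lo l≤A) ⟩
    2 * a + m  ∎)
    where
    open ℕP.≤-Reasoning
    a = length A₁
    s = ∑ cost (rows (suc Λ))
    loss : m ≤ a + s
    loss = proj₁ (proj₂ (proj₂ (proj₂ stable)))
    s≤ : s ≤ 4 * e * L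
    s≤ = ℕP.≤-trans (ℕP.m≤m+n s _) (ℕP.≤-reflexive (rows-cost (suc Λ) ℕP.≤-refl))
    l₁ : ∀ a s → (a + s) + (a + s) ≡ 2 * a + 2 * s
    l₁ = ring-ℕ
    l₂ : ∀ e L → 2 * (4 * e * L) ≡ L * (8 * e)
    l₂ = ring-ℕ

  private
    size : ℕ → ℕ
    size i = length (V (2 ^ i) A₁)

    abstract
      best : ∃ λ i → ∀ i' → i' ≤ length A₁ → size i' * 2 ^ (i * D) ≤ size i * 2 ^ (i' * D)
      best = argmax size (λ i → 2 ^ (i * D)) (λ i → ℕP.m^n>0 2 (i * D)) (length A₁)

  i j v₀ : ℕ
  i  = proj₁ best
  j  = 2 ^ i
  v₀ = size i

  maximal : ∀ i' → size i' * 2 ^ (i * D) ≤ v₀ * 2 ^ (i' * D)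
  maximal i' with i' ≤? length A₁
  ... | yes h = proj₂ best i' h
  -- Scales beyond the searched range satisfy `2 ^ i' > length A₁` and have no sums at all.
  ... | no ¬h = subst (λ k → k * 2 ^ (i * D) ≤ v₀ * 2 ^ (i' * D)) (sym (V-empty (2 ^ i') A₁ (ℕP.<-trans (ℕP.≰⇒> ¬h) (n<2^n i')))) z≤n

  growth : ∀ k → size (k + i) ≤ 2 ^ (k * D) * v₀
  growth k = ℕP.*-cancelʳ-≤ _ _ (2 ^ (i * D)) ⦃ ℕP.m^n≢0 2 (i * D) ⦄ (ℕP.≤-trans (maximal (k + i)) (ℕP.≤-reflexive (begin
    v₀ * 2 ^ ((k + i) * D)  ≡⟨ cong (λ q → v₀ * 2 ^ q) (ℕP.*-distribʳ-+ D k i) ⟩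
    v₀ * 2 ^ (k * D + i * D)  ≡⟨ cong (v₀ *_) (ℕP.^-distribˡ-+-* 2 (k * D) (i * D)) ⟩
    v₀ * (2 ^ (k * D) * 2 ^ (i * D))  ≡⟨ lem v₀ (2 ^ (k * D)) (2 ^ (i * D)) ⟩
    2 ^ (k * D) * v₀ * 2 ^ (i * D)  ∎)))
    where
    open ≡-Reasoning
    lem : ∀ a b c → a * (b * c) ≡ b * a * c
    lem = ring-ℕ

  A₁-grown : length A₁ * 2 ^ (i * D) ≤ v₀
  A₁-grown = ℕP.≤-trans (ℕP.*-monoˡ-≤ (2 ^ (i * D)) (length≤V₁ A₁ A₁-unique)) (ℕP.≤-trans (maximal 0) (ℕP.≤-reflexive (ℕP.*-identityʳ v₀)))

  A₁≤V : length A₁ ≤ v₀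
  A₁≤V = ℕP.≤-trans (ℕP.m≤m*n (length A₁) (2 ^ (i * D)) ⦃ ℕP.m^n≢0 2 (i * D) ⦄) A₁-grown

  m-grown : m * 2 ^ (i * D) ≤ 2 * v₀
  m-grown = ℕP.≤-trans (ℕP.*-monoˡ-≤ (2 ^ (i * D)) half) (ℕP.≤-trans (ℕP.≤-reflexive (ℕP.*-assoc 2 (length A₁) _)) (ℕP.*-monoʳ-≤ 2 A₁-grown))

  -- The reason for `D = 2e + 1`: the factor `(4 ^ i) ^ e` is the one in `alive`, and one factor `j`
  -- is left over. It cancels against the range `j n` in `j<l` and pays for lost budget in
  -- `i-small`.
  2^iD : 2 ^ (i * D) ≡ (4 ^ i) ^ e * j
  2^iD = begin
    2 ^ (i * D)  ≡⟨ cong (2 ^_) (lem i e) ⟩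
    2 ^ (2 * i * e + i)  ≡⟨ ℕP.^-distribˡ-+-* 2 (2 * i * e) i ⟩
    2 ^ (2 * i * e) * j  ≡⟨ cong (_* j) (trans (sym (ℕP.^-*-assoc 2 (2 * i) e)) (cong (_^ e) (sym (ℕP.^-*-assoc 2 2 i)))) ⟩
    (4 ^ i) ^ e * j  ∎
    where
    open ≡-Reasoning
    lem : ∀ i e → i * suc (e + e) ≡ 2 * i * e + i
    lem = ring-ℕ

  j≥1 : 1 ≤ j
  j≥1 = ℕP.m^n>0 2 i

  v₀-range : v₀ ≤ 2 * (j * n)
  v₀-range = ℕP.≤-trans (V-range j (A≤n ∘ A₁⊑A)) (ℕP.≤-trans (ℕP.+-monoˡ-≤ (j * n) (ℕP.*-mono-≤ j≥1 n≥1)) (ℕP.≤-reflexive (cong (j * n +_) (sym (ℕP.+-identityʳ (j * n))))))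

  -- Maximality gives `m (4^i)^e j ≤ 2 v₀ ≤ 4 j n`, hence `m (4^i)^e ≤ 4 n`. If `l ≤ j`, then
  -- `l^d ≤ (4^i)^e`, and density would force `C ≤ 4`.
  j<l : j < l
  j<l = ℕP.≰⇒> λ l≤j → ℕP.<⇒≱ {4 * n} {C * n} (ℕP.*-monoˡ-< n ⦃ ℕ.>-nonZero n≥1 ⦄ C≥5) (begin
      C * n  ≤⟨ dense ⟩
      l ^ d * m  ≤⟨ ℕP.*-monoˡ-≤ m (ℕP.≤-trans (^-mono d l≤j) (ℕP.≤-trans (^-mono d j≤4^) (ℕP.^-monoʳ-≤ (4 ^ i) ⦃ ℕP.m^n≢0 4 i ⦄ (ℕP.n≤1+n d)))) ⟩
      (4 ^ i) ^ e * m  ≤⟨ ℕP.*-cancelʳ-≤ _ _ j ⦃ ℕ.>-nonZero j≥1 ⦄ cancelled ⟩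
      4 * n  ∎)
    where
    open ℕP.≤-Reasoning
    j≤4^ : j ≤ 4 ^ i
    j≤4^ = ^-mono i (s≤s (s≤s z≤n))
    l₁ : ∀ a b c → a * b * c ≡ b * (a * c)
    l₁ = ring-ℕ
    l₂ : ∀ a b → 2 * (2 * (a * b)) ≡ 4 * b * a
    l₂ = ring-ℕ
    cancelled : (4 ^ i) ^ e * m * j ≤ 4 * n * j
    cancelled = begin
      (4 ^ i) ^ e * m * j  ≡⟨ l₁ ((4 ^ i) ^ e) m j ⟩
      m * ((4 ^ i) ^ e * j)  ≡⟨ cong (m *_) 2^iD ⟨
      m * 2 ^ (i * D)  ≤⟨ m-grown ⟩
      2 * v₀  ≤⟨ ℕP.*-monoʳ-≤ 2 v₀-range ⟩
      2 * (2 * (j * n))  ≡⟨ l₂ j n ⟩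
      4 * n * j  ∎

  4^i^e≢0 : NonZero ((4 ^ i) ^ e)
  4^i^e≢0 = ℕP.m^n≢0 (4 ^ i) e ⦃ ℕP.m^n≢0 4 i ⦄

  -- With a budget below `K * 4 ^ i`, the powers of `4 ^ i` in `alive` cancel and leave
  -- `m L^e ≤ 4 j n K^e`. Against density this gives `C l ≤ c₀ j`, impossible since `j < l` and
  -- `c₀ < C`.
  room : ∀ u → alive (i , u) A₁ → K * 4 ^ i ≤ 2 ^ (Λ ∸ u)
  room u h = ℕP.≮⇒≥ λ small → ℕP.<⇒≱ C≥ (ℕP.<⇒≤ (ℕP.*-cancelʳ-< l C c₀ (begin-strict
      C * l  ≤⟨ Cl≤ small ⟩
      c₀ * j  <⟨ ℕP.*-monoʳ-< c₀ ⦃ c₀≢0 ⦄ j<l ⟩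
      c₀ * l  ∎)))
    where
    open ℕP.≤-Reasoning
    c₀ = 4 * (2 * M * K) ^ e
    c₀≢0 : NonZero c₀
    c₀≢0 = ℕP.m*n≢0 4 ((2 * M * K) ^ e) ⦃ _ ⦄ ⦃ ℕP.m^n≢0 (2 * M * K) e ⦃ ℕ.>-nonZero (ℕP.*-mono-≤ {1} {2 * M} (s≤s z≤n) (ℕP.≤-trans (s≤s z≤n) K≥2)) ⦄ ⦄
    l₁ : ∀ m x y z → m * (x * y) * z ≡ m * y * (x * z)
    l₁ = ring-ℕ
    module _ (small : 2 ^ (Λ ∸ u) < K * 4 ^ i) where
      ρ = 2 ^ (Λ ∸ u)
      step₁ : m * L ^ e ≤ 4 * (j * n) * K ^ e
      step₁ = ℕP.*-cancelʳ-≤ _ _ ((4 ^ i) ^ e) ⦃ 4^i^e≢0 ⦄ (begin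
        m * L ^ e * (4 ^ i) ^ e  ≡⟨ trans (ℕP.*-assoc m _ _) (cong (m *_) (trans (ℕP.*-comm (L ^ e) _) (sym (^-distrib-* (4 ^ i) L e)))) ⟩
        m * (4 ^ i * L) ^ e  ≤⟨ h ⟩
        2 * (v₀ * ρ ^ e)  ≤⟨ ℕP.*-monoʳ-≤ 2 (ℕP.*-mono-≤ v₀-range (^-mono e (ℕP.<⇒≤ small))) ⟩
        2 * (2 * (j * n) * (K * 4 ^ i) ^ e)  ≡⟨ cong (λ q → 2 * (2 * (j * n) * q)) (^-distrib-* K (4 ^ i) e) ⟩
        2 * (2 * (j * n) * (K ^ e * (4 ^ i) ^ e))  ≡⟨ l₂ (j * n) (K ^ e) ((4 ^ i) ^ e) ⟩
        4 * (j * n) * K ^ e * (4 ^ i) ^ e  ∎)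
        where
        l₂ : ∀ a b c → 2 * (2 * a * (b * c)) ≡ 4 * a * b * c
        l₂ = ring-ℕ
      l≤ : l ≤ 2 * M * L
      l≤ = ℕP.≤-trans (ℕP.<⇒≤ hi) (ℕP.≤-reflexive (l₂ L M))
        where
        l₂ : ∀ a b → 2 * a * b ≡ 2 * b * a
        l₂ = ring-ℕ
      Cl≤ : C * l ≤ c₀ * j
      Cl≤ = ℕP.*-cancelʳ-≤ _ _ n ⦃ ℕ.>-nonZero n≥1 ⦄ (begin
        C * l * n  ≡⟨ l₂ C l n ⟩
        l * (C * n)  ≤⟨ ℕP.*-monoʳ-≤ l dense ⟩
        l * (l ^ d * m)  ≡⟨ l₃ l (l ^ d) m ⟩
        m * l ^ e  ≤⟨ ℕP.*-monoʳ-≤ m (^-mono e l≤) ⟩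
        m * (2 * M * L) ^ e  ≡⟨ cong (m *_) (^-distrib-* (2 * M) L e) ⟩
        m * ((2 * M) ^ e * L ^ e)  ≡⟨ l₄ m ((2 * M) ^ e) (L ^ e) ⟩
        (2 * M) ^ e * (m * L ^ e)  ≤⟨ ℕP.*-monoʳ-≤ ((2 * M) ^ e) step₁ ⟩
        (2 * M) ^ e * (4 * (j * n) * K ^ e)  ≡⟨ l₅ ((2 * M) ^ e) j n (K ^ e) ⟩
        4 * ((2 * M) ^ e * K ^ e) * j * n  ≡⟨ cong (λ q → 4 * q * j * n) (^-distrib-* (2 * M) K e) ⟨
        c₀ * j * n  ∎)
        where
        l₂ : ∀ a b c → a * b * c ≡ b * (a * c)
        l₂ = ring-ℕ
        l₃ : ∀ a b c → a * (b * c) ≡ c * (a * b)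
        l₃ = ring-ℕ
        l₄ : ∀ a b c → a * (b * c) ≡ b * (a * c)
        l₄ = ring-ℕ
        l₅ : ∀ a b c d → a * (4 * (b * c) * d) ≡ 4 * (a * d) * b * c
        l₅ = ring-ℕ

  alive₀ : alive (i , 0) A₁
  alive₀ = begin
    m * (4 ^ i * L) ^ e  ≡⟨ trans (cong (m *_) (^-distrib-* (4 ^ i) L e)) (sym (ℕP.*-assoc m _ _)) ⟩
    m * (4 ^ i) ^ e * L ^ e  ≤⟨ ℕP.*-monoˡ-≤ (L ^ e) (ℕP.*-monoʳ-≤ m (ℕP.≤-trans (ℕP.m≤m*n _ j ⦃ ℕ.>-nonZero j≥1 ⦄) (ℕP.≤-reflexive (sym 2^iD)))) ⟩
    m * 2 ^ (i * D) * L ^ e  ≤⟨ ℕP.*-monoˡ-≤ (L ^ e) m-grown ⟩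
    2 * v₀ * L ^ e  ≡⟨ ℕP.*-assoc 2 v₀ _ ⟩
    2 * (v₀ * L ^ e)  ∎
    where open ℕP.≤-Reasoning

  m≥1 : 1 ≤ m
  m≥1 = ℕP.≤-trans l≥1 l≤A

  module Level (u : ℕ) (u<Λ : u < Λ) (al : alive (i , u) A₁) (dead : ¬ alive (i , suc u) A₁) where

    ρ' : ℕ
    ρ' = 2 ^ (Λ ∸ suc u)

    ρ≡ : 2 ^ (Λ ∸ u) ≡ 2 * ρ'
    ρ≡ = cong (2 ^_) (lem Λ u u<Λ)
      where
      lem : ∀ a b → b < a → a ∸ b ≡ suc (a ∸ suc b)
      lem (suc a) zero    _       = refl
      lem (suc a) (suc b) (s≤s h) = lem a b h

    L≡ : L ≡ 2 ^ suc u * ρ'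
    L≡ = trans (cong (2 ^_) (sym (ℕP.m+[n∸m]≡n u<Λ))) (ℕP.^-distribˡ-+-* 2 (suc u) (Λ ∸ suc u))

    -- For larger `i` the spare factor `j` exceeds `(2 ^ (u + 1)) ^ e`, the whole loss of budget
    -- down to level `u + 1`, so that level would still be alive.
    i-small : i < suc u * e
    i-small = ℕP.≰⇒> λ ue≤i → ℕP.<⇒≱ (ℕP.≰⇒> dead) (begin
        m * (4 ^ i * L) ^ e  ≡⟨ cong (λ q → m * (4 ^ i * q) ^ e) L≡ ⟩
        m * (4 ^ i * (2 ^ suc u * ρ')) ^ e  ≡⟨ cong (m *_) (trans (^-distrib-* (4 ^ i) _ e) (cong ((4 ^ i) ^ e *_) (^-distrib-* (2 ^ suc u) ρ' e))) ⟩
        m * ((4 ^ i) ^ e * ((2 ^ suc u) ^ e * ρ' ^ e))  ≤⟨ ℕP.*-monoʳ-≤ m (ℕP.*-monoʳ-≤ ((4 ^ i) ^ e) (ℕP.*-monoˡ-≤ (ρ' ^ e) (pow ue≤i))) ⟩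
        m * ((4 ^ i) ^ e * (j * ρ' ^ e))  ≡⟨ l₁ m ((4 ^ i) ^ e) j (ρ' ^ e) ⟩
        m * ((4 ^ i) ^ e * j) * ρ' ^ e  ≡⟨ cong (λ q → m * q * ρ' ^ e) 2^iD ⟨
        m * 2 ^ (i * D) * ρ' ^ e  ≤⟨ ℕP.*-monoˡ-≤ (ρ' ^ e) m-grown ⟩
        2 * v₀ * ρ' ^ e  ≡⟨ ℕP.*-assoc 2 v₀ _ ⟩
        2 * (v₀ * ρ' ^ e)  ∎)
      where
      open ℕP.≤-Reasoning
      l₁ : ∀ a b c d → a * (b * (c * d)) ≡ a * (b * c) * d
      l₁ = ring-ℕ
      pow : suc u * e ≤ i → (2 ^ suc u) ^ e ≤ j
      pow h = ℕP.≤-trans (ℕP.≤-reflexive (ℕP.^-*-assoc 2 (suc u) e)) (ℕP.^-monoʳ-≤ 2 h)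

    -- Stability keeps level `u` alive after deleting `Z`, while the failure of level `u + 1` bounds
    -- `v₀` by the same quantity. The two budgets differ by a factor 2, raised to the power `e`.
    robust : ∀ Z → length Z ≤ 2 ^ (Λ ∸ u) → v₀ ≤ 2 ^ e * length (V j (A₁ ∖ Z))
    robust Z h = ℕP.<⇒≤ (ℕP.*-cancelʳ-< (2 * ρ' ^ e) _ _ (begin-strict
        v₀ * (2 * ρ' ^ e)  ≡⟨ l₁ v₀ (ρ' ^ e) ⟩
        2 * (v₀ * ρ' ^ e)  <⟨ ℕP.≰⇒> dead ⟩
        m * (4 ^ i * L) ^ e  ≤⟨ rob Z h ⟩
        2 * (vz * (2 ^ (Λ ∸ u)) ^ e)  ≡⟨ cong (λ q → 2 * (vz * q)) (trans (cong (_^ e) ρ≡) (^-distrib-* 2 ρ' e)) ⟩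
        2 * (vz * (2 ^ e * ρ' ^ e))  ≡⟨ l₂ vz (2 ^ e) (ρ' ^ e) ⟩
        2 ^ e * vz * (2 * ρ' ^ e)  ∎))
      where
      open ℕP.≤-Reasoning
      vz = length (V j (A₁ ∖ Z))
      rob : Robust (i , u) A₁
      rob = proj₂ (proj₂ (proj₂ (proj₂ stable))) (∈-rows (suc Λ) (ℕP.m≤n⇒m≤1+n u<Λ) i-small) al
      l₁ : ∀ a b → a * (2 * b) ≡ 2 * (a * b)
      l₁ = ring-ℕ
      l₂ : ∀ a b c → 2 * (a * (b * c)) ≡ b * a * (2 * c)
      l₂ = ring-ℕ

  robustScale : RobustScale d K Λ A
  robustScale = atLevel (last-true (λ u → alive? (i , u) A₁) alive₀ Λ)
    where
    atLevel : (∃ λ u → u < Λ × alive (i , u) A₁ × ¬ alive (i , suc u) A₁) ⊎ alive (i , Λ) A₁ → RobustScale d K Λ A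
    -- At level `Λ` the budget is 1, which leaves no room.
    atLevel (inj₂ al) = ⊥-elim (ℕP.<⇒≱ {1} {K * 4 ^ i} (ℕP.*-mono-≤ K≥2 (ℕP.m^n>0 4 i))
      (ℕP.≤-trans (room Λ al) (ℕP.≤-reflexive (cong (2 ^_) (ℕP.n∸n≡0 Λ)))))
    atLevel (inj₁ (u , u< , al , dead)) = record
      { A₁ = A₁ ; A₁-unique = A₁-unique ; A₁⊑A = A₁⊑A ; i = i ; v = Λ ∸ u ; v≤Λ = ℕP.m∸n≤m Λ u ; room = room u al
      ; half = half ; A₁≤V = A₁≤V ; growth = growth ; robust = Level.robust u u< al dead ; large = al }

-- Progressions in sums of distinct elements

record DistinctGap (A : List ℕ) (ξ t size terms : ℕ) : Set where
  field
    rank      : ℕ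
    rank≤     : rank ≤ ξ
    zs        : Vec ℤ rank
    Ns        : Vec ℕ rank
    shift     : ℤ
    size≤     : size ≤ 2 ^ ξ * prodV Ns
    represent : ∀ {x} → Below x (Vec.map (t *_) Ns) → ∃ λ B → Rep terms A B × dot zs (posV x) ℤ.+ shift ≡ pos (sum B)
    injective : ∀ {x y} → Below x (Vec.map (t *_) Ns) → Below y (Vec.map (t *_) Ns) →
      dot zs (posV x) ≡ dot zs (posV y) → x ≡ y

module Combine (A : List ℕ) (uA : Unique A) (j ρ Q E γ₁ γ₄ : ℕ) (E≥1 : 1 ≤ E) (γ₁≥1 : 1 ≤ γ₁)
  (V≥1 : 1 ≤ length (V j A)) (Q≥1 : 1 ≤ Q) (2Q≤V : 2 * Q ≤ 2 * length (V j A)) (jQ≤ρ : 2 * (j * Q) ≤ ρ)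
  (rob : ∀ Z → length Z ≤ ρ → length (V j A) ≤ E * length (V j (A ∖ Z)))
  (grow₁ : length (V (j + j) A) ≤ γ₁ * length (V j A)) (grow₄ : length (V (8 * (j + j)) A) ≤ γ₄ * length (V j A))
  (wide : 2 * (j * E) ≤ Q) (eight : 2 * (4 * (γ₁ * E) * E) * (8 * (j + j)) < Q) where

  private instance
    Q≢0 : NonZero Q
    Q≢0 = ℕ.>-nonZero Q≥1

  v cap g W : ℕ
  v   = length (V j A)
  cap = v ℕDM./ Q
  g   = γ₁ * E
  W   = 2 * (4 * g * E)

  cap*Q≤ : cap * Q ≤ v
  cap*Q≤ = ℕDM.m/n*n≤m v Q

  cap≥1 : 1 ≤ cap
  cap≥1 = ℕDM.m≥n⇒m/n>0 (ℕP.*-cancelˡ-≤ 2 2Q≤V)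

  v<2capQ : v < 2 * (cap * Q)
  v<2capQ = begin-strict
    v  ≡⟨ ℕDM.m≡m%n+[m/n]*n v Q ⟩
    v ℕDM.% Q + cap * Q  <⟨ ℕP.+-monoˡ-< (cap * Q) (ℕDM.m%n<n v Q) ⟩
    Q + cap * Q  ≤⟨ ℕP.+-monoˡ-≤ (cap * Q) (ℕP.m≤n*m Q cap ⦃ ℕ.>-nonZero cap≥1 ⦄) ⟩
    cap * Q + cap * Q  ≡⟨ cong (cap * Q +_) (ℕP.+-identityʳ (cap * Q)) ⟨
    2 * (cap * Q)  ∎
    where open ℕP.≤-Reasoning

  module S₀ = Spread A uA j cap
  open S₀ using (F)

  V≤F : v ≤ E * length F
  V≤F = S₀.V≤F {ρ} {E} rob (begin-strict
    j * v  ≤⟨ ℕP.*-monoʳ-≤ j (ℕP.<⇒≤ v<2capQ) ⟩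
    j * (2 * (cap * Q))  ≡⟨ lem j cap Q ⟩
    2 * (j * Q) * cap  ≤⟨ ℕP.*-monoˡ-≤ cap jQ≤ρ ⟩
    ρ * cap  <⟨ ℕP.*-monoˡ-< cap ⦃ ℕ.>-nonZero cap≥1 ⦄ (ℕP.n<1+n ρ) ⟩
    suc ρ * cap  ∎)
    where
    open ℕP.≤-Reasoning
    lem : ∀ a b c → a * (2 * (b * c)) ≡ 2 * (a * c) * b
    lem = ring-ℕ

  F≥1 : 1 ≤ length F
  F≥1 with length F in eq
  ... | suc _ = s≤s z≤n
  ... | zero  = ⊥-elim (ℕP.<⇒≱ V≥1 (ℕP.≤-trans V≤F (ℕP.≤-reflexive (trans (cong (E *_) eq) (ℕP.*-zeroʳ E)))))

  spread : 2 * (j * cap) ≤ length F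
  spread = ℕP.*-cancelˡ-≤ E ⦃ ℕ.>-nonZero E≥1 ⦄ (begin
    E * (2 * (j * cap))  ≡⟨ lem E j cap ⟩
    cap * (2 * (j * E))  ≤⟨ ℕP.*-monoʳ-≤ cap wide ⟩
    cap * Q  ≤⟨ cap*Q≤ ⟩
    v  ≤⟨ V≤F ⟩
    E * length F  ∎)
    where
    open ℕP.≤-Reasoning
    lem : ∀ a b c → a * (2 * (b * c)) ≡ c * (2 * (b * a))
    lem = ring-ℕ

  T≤ : length S₀.T ≤ g * length F
  T≤ = ℕP.≤-trans grow₁ (ℕP.≤-trans (ℕP.*-monoʳ-≤ γ₁ V≤F) (ℕP.≤-reflexive (sym (ℕP.*-assoc γ₁ E _))))

  module P = S₀.Popular g (ℕP.*-mono-≤ γ₁≥1 E≥1) F≥1 T≤ spread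
  abstract
    R : List ℕ
    R = P.R

    R-unique : Unique R
    R-unique = P.R-unique

    F≤R : length F ≤ 4 * length R
    F≤R = P.F≤R

    avoid : ∀ {z} → z ∈ R → ∀ Z → W * length Z < Q → z ∈ V (j + j) (A ∖ Z)
    avoid z∈ Z small = P.R-robust z∈ Z (ℕP.*-cancelʳ-< Q _ _ (begin-strict
      4 * g * (2 * (length Z * cap)) * Q  ≡⟨ l₁ g (length Z) cap Q ⟩
      8 * g * length Z * (cap * Q)  ≤⟨ ℕP.*-monoʳ-≤ (8 * g * length Z) (ℕP.≤-trans cap*Q≤ V≤F) ⟩
      8 * g * length Z * (E * length F)  ≡⟨ l₂ g (length Z) E (length F) ⟩
      length F * (W * length Z)  <⟨ ℕP.*-monoʳ-< (length F) ⦃ ℕ.>-nonZero F≥1 ⦄ small ⟩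
      length F * Q  ∎))
      where
      open ℕP.≤-Reasoning
      l₁ : ∀ g z c q → 4 * g * (2 * (z * c)) * q ≡ 8 * g * z * (c * q)
      l₁ = ring-ℕ
      l₂ : ∀ g z e f → 8 * g * z * (e * f) ≡ f * (2 * (4 * g * e) * z)
      l₂ = ring-ℕ

  Rℤ : List ℤ
  Rℤ = map pos R

  distinct-sums : ∀ {k z} → Sums (_∈ Rℤ) k z → W * (k * (j + j)) < Q → ∃ λ B → Rep (k * (j + j)) A B × z ≡ pos (sum B)
  distinct-sums nil _ = [] , ([] , [] , refl) , refl
  distinct-sums {suc k} (more x∈ s) small with distinct-sums s (ℕP.≤-<-trans (ℕP.*-monoʳ-≤ W (ℕP.m≤n+m (k * (j + j)) (j + j))) small) | ∈-map⁻ pos x∈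
  ... | B' , (u' , a' , l') , refl | x , x∈R , refl
    with ∈-V⁻ {j + j} {A ∖ B'} (avoid x∈R B' (ℕP.≤-<-trans (ℕP.*-monoʳ-≤ W (subst (_≤ suc k * (j + j)) (sym l') (ℕP.m≤n+m (k * (j + j)) (j + j)))) small))
  ... | B , (u , a , l) , refl = B ++ B'
    , (UniqueP.++⁺ u u' (λ (p , q) → proj₂ (∖⁻ {A} {B'} (All.lookup a p)) q) , AllP.++⁺ (All.map (∖-⊑ B') a) a'
      , trans (ListP.length-++ B) (cong₂ _+_ l l'))
    , trans (sym (ℤP.pos-+ (sum B) (sum B'))) (cong pos (sym (SumP.sum-++ B B')))

  G ξ : ℕ
  G = γ₄ * (4 * E)
  ξ = 2 * (G * G)

  v≤R : v ≤ 4 * E * length Rℤ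
  v≤R = begin
    v  ≤⟨ V≤F ⟩
    E * length F  ≤⟨ ℕP.*-monoʳ-≤ E F≤R ⟩
    E * (4 * length R)  ≡⟨ lem E (length R) ⟩
    4 * E * length R  ≡⟨ cong (4 * E *_) (ListP.length-map pos R) ⟨
    4 * E * length Rℤ  ∎
    where
    open ℕP.≤-Reasoning
    lem : ∀ a b → a * (4 * b) ≡ 4 * a * b
    lem = ring-ℕ

  private
    inhabited : ∃ (_∈ Rℤ)
    inhabited with Rℤ in eq
    ... | x ∷ _ = x , here refl
    ... | []    = ⊥-elim (ℕP.<⇒≱ V≥1 (ℕP.≤-trans v≤R (ℕP.≤-reflexive (trans (cong (λ xs → 4 * E * length xs) eq) (ℕP.*-zeroʳ (4 * E))))))

  r₀ : ℤ
  r₀ = proj₁ inhabited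

  r₀∈ : r₀ ∈ Rℤ
  r₀∈ = proj₂ inhabited

  t₀ : ℤ
  t₀ = r₀ ℤ.+ (r₀ ℤ.+ (r₀ ℤ.+ ℤ.0ℤ))

  T₅ : List ℤ
  T₅ = map (λ s → pos s ℤ.- t₀) (V (8 * (j + j)) A)

  -- Three fixed summands complete five to eight: eight robust elements use `16 j` elements of `A`,
  -- and growth is controlled only when the scale `j` is multiplied by a power of two.
  five : ∀ {z} → Sums (_∈ Rℤ) 5 z → z ∈ T₅
  five {z} s with distinct-sums (sums-+ s (more r₀∈ (more r₀∈ (more r₀∈ nil)))) eight
  ... | B , r , eq = subst (_∈ T₅) (trans (cong (ℤ._- t₀) (sym eq)) (lem z t₀)) (∈-map⁺ (λ s → pos s ℤ.- t₀) (∈-V⁺ {8 * (j + j)} r))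
    where
    lem : ∀ z t → z ℤ.+ t ℤ.- t ≡ z
    lem = ring-ℤ

  T₅≤ : length T₅ ≤ G * length Rℤ
  T₅≤ = begin
    length T₅  ≡⟨ ListP.length-map _ (V (8 * (j + j)) A) ⟩
    length (V (8 * (j + j)) A)  ≤⟨ grow₄ ⟩
    γ₄ * v  ≤⟨ ℕP.*-monoʳ-≤ γ₄ v≤R ⟩
    γ₄ * (4 * E * length Rℤ)  ≡⟨ ℕP.*-assoc γ₄ (4 * E) _ ⟨
    G * length Rℤ  ∎
    where open ℕP.≤-Reasoning

  module Cov = Covering Rℤ (UniqueP.map⁺ ℤP.+-injective R-unique) r₀ r₀∈ T₅ five G T₅≤
  open Cov using (S; σ)

  shifted-sums : ∀ {n z} → Sums (_∈ S) n z → Sums (_∈ Rℤ) (n * 2) (z ℤ.+ pos n ℤ.* σ)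
  shifted-sums nil = nil
  shifted-sums {suc n} (more {x = x} {z} x∈ s) = subst (Sums (_∈ Rℤ) (2 + n * 2))
    (trans (lem x z σ (pos n ℤ.* σ)) (cong (λ w → x ℤ.+ z ℤ.+ w) (sym (ℤP.suc-* (pos n) σ)))) (sums-+ (Cov.S-shift x∈) (shifted-sums s))
    where
    lem : ∀ x z s n → x ℤ.+ s ℤ.+ (z ℤ.+ n) ≡ x ℤ.+ z ℤ.+ (s ℤ.+ n)
    lem = ring-ℤ

  distinctGap : ∀ t → 1 ≤ t → W * (GapConstants.L ξ * t * 2 * (j + j)) < Q →
    DistinctGap A ξ t (length Cov.E) (GapConstants.L ξ * t * 2 * (j + j))
  distinctGap t t≥1 small = record
    { rank = rank ; rank≤ = rank≤ ; zs = zs ; Ns = Ns ; shift = pos (GapConstants.L ξ * t) ℤ.* σ ; size≤ = size≤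
    ; represent = λ bx → distinct-sums (shifted-sums (contained bx)) small ; injective = injective }
    where
    gap : SumGap S ξ t (length Cov.E)
    gap = sumGap-of-covering Cov.0∈S Cov.S-neg Cov.covering Cov.E-unique Cov.E⊑S t t≥1
    open SumGap gap

  v≤E : v ≤ 4 * E * (G * length Cov.E)
  v≤E = ℕP.≤-trans v≤R (ℕP.*-monoʳ-≤ (4 * E) Cov.R≤E)

-- Counting points of boxes, completion to `l` summands, and the choice of constants

grid : ∀ {k} → Vec ℕ k → List (Vec ℕ k)
grid Vec.[]       = Vec.[] ∷ []
grid (N Vec.∷ Ns) = cartesianProductWith Vec._∷_ (upTo (suc N)) (grid Ns)

grid-below : ∀ {k} {Ns x : Vec ℕ k} → x ∈ grid Ns → Below x Ns
grid-below {Ns = Vec.[]} (here refl) = []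
grid-below {Ns = N Vec.∷ Ns} p with ∈-cartesianProductWith⁻ Vec._∷_ (upTo (suc N)) (grid Ns) p
... | a , x , a∈ , x∈ , refl = ℕP.<⇒≤pred (∈-upTo⁻ a∈) ∷ grid-below x∈

grid-unique : ∀ {k} (Ns : Vec ℕ k) → Unique (grid Ns)
grid-unique Vec.[]       = [] ∷ []
grid-unique (N Vec.∷ Ns) = UniqueP.cartesianProductWith⁺ Vec._∷_ (λ { refl → refl , refl }) (UniqueP.upTo⁺ (suc N)) (grid-unique Ns)

prodV≤grid : ∀ {k} (Ns : Vec ℕ k) → prodV Ns ≤ length (grid Ns)
prodV≤grid Vec.[]       = ℕP.≤-refl
prodV≤grid (N Vec.∷ Ns) = ℕP.≤-trans (ℕP.*-mono-≤ (ℕP.n≤1+n N) (prodV≤grid Ns))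
  (ℕP.≤-reflexive (sym (trans (length-cartesianProductWith Vec._∷_ (upTo (suc N)) (grid Ns)) (cong (_* length (grid Ns)) (ListP.length-upTo (suc N))))))

prodV-scale : ∀ {k} t (Ns : Vec ℕ k) → prodV (Vec.map (t *_) Ns) ≡ t ^ k * prodV Ns
prodV-scale t Vec.[]       = refl
prodV-scale {suc k} t (N Vec.∷ Ns) = trans (cong (t * N *_) (prodV-scale t Ns)) (lem t N (t ^ k) (prodV Ns))
  where
  lem : ∀ a b c d → a * b * (c * d) ≡ a * c * (b * d)
  lem = ring-ℕ

prodFin-lookup : ∀ {k} (Ns : Vec ℕ k) → prodFin k (Vec.lookup Ns) ≡ prodV Ns
prodFin-lookup Vec.[]       = refl
prodFin-lookup (N Vec.∷ Ns) = cong (N *_) (prodFin-lookup Ns)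

sumFin-dot : ∀ {k} (zs : Vec ℤ k) (f : Fin k → ℕ) → sumFinℤ k (λ i → pos (f i) ℤ.* Vec.lookup zs i) ≡ dot zs (posV (Vec.tabulate f))
sumFin-dot Vec.[]       f = refl
sumFin-dot (z Vec.∷ zs) f = cong₂ ℤ._+_ (ℤP.*-comm (pos (f Fin.zero)) z) (sumFin-dot zs (f ∘ Fin.suc))

coord-below : ∀ {k} (Ns : Vec ℕ k) (x : (i : Fin k) → Fin (suc (Vec.lookup Ns i))) → Below (Vec.tabulate (toℕ ∘ x)) Ns
coord-below Vec.[]       x = []
coord-below (N Vec.∷ Ns) x = FinP.toℕ≤pred[n] (x Fin.zero) ∷ coord-below Ns (x ∘ Fin.suc)

unique-++-disjoint : ∀ {xs ys : List ℕ} {z} → Unique (xs ++ ys) → z ∈ xs → z ∉ ys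
unique-++-disjoint {x ∷ xs} (p ∷ u) (here refl) q = All.lookup p (∈-++⁺ʳ xs q) refl
unique-++-disjoint {x ∷ xs} (p ∷ u) (there z∈)  q = unique-++-disjoint u z∈ q

-- The first `l` elements of `A` serve as a reservoir disjoint from `B`. The completion depends only
-- on the number of missing terms, so it merely translates the progression.
pad : ∀ {A l terms B} → Unique A → l ≤ length A → terms ≤ l → Rep terms (Data.List.drop l A) B →
  Rep l A (B ++ Data.List.take (l ∸ terms) (Data.List.take l A))
pad {A} {l} {terms} {B} u l≤A terms≤l (uB , aB , lB) =
  UniqueP.++⁺ uB (UniqueP.take⁺ (l ∸ terms) (UniqueP.take⁺ l u))
    (λ (p , q) → unique-++-disjoint (subst Unique (sym split) u) (take-⊑ (l ∸ terms) q) (All.lookup aB p))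
  , AllP.++⁺ (All.map (λ p → subst (_ ∈_) split (∈-++⁺ʳ (Data.List.take l A) p)) aB)
      (All.tabulate (λ q → subst (_ ∈_) split (∈-++⁺ˡ (take-⊑ (l ∸ terms) q))))
  , trans (ListP.length-++ B) (trans (cong₂ _+_ lB len) (ℕP.m+[n∸m]≡n terms≤l))
  where
  split : Data.List.take l A ++ Data.List.drop l A ≡ A
  split = ListP.take++drop≡id l A
  take-⊑ : ∀ n {xs : List ℕ} → Data.List.take n xs ⊑ xs
  take-⊑ n {xs} p = subst (_ ∈_) (ListP.take++drop≡id n xs) (∈-++⁺ˡ p)
  len : length (Data.List.take (l ∸ terms) (Data.List.take l A)) ≡ l ∸ terms
  len = trans (ListP.length-take (l ∸ terms) _) (trans (cong ((l ∸ terms) ℕ.⊓_) (trans (ListP.length-take l A) (ℕP.m≤n⇒m⊓n≡m l≤A)))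
    (ℕP.m≤n⇒m⊓n≡m (ℕP.m∸n≤m l terms)))

module Main (d : ℕ) where

  e D E γ₁ γ₄ W G ξ Lξ M : ℕ
  e  = suc d
  D  = suc (e + e)
  E  = 2 ^ e
  γ₁ = 2 ^ (1 * D)
  γ₄ = 2 ^ (4 * D)
  W  = 2 * (4 * (γ₁ * E) * E)
  G  = γ₄ * (4 * E)
  ξ  = 2 * (G * G)
  Lξ = GapConstants.L ξ
  M  = 8 * e

  E≥1 : 1 ≤ E
  E≥1 = ℕP.m^n>0 2 e

  γ₁≥1 : 1 ≤ γ₁
  γ₁≥1 = ℕP.m^n>0 2 (1 * D)

  W≥1 : 1 ≤ W
  W≥1 = ℕP.*-mono-≤ {1} {2} (s≤s z≤n) (ℕP.*-mono-≤ (ℕP.*-mono-≤ {1} {4} (s≤s z≤n) (ℕP.*-mono-≤ γ₁≥1 E≥1)) E≥1)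

  module Sized (c₁ K c₂ c₃ C : ℕ) (c₁≥1 : 1 ≤ c₁) (c₁-large : 8 * W * Lξ ≤ c₁)
    (K≥2 : 2 ≤ K) (K>W : 32 * W + 1 ≤ K) (K>c₁ : c₁ + 1 ≤ K) (K>E : 4 * E + 1 ≤ K)
    (c₂≡ : 4 * E * (G * 2 ^ ξ) ≡ c₂) (c₃≡ : 2 * c₂ * (4 * M * c₁) ^ e ≡ c₃)
    (C≥5 : 5 ≤ C) (C>K : 4 * (2 * M * K) ^ e < C) (C>c₃ : 2 * c₃ < C) (C>X : (M + 2 * c₂) ^ d < C) where

    module Instance (n l : ℕ) (n≥1 : 1 ≤ n) (l≥1 : 1 ≤ l) (A : List ℕ) (uA : Unique A)
      (range : All (λ a → 1 ≤ a × a ≤ n) A) (2l≤A : 2 * l ≤ length A) (dense : 2 * C * n ≤ l ^ d * length A) where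

      A₀ : List ℕ
      A₀ = Data.List.drop l A

      m : ℕ
      m = length A₀

      m≡ : m ≡ length A ∸ l
      m≡ = ListP.length-drop l A

      l≤A : l ≤ length A
      l≤A = ℕP.≤-trans (ℕP.m≤m+n l (l + 0)) 2l≤A

      l≤m : l ≤ m
      l≤m = subst (l ≤_) (sym m≡) (ℕP.m+n≤o⇒m≤o∸n l (ℕP.≤-trans (ℕP.≤-reflexive (cong (l +_) (sym (ℕP.+-identityʳ l)))) 2l≤A))

      A≤2m : length A ≤ 2 * m
      A≤2m = begin
        length A  ≡⟨ ℕP.m∸n+n≡m l≤A ⟨
        length A ∸ l + l  ≡⟨ cong (_+ l) m≡ ⟨
        m + l  ≤⟨ ℕP.+-monoʳ-≤ m l≤m ⟩
        m + m  ≡⟨ cong (m +_) (ℕP.+-identityʳ m) ⟨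
        2 * m  ∎
        where open ℕP.≤-Reasoning

      uA₀ : Unique A₀
      uA₀ = UniqueP.drop⁺ l uA

      A₀⊑A : A₀ ⊑ A
      A₀⊑A p = subst (_ ∈_) (ListP.take++drop≡id l A) (∈-++⁺ʳ (Data.List.take l A) p)

      A≤n : ∀ {a} → a ∈ A → a ≤ n
      A≤n p = proj₂ (All.lookup range p)

      m≤n : m ≤ n
      m≤n = subst (m ≤_) (trans (ListP.length-map suc (upTo n)) (ListP.length-upTo n)) (length-⊆ uA₀ sub)
        where
        sub : A₀ ⊑ map suc (upTo n)
        sub {zero}  p with () ← proj₁ (All.lookup range (A₀⊑A p))
        sub {suc a} p = ∈-map⁺ suc (∈-upTo⁺ (A≤n (A₀⊑A p)))

      dense₀ : C * n ≤ l ^ d * m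
      dense₀ = ℕP.*-cancelˡ-≤ 2 (begin
        2 * (C * n)  ≡⟨ ℕP.*-assoc 2 C n ⟨
        2 * C * n  ≤⟨ dense ⟩
        l ^ d * length A  ≤⟨ ℕP.*-monoʳ-≤ (l ^ d) A≤2m ⟩
        l ^ d * (2 * m)  ≡⟨ lem (l ^ d) m ⟩
        2 * (l ^ d * m)  ∎)
        where
        open ℕP.≤-Reasoning
        lem : ∀ a b → a * (2 * b) ≡ 2 * (a * b)
        lem = ring-ℕ

      m≥1 : 1 ≤ m
      m≥1 = ℕP.≤-trans l≥1 l≤m

      C≤l^d : C ≤ l ^ d
      C≤l^d = ℕP.*-cancelʳ-≤ C (l ^ d) m ⦃ ℕ.>-nonZero m≥1 ⦄ (ℕP.≤-trans (ℕP.*-monoʳ-≤ C m≤n) dense₀)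

      -- Since `m ≤ n`, density gives `C ≤ l^d`, so `l` exceeds every constant whose `d`-th power is
      -- below `C`. The term `M` is needed for a dyadic scale below `l`, the term `2 * c₂` to
      -- exclude rank zero.
      X<l : M + 2 * c₂ < l
      X<l = ℕP.≰⇒> λ l≤X → ℕP.<⇒≱ C>X
        (ℕP.≤-trans C≤l^d (^-mono d l≤X))

      scale-exponent : ∃ λ Λ → 2 ^ Λ * M ≤ l × l < 2 ^ suc Λ * M
      scale-exponent = dyadic M (s≤s z≤n) l (ℕP.≤-trans (ℕP.m≤m+n M (2 * c₂)) (ℕP.<⇒≤ X<l))

      Λ : ℕ
      Λ = proj₁ scale-exponent

      module FromScale (scale : RobustScale d K Λ A₀) where

        open RobustScale scale

        j ρ Q vol₀ s : ℕ
        j    = 2 ^ i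
        ρ    = 2 ^ v
        -- Chosen so that `2 j Q = ρ`. With degrees capped at about `vol₀ / Q`, the at most `j vol₀`
        -- incidences of the family saturate no more than `ρ` elements.
        Q    = 2 ^ (v ∸ suc i)
        vol₀ = length (V j A₁)
        s    = 4 ^ i

        s≡ : s ≡ j * j
        s≡ = 4^≡ i

        s≥1 : 1 ≤ s
        s≥1 = ℕP.m^n>0 4 i

        j≥1 : 1 ≤ j
        j≥1 = ℕP.m^n>0 2 i

        private instance
          j≢0 : NonZero j
          j≢0 = ℕ.>-nonZero j≥1

        room-for : ∀ k → k + 1 ≤ K → k * s < ρ
        room-for k h = ℕP.≤-trans (ℕP.≤-trans (ℕP.+-monoˡ-≤ (k * s) s≥1) (ℕP.≤-trans (ℕP.≤-reflexive (lem k s)) (ℕP.*-monoˡ-≤ s h))) room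
          where
          lem : ∀ k s → s + k * s ≡ (k + 1) * s
          lem = ring-ℕ

        i<v : suc i ≤ v
        i<v = ℕP.≮⇒≥ λ v<si → ℕP.<⇒≱ (ℕP.<-≤-trans (ℕP.^-monoʳ-< 2 (s≤s (s≤s z≤n)) v<si) (begin
          2 * j  ≤⟨ ℕP.*-monoʳ-≤ 2 (^-mono i (s≤s (s≤s z≤n))) ⟩
          2 * s  ≤⟨ ℕP.*-monoˡ-≤ s K≥2 ⟩
          K * s  ≤⟨ room ⟩
          ρ  ∎)) ℕP.≤-refl
          where open ℕP.≤-Reasoning

        2jQ≡ρ : 2 * (j * Q) ≡ ρ
        2jQ≡ρ = trans (sym (ℕP.*-assoc 2 j Q)) (trans (sym (ℕP.^-distribˡ-+-* 2 (suc i) (v ∸ suc i))) (cong (2 ^_) (ℕP.m+[n∸m]≡n i<v)))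

        below-Q : ∀ {k} a → k * s < ρ → a * 2 * (j * j) ≤ k * s → a * j < Q
        below-Q {k} a h h' = ℕP.*-cancelˡ-< (2 * j) _ _ (begin-strict
          2 * j * (a * j)  ≡⟨ lem j a ⟩
          a * 2 * (j * j)  ≤⟨ h' ⟩
          k * s  <⟨ h ⟩
          ρ  ≡⟨ 2jQ≡ρ ⟨
          2 * (j * Q)  ≡⟨ ℕP.*-assoc 2 j Q ⟨
          2 * j * Q  ∎)
          where
          open ℕP.≤-Reasoning
          lem : ∀ j a → 2 * j * (a * j) ≡ a * 2 * (j * j)
          lem = ring-ℕ

        ρ≤l : ρ ≤ l
        ρ≤l = ℕP.≤-trans (ℕP.^-monoʳ-≤ 2 v≤Λ) (ℕP.≤-trans (ℕP.m≤m*n (2 ^ Λ) M) (proj₁ (proj₂ scale-exponent)))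

        m≤2V : m ≤ 2 * vol₀
        m≤2V = ℕP.≤-trans half (ℕP.*-monoʳ-≤ 2 A₁≤V)

        V≥1 : 1 ≤ vol₀
        V≥1 = ℕP.*-cancelˡ-< 2 0 vol₀ (ℕP.≤-trans m≥1 m≤2V)

        Q≤ρ : 2 * Q ≤ ρ
        Q≤ρ = ℕP.≤-trans (ℕP.*-monoʳ-≤ 2 (ℕP.m≤n*m Q j)) (ℕP.≤-reflexive 2jQ≡ρ)

        wide : 2 * (j * E) ≤ Q
        wide = ℕP.≤-trans (ℕP.≤-reflexive (l₁ j E)) (ℕP.<⇒≤ (below-Q {4 * E} (2 * E) (room-for (4 * E) K>E)
          (ℕP.≤-reflexive (trans (cong (_* (j * j)) (l₂ E)) (cong (4 * E *_) (sym s≡))))))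
          where
          l₁ : ∀ j E → 2 * (j * E) ≡ 2 * E * j
          l₁ = ring-ℕ
          l₂ : ∀ E → 2 * E * 2 ≡ 4 * E
          l₂ = ring-ℕ

        eight : W * (8 * (j + j)) < Q
        eight = ℕP.≤-<-trans (ℕP.≤-reflexive (l₁ W j)) (below-Q {32 * W} (16 * W) (room-for (32 * W) K>W)
          (ℕP.≤-reflexive (trans (cong (_* (j * j)) (l₂ W)) (cong (32 * W *_) (sym s≡)))))
          where
          open ℕP.≤-Reasoning
          l₁ : ∀ W j → W * (8 * (j + j)) ≡ 16 * W * j
          l₁ = ring-ℕ
          l₂ : ∀ W → 16 * W * 2 ≡ 32 * W
          l₂ = ring-ℕ

        c₁s≥1 : 1 ≤ c₁ * s
        c₁s≥1 = ℕP.*-mono-≤ c₁≥1 s≥1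

        private instance
          c₁s≢0 : NonZero (c₁ * s)
          c₁s≢0 = ℕ.>-nonZero c₁s≥1

        c₁s<ρ : c₁ * s < ρ
        c₁s<ρ = room-for c₁ K>c₁

        abstract
          t : ℕ
          -- The largest `t` with `c₁ t s < ρ`; the predecessor makes the inequality strict.
          t = ℕ.pred ρ ℕDM./ (c₁ * s)

          ρ≡ : suc (ℕ.pred ρ) ≡ ρ
          ρ≡ = ℕP.suc-pred ρ ⦃ ℕP.m^n≢0 2 v ⦄

          t≥1 : 1 ≤ t
          t≥1 = ℕDM.m≥n⇒m/n>0 (ℕP.<⇒≤pred c₁s<ρ)

          t-small : c₁ * t * s < ρ
          t-small = subst (c₁ * t * s <_) ρ≡ (s≤s (ℕP.≤-trans (ℕP.≤-reflexive (lem c₁ t s)) (ℕDM.m/n*n≤m (ℕ.pred ρ) (c₁ * s))))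
            where
            lem : ∀ a b c → a * b * c ≡ b * (a * c)
            lem = ring-ℕ

          t-large : ρ ≤ 2 * c₁ * t * s
          t-large = begin
            ρ  ≡⟨ ρ≡ ⟨
            suc (ℕ.pred ρ)  ≡⟨ cong suc (ℕDM.m≡m%n+[m/n]*n (ℕ.pred ρ) (c₁ * s)) ⟩
            suc (ℕ.pred ρ ℕDM.% (c₁ * s)) + t * (c₁ * s)  ≤⟨ ℕP.+-monoˡ-≤ (t * (c₁ * s)) (ℕDM.m%n<n (ℕ.pred ρ) (c₁ * s)) ⟩
            c₁ * s + t * (c₁ * s)  ≤⟨ ℕP.+-monoˡ-≤ (t * (c₁ * s)) (ℕP.m≤n*m (c₁ * s) t ⦃ ℕ.>-nonZero t≥1 ⦄) ⟩
            t * (c₁ * s) + t * (c₁ * s)  ≡⟨ lem c₁ t s ⟩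
            2 * c₁ * t * s  ∎
            where
            open ℕP.≤-Reasoning
            lem : ∀ a b c → b * (a * c) + b * (a * c) ≡ 2 * a * b * c
            lem = ring-ℕ

        abstract
          terms : ℕ
          terms = Lξ * t * 2 * (j + j)

          terms-small : W * terms < Q
          terms-small = ℕP.≤-<-trans (ℕP.≤-reflexive (l₁ W Lξ t j)) (below-Q {c₁ * t} (4 * W * Lξ * t) t-small (begin
              4 * W * Lξ * t * 2 * (j * j)  ≡⟨ cong₂ _*_ (l₂ W Lξ t) (sym s≡) ⟩
              8 * W * Lξ * t * s  ≤⟨ ℕP.*-monoˡ-≤ s (ℕP.*-monoˡ-≤ t c₁-large) ⟩
              c₁ * t * s  ∎))
            where
            open ℕP.≤-Reasoning
            l₁ : ∀ W L t j → W * (L * t * 2 * (j + j)) ≡ 4 * W * L * t * j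
            l₁ = ring-ℕ
            l₂ : ∀ W L t → 4 * W * L * t * 2 ≡ 8 * W * L * t
            l₂ = ring-ℕ

        terms≤l : terms ≤ l
        terms≤l = ℕP.≤-trans (ℕP.m≤n*m terms W ⦃ ℕ.>-nonZero W≥1 ⦄) (ℕP.≤-trans (ℕP.<⇒≤ terms-small)
          (ℕP.≤-trans (ℕP.m≤n*m Q 2) (ℕP.≤-trans Q≤ρ ρ≤l)))

        abstract
          gap : ∃ λ size → vol₀ ≤ 4 * E * (G * size) × DistinctGap A₁ ξ t size terms
          gap = length Co.Cov.E , Co.v≤E , Co.distinctGap t t≥1 terms-small
            where
            double : length (V (j + j) A₁) ≤ γ₁ * vol₀
            double = subst (λ k → length (V k A₁) ≤ γ₁ * vol₀) (cong (j +_) (ℕP.+-identityʳ j)) (growth 1)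
            sixteen : length (V (8 * (j + j)) A₁) ≤ γ₄ * vol₀
            sixteen = subst (λ k → length (V k A₁) ≤ γ₄ * vol₀) (lem j) (growth 4)
              where
              lem : ∀ j → 2 * (2 * (2 * (2 * j))) ≡ 8 * (j + j)
              lem = ring-ℕ
            module Co = Combine A₁ A₁-unique j ρ Q E γ₁ γ₄ E≥1 γ₁≥1 V≥1 (ℕP.m^n>0 2 (v ∸ suc i))
              (ℕP.≤-trans Q≤ρ (ℕP.≤-trans ρ≤l (ℕP.≤-trans l≤m m≤2V))) (ℕP.≤-reflexive 2jQ≡ρ) robust double sixteen wide eight

        module FromGap (t : ℕ) (t≥1 : 1 ≤ t) (t-large : ρ ≤ 2 * c₁ * t * s) (terms : ℕ) (terms≤l : terms ≤ l)
          (size : ℕ) (vol₀≤ : vol₀ ≤ 4 * E * (G * size)) (dg : DistinctGap A₁ ξ t size terms) where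

          open DistinctGap dg

          bounds : Vec ℕ rank
          bounds = Vec.map (t *_) Ns

          padding : ℕ
          padding = sum (Data.List.take (l ∸ terms) (Data.List.take l A))

          origin : ℤ
          origin = shift ℤ.+ pos padding

          represent-l : ∀ {x} → Below x bounds → ∃ λ B → Rep l A B × dot zs (posV x) ℤ.+ origin ≡ pos (sum B)
          represent-l {x} bx with represent bx
          ... | B , r , eq = B ++ Data.List.take (l ∸ terms) (Data.List.take l A) , pad uA l≤A terms≤l (rep-mono A₁⊑A r)
            , trans (sym (ℤP.+-assoc (dot zs (posV x)) shift (pos padding))) (trans (cong (ℤ._+ pos padding) eq)
                (trans (sym (ℤP.pos-+ (sum B) padding)) (cong pos (sym (SumP.sum-++ B _)))))

          -- Distinct points of the box give distinct sums of `l` elements of `A`, all in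
          -- `[0, l n]`.
          volume≤ : prodV bounds ≤ 2 * (l * n)
          volume≤ = begin
            prodV bounds  ≤⟨ prodV≤grid bounds ⟩
            length (grid bounds)  ≤⟨ length-inj value (grid-unique bounds) inj mem ⟩
            length (upTo (suc (l * n)))  ≡⟨ ListP.length-upTo (suc (l * n)) ⟩
            suc (l * n)  ≤⟨ ℕP.+-monoˡ-≤ (l * n) (ℕP.*-mono-≤ l≥1 n≥1) ⟩
            l * n + l * n  ≡⟨ cong (l * n +_) (ℕP.+-identityʳ (l * n)) ⟨
            2 * (l * n)  ∎
            where
            open ℕP.≤-Reasoning
            value : Vec ℕ rank → ℕ
            value x = ∣ dot zs (posV x) ℤ.+ origin ∣
            value≡ : ∀ {x} → Below x bounds → pos (value x) ≡ dot zs (posV x) ℤ.+ origin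
            value≡ bx with represent-l bx
            ... | B , _ , eq = trans (cong (pos ∘ ∣_∣) eq) (sym eq)
            inj : ∀ {x y} → x ∈ grid bounds → y ∈ grid bounds → value x ≡ value y → x ≡ y
            inj x∈ y∈ eq = injective (grid-below x∈) (grid-below y∈)
              (ℤ-cancelʳ origin (trans (sym (value≡ (grid-below x∈))) (trans (cong pos eq) (value≡ (grid-below y∈)))))
            mem : ∀ {x} → x ∈ grid bounds → value x ∈ upTo (suc (l * n))
            mem x∈ with represent-l (grid-below x∈)
            ... | B , (_ , a , len) , eq = ∈-upTo⁺ (s≤s (subst₂ _≤_ (sym (cong ∣_∣ eq)) (cong (_* n) len) (sum-bound B (All.map A≤n a))))

          P : ℕ
          P = prodV Ns

          V≤P : vol₀ ≤ c₂ * P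
          V≤P = ℕP.≤-trans vol₀≤ (ℕP.≤-trans (ℕP.*-monoʳ-≤ (4 * E) (ℕP.*-monoʳ-≤ G size≤)) (ℕP.≤-reflexive (trans (lem (4 * E) G (2 ^ ξ) P) (cong (_* P) c₂≡))))
            where
            lem : ∀ a b c p → a * (b * (c * p)) ≡ a * (b * c) * p
            lem = ring-ℕ

          -- `large` is the case of exponent `e`. Smaller exponents follow because `ρ ≤ s L`, so
          -- omitting factors `ρ / (s L)` on the larger side only helps. Exponent `e` will bound the
          -- rank, exponent `rank` the volume.
          volume-bound : ∀ r → r ≤ e → l ^ r * m ≤ c₃ * (t ^ r * P)
          volume-bound r r≤e = begin
              l ^ r * m  ≤⟨ ℕP.*-monoˡ-≤ m (^-mono r l≤) ⟩
              (2 * M * L) ^ r * m  ≡⟨ trans (cong (_* m) (^-distrib-* (2 * M) L r)) (l₁ ((2 * M) ^ r) (L ^ r) m) ⟩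
              (2 * M) ^ r * (m * L ^ r)  ≤⟨ ℕP.*-monoʳ-≤ ((2 * M) ^ r) cancelled ⟩
              (2 * M) ^ r * (2 * vol₀ * (2 * c₁ * t) ^ r)  ≡⟨ powers ⟩
              2 * vol₀ * (4 * M * c₁) ^ r * t ^ r  ≤⟨ ℕP.*-monoˡ-≤ (t ^ r) (ℕP.*-mono-≤ (ℕP.*-monoʳ-≤ 2 V≤P) (ℕP.^-monoʳ-≤ (4 * M * c₁) ⦃ ℕ.>-nonZero (ℕP.*-mono-≤ {1} {4 * M} (s≤s z≤n) c₁≥1) ⦄ r≤e)) ⟩
              2 * (c₂ * P) * (4 * M * c₁) ^ e * t ^ r  ≡⟨ trans (l₂ c₂ P ((4 * M * c₁) ^ e) (t ^ r)) (cong (_* (t ^ r * P)) c₃≡) ⟩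
              c₃ * (t ^ r * P)  ∎
            where
            open ℕP.≤-Reasoning
            L = 2 ^ Λ
            l≤ : l ≤ 2 * M * L
            l≤ = ℕP.≤-trans (ℕP.<⇒≤ (proj₂ (proj₂ scale-exponent))) (ℕP.≤-reflexive (lem L M))
              where
              lem : ∀ a b → 2 * a * b ≡ 2 * b * a
              lem = ring-ℕ
            l₁ : ∀ a b c → a * b * c ≡ a * (c * b)
            l₁ = ring-ℕ
            l₂ : ∀ a p b t → 2 * (a * p) * b * t ≡ 2 * a * b * (t * p)
            l₂ = ring-ℕ
            l₃ : ∀ a b c d → a * (2 * b * (c * d)) ≡ 2 * b * (a * c) * d
            l₃ = ring-ℕ
            l₄ : ∀ m c → 2 * m * (2 * c) ≡ 4 * m * c
            l₄ = ring-ℕ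
            powers : (2 * M) ^ r * (2 * vol₀ * (2 * c₁ * t) ^ r) ≡ 2 * vol₀ * (4 * M * c₁) ^ r * t ^ r
            powers = trans (cong (λ q → (2 * M) ^ r * (2 * vol₀ * q)) (^-distrib-* (2 * c₁) t r))
              (trans (l₃ ((2 * M) ^ r) vol₀ ((2 * c₁) ^ r) (t ^ r))
                (cong (λ q → 2 * vol₀ * q * t ^ r) (trans (sym (^-distrib-* (2 * M) (2 * c₁) r)) (cong (_^ r) (l₄ M c₁)))))
            sL : ℕ
            sL = s * L
            ρ≤sL : ρ ≤ sL
            ρ≤sL = ℕP.≤-trans (ℕP.^-monoʳ-≤ 2 v≤Λ) (ℕP.m≤n*m L s ⦃ ℕ.>-nonZero s≥1 ⦄)
            e≡ : r + (e ∸ r) ≡ e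
            e≡ = ℕP.m+[n∸m]≡n r≤e
            lowered : m * sL ^ r ≤ 2 * (vol₀ * ρ ^ r)
            lowered = ℕP.*-cancelʳ-≤ _ _ (sL ^ (e ∸ r)) ⦃ ℕP.m^n≢0 sL (e ∸ r) ⦃ ℕ.>-nonZero (ℕP.*-mono-≤ s≥1 (ℕP.m^n>0 2 Λ)) ⦄ ⦄ (begin
              m * sL ^ r * sL ^ (e ∸ r)  ≡⟨ trans (ℕP.*-assoc m _ _) (cong (m *_) (trans (sym (ℕP.^-distribˡ-+-* sL r (e ∸ r))) (cong (sL ^_) e≡))) ⟩
              m * sL ^ e  ≤⟨ large ⟩
              2 * (vol₀ * ρ ^ e)  ≡⟨ cong (λ q → 2 * (vol₀ * q)) (trans (cong (ρ ^_) (sym e≡)) (ℕP.^-distribˡ-+-* ρ r (e ∸ r))) ⟩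
              2 * (vol₀ * (ρ ^ r * ρ ^ (e ∸ r)))  ≤⟨ ℕP.*-monoʳ-≤ 2 (ℕP.*-monoʳ-≤ vol₀ (ℕP.*-monoʳ-≤ (ρ ^ r) (^-mono (e ∸ r) ρ≤sL))) ⟩
              2 * (vol₀ * (ρ ^ r * sL ^ (e ∸ r)))  ≡⟨ lem vol₀ (ρ ^ r) (sL ^ (e ∸ r)) ⟩
              2 * (vol₀ * ρ ^ r) * sL ^ (e ∸ r)  ∎)
              where
              lem : ∀ a b c → 2 * (a * (b * c)) ≡ 2 * (a * b) * c
              lem = ring-ℕ
            cancelled : m * L ^ r ≤ 2 * vol₀ * (2 * c₁ * t) ^ r
            cancelled = ℕP.*-cancelʳ-≤ _ _ (s ^ r) ⦃ ℕP.m^n≢0 s r ⦃ ℕ.>-nonZero s≥1 ⦄ ⦄ (begin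
              m * L ^ r * s ^ r  ≡⟨ trans (ℕP.*-assoc m _ _) (cong (m *_) (trans (ℕP.*-comm (L ^ r) _) (sym (^-distrib-* s L r)))) ⟩
              m * sL ^ r  ≤⟨ lowered ⟩
              2 * (vol₀ * ρ ^ r)  ≤⟨ ℕP.*-monoʳ-≤ 2 (ℕP.*-monoʳ-≤ vol₀ (^-mono r t-large)) ⟩
              2 * (vol₀ * (2 * c₁ * t * s) ^ r)  ≡⟨ cong (λ q → 2 * (vol₀ * q)) (^-distrib-* (2 * c₁ * t) s r) ⟩
              2 * (vol₀ * ((2 * c₁ * t) ^ r * s ^ r))  ≡⟨ lem vol₀ ((2 * c₁ * t) ^ r) (s ^ r) ⟩
              2 * vol₀ * (2 * c₁ * t) ^ r * s ^ r  ∎)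
              where
              lem : ∀ a b c → 2 * (a * (b * c)) ≡ 2 * a * b * c
              lem = ring-ℕ

          -- A rank above `d` would give volume at least `t^e P`, which is at least `l^e m / c₃` and
          -- by density at least `C l n / c₃`. The interval that holds all the sums has no room for
          -- this.
          rank≤d : rank ≤ d
          rank≤d = ℕP.≮⇒≥ λ d<rank → ℕP.<⇒≱ C>c₃ (ℕP.*-cancelʳ-≤ C (2 * c₃) (l * n) ⦃ ℕ.>-nonZero (ℕP.*-mono-≤ l≥1 n≥1) ⦄ (begin
              C * (l * n)  ≡⟨ l₁ C l n ⟩
              l * (C * n)  ≤⟨ ℕP.*-monoʳ-≤ l dense₀ ⟩
              l * (l ^ d * m)  ≡⟨ ℕP.*-assoc l (l ^ d) m ⟨
              l ^ e * m  ≤⟨ volume-bound e ℕP.≤-refl ⟩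
              c₃ * (t ^ e * P)  ≤⟨ ℕP.*-monoʳ-≤ c₃ (ℕP.*-monoˡ-≤ P (ℕP.^-monoʳ-≤ t ⦃ ℕ.>-nonZero t≥1 ⦄ d<rank)) ⟩
              c₃ * (t ^ rank * P)  ≡⟨ cong (c₃ *_) (prodV-scale t Ns) ⟨
              c₃ * prodV bounds  ≤⟨ ℕP.*-monoʳ-≤ c₃ volume≤ ⟩
              c₃ * (2 * (l * n))  ≡⟨ l₂ c₃ (l * n) ⟩
              2 * c₃ * (l * n)  ∎))
            where
            open ℕP.≤-Reasoning
            l₁ : ∀ a b c → a * (b * c) ≡ b * (a * c)
            l₁ = ring-ℕ
            l₂ : ∀ a b → a * (2 * b) ≡ 2 * a * b
            l₂ = ring-ℕ

          -- In rank zero `vol₀ ≤ c₂`, but `l ≤ m ≤ 2 vol₀` and `l` exceeds `2 c₂`.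
          rank≥1 : 1 ≤ rank
          rank≥1 = positive rank Ns V≤P
            where
            positive : ∀ r (Ns : Vec ℕ r) → vol₀ ≤ c₂ * prodV Ns → 1 ≤ r
            positive (suc r) _ _ = s≤s z≤n
            positive zero Vec.[] h = ⊥-elim (ℕP.<⇒≱ X<l (ℕP.≤-trans l≤m (ℕP.≤-trans m≤2V (ℕP.≤-trans (ℕP.*-monoʳ-≤ 2 (ℕP.≤-trans h (ℕP.≤-reflexive (ℕP.*-identityʳ c₂)))) (ℕP.m≤n+m (2 * c₂) M)))))

          Gap : GAP rank
          Gap = mkGAP origin (Vec.lookup zs) (Vec.lookup bounds)

          coords : Coord Gap → Vec ℕ rank
          coords x = Vec.tabulate (toℕ ∘ x)

          eval≡ : ∀ x → eval Gap x ≡ dot zs (posV (coords x)) ℤ.+ origin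
          eval≡ x = trans (cong (λ w → origin ℤ.+ w) (sumFin-dot zs (toℕ ∘ x))) (ℤP.+-comm origin _)

          coords-below : ∀ x → Below (coords x) bounds
          coords-below x = coord-below bounds x

          proper : Proper Gap
          proper x y eq i = trans (sym (VecP.lookup∘tabulate (toℕ ∘ x) i)) (trans (cong (λ u → Vec.lookup u i)
            (injective (coords-below x) (coords-below y) (ℤ-cancelʳ origin (trans (sym (eval≡ x)) (trans eq (eval≡ y))))))
            (VecP.lookup∘tabulate (toℕ ∘ y) i))

          subset : GAPSubset Gap (InSumset l A)
          subset x with represent-l (coords-below x)
          ... | B , (uB , aB , lB) , eq = sum B , (B , uB , aB , lB , refl) , trans (eval≡ x) eq

          volume-large : l ^ rank * length A ≤ 2 * c₃ * volume Gap
          volume-large = begin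
            l ^ rank * length A  ≤⟨ ℕP.*-monoʳ-≤ (l ^ rank) A≤2m ⟩
            l ^ rank * (2 * m)  ≡⟨ l₁ (l ^ rank) m ⟩
            2 * (l ^ rank * m)  ≤⟨ ℕP.*-monoʳ-≤ 2 (volume-bound rank (ℕP.m≤n⇒m≤1+n rank≤d)) ⟩
            2 * (c₃ * (t ^ rank * P))  ≡⟨ cong (λ q → 2 * (c₃ * q)) (sym (trans (prodFin-lookup bounds) (prodV-scale t Ns))) ⟩
            2 * (c₃ * volume Gap)  ≡⟨ ℕP.*-assoc 2 c₃ (volume Gap) ⟨
            2 * c₃ * volume Gap  ∎
            where
            open ℕP.≤-Reasoning
            l₁ : ∀ a b → a * (2 * b) ≡ 2 * (a * b)
            l₁ = ring-ℕ

          conclusion : Σ ℕ λ d' → 1 ≤ d' × d' ≤ d × Σ (GAP d') λ Q →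
            Proper Q × GAPSubset Q (InSumset l A) × l ^ d' * length A ≤ 2 * c₃ * volume Q
          conclusion = rank , rank≥1 , rank≤d , Gap , proper , subset , volume-large

        conclusion : Σ ℕ λ d' → 1 ≤ d' × d' ≤ d × Σ (GAP d') λ Q →
          Proper Q × GAPSubset Q (InSumset l A) × l ^ d' * length A ≤ 2 * c₃ * volume Q
        conclusion = FromGap.conclusion t t≥1 t-large terms terms≤l (proj₁ gap) (proj₁ (proj₂ gap)) (proj₂ (proj₂ gap))

      robust-scale : RobustScale d K Λ A₀
      robust-scale = Scale.robustScale d K C K≥2 C≥5 C>K
        n l n≥1 l≥1 A₀ uA₀ (A≤n ∘ A₀⊑A) l≤m dense₀ Λ (proj₁ (proj₂ scale-exponent)) (proj₂ (proj₂ scale-exponent))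

      conclusion : Σ ℕ λ d' → 1 ≤ d' × d' ≤ d × Σ (GAP d') λ Q →
        Proper Q × GAPSubset Q (InSumset l A) × l ^ d' * length A ≤ 2 * c₃ * volume Q
      conclusion = FromScale.conclusion robust-scale

  -- `c₁` keeps the number of summands below `Q / W`. `K` collects the demands on the budget:
  -- eightfold sums, `t ≥ 1`, and few intersecting members of the family. `c₂` compares `vol₀` with
  -- `prodV Ns`, and `c₃` compares `l^r m` with `t^r prodV Ns`. The summands of `C` serve `j<l`,
  -- `room`, `rank≤d` and `X<l` in this order.
  c₁ K c₂ c₃ C : ℕ
  c₁ = 8 * W * suc Lξ
  K  = 32 * W + c₁ + 4 * E + 2
  c₂ = 4 * E * (G * 2 ^ ξ)
  c₃ = 2 * c₂ * (4 * M * c₁) ^ e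
  C  = 6 + 4 * (2 * M * K) ^ e + 2 * c₃ + (M + 2 * c₂) ^ d

  c₁≥1 : 1 ≤ c₁
  c₁≥1 = ℕP.*-mono-≤ {1} {8 * W} (ℕP.*-mono-≤ {1} {8} (s≤s z≤n) W≥1) (s≤s z≤n)

  c₃≥1 : 1 ≤ 2 * c₃
  c₃≥1 = ℕP.*-mono-≤ {1} {2} (s≤s z≤n) (ℕP.*-mono-≤ (ℕP.*-mono-≤ {1} {2} (s≤s z≤n) c₂≥1)
    (ℕP.m^n>0 (4 * M * c₁) ⦃ ℕ.>-nonZero (ℕP.*-mono-≤ {1} {4 * M} (s≤s z≤n) c₁≥1) ⦄ e))
    where
    c₂≥1 : 1 ≤ c₂
    c₂≥1 = ℕP.*-mono-≤ (ℕP.*-mono-≤ {1} {4} (s≤s z≤n) E≥1)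
      (ℕP.*-mono-≤ (ℕP.*-mono-≤ (ℕP.m^n>0 2 (4 * D)) (ℕP.*-mono-≤ {1} {4} (s≤s z≤n) E≥1)) (ℕP.m^n>0 2 ξ))

  summand : ∀ a b c d → (a ≤ a + b + c + d) × (b ≤ a + b + c + d) × (c ≤ a + b + c + d) × (d ≤ a + b + c + d)
  summand a b c d = ℕP.≤-trans (ℕP.m≤m+n a b) ab≤ , ℕP.≤-trans (ℕP.m≤n+m b a) ab≤
    , ℕP.≤-trans (ℕP.m≤n+m c (a + b)) (ℕP.m≤m+n (a + b + c) d) , ℕP.m≤n+m d (a + b + c)
    where
    ab≤ : a + b ≤ a + b + c + d
    ab≤ = ℕP.≤-trans (ℕP.m≤m+n (a + b) c) (ℕP.m≤m+n (a + b + c) d)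

  K-bounds : ∀ a b c → (a + 1 ≤ a + b + c + 2) × (b + 1 ≤ a + b + c + 2) × (c + 1 ≤ a + b + c + 2)
  K-bounds a b c = up (ℕP.≤-trans (ℕP.m≤m+n a b) (ℕP.m≤m+n (a + b) c)) , up (ℕP.≤-trans (ℕP.m≤n+m b a) (ℕP.m≤m+n (a + b) c)) , up (ℕP.m≤n+m c (a + b))
    where
    up : ∀ {x y} → x ≤ y → x + 1 ≤ y + 2
    up h = ℕP.+-mono-≤ h (s≤s z≤n)

  C-bounds : ∀ a b c → (5 ≤ 6 + a + b + c) × (a < 6 + a + b + c) × (b < 6 + a + b + c) × (c < 6 + a + b + c)
  C-bounds a b c = let p , q , r , s = summand 5 a b c in ℕP.m≤n⇒m≤1+n p , s≤s q , s≤s r , s≤s s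

  conclusion : (n l : ℕ) → 1 ≤ n → 1 ≤ l → (A : List ℕ) → IsFinSet A → SubsetOfRange n A →
    2 * l ≤ length A → 2 * C * n ≤ l ^ d * length A →
    Σ ℕ λ d' → 1 ≤ d' × d' ≤ d × Σ (GAP d') λ Q →
    Proper Q × GAPSubset Q (InSumset l A) × l ^ d' * length A ≤ 2 * c₃ * volume Q
  conclusion =
    let K>W , K>c₁ , K>E = K-bounds (32 * W) c₁ (4 * E)
        C≥5 , C>K , C>c₃ , C>X = C-bounds (4 * (2 * M * K) ^ e) (2 * c₃) ((M + 2 * c₂) ^ d)
    in Sized.Instance.conclusion c₁ K c₂ c₃ C c₁≥1 (ℕP.*-monoʳ-≤ (8 * W) (ℕP.n≤1+n Lξ)) (ℕP.m≤n+m 2 (32 * W + c₁ + 4 * E))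
      K>W K>c₁ K>E refl refl C≥5 C>K C>c₃ C>X

theorem7p1 : (d : ℕ) → 1 ≤ d →
    Σ ℕ λ C → 1 ≤ C × Σ ℕ λ K → 1 ≤ K ×
    ((n l : ℕ) → 1 ≤ n → 1 ≤ l → (A : List ℕ) → IsFinSet A → SubsetOfRange n A →
    2 * l ≤ length A → C * n ≤ l ^ d * length A →
    Σ ℕ λ d' → 1 ≤ d' × d' ≤ d × Σ (GAP d') λ Q →
    Proper Q × GAPSubset Q (InSumset l A) × l ^ d' * length A ≤ K * volume Q)
-- Both factors 2 pay for the `l` elements held back, which leave at least half of `A`.
theorem7p1 d _ = 2 * C , s≤s z≤n , 2 * c₃ , c₃≥1 , conclusion
  where open Main d
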